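{- Let $\Phi=(G,\hat{\mathbb V},\varphi)$ be a dual unit gain graph on $n$ vertices. Then $$\mathrm{Mdet}(A(\Phi))=\sum_{B\in\mathcal B_n(G)}(-1)^{n+p(B)}\,2^{c(B)}\,\mathcal R(B).$$ Furthermore, writing the characteristic polynomial of $A(\Phi)$ as $p_{A(\Phi)}(x)=x^n+\sum_{i=1}^n c_ix^{n-i}$, one has $$c_i=\sum_{B\in\mathcal B_i(G)}(-1)^{p(B)}\,2^{c(B)}\,\mathcal R(B),\qquad i=1,\dots,n.$$
   Context: Dual elements: $\mathbb G\in\{\mathbb R,\mathbb C,\mathbb H\}$; $\hat{\mathbb G}=\{a_s+a_d\epsilon:a_s,a_d\in\mathbb G\}$ with $\epsilon\ne0$, $\epsilon^2=0$, $\epsilon$ central, product $(a_s+a_d\epsilon)(b_s+b_d\epsilon)=a_sb_s+(a_sb_d+a_db_s)\epsilon$, conjugate $a^*=a_s^*+a_d^*\epsilon$. The real part is $Re(a)=Re(a_s)+Re(a_d)\epsilon\in\hat{\mathbb R}$ (real part of a quaternion = its scalar part). $\hat{\mathbb V}$ is the group of unit dual elements $p=p_s+p_d\epsilon$ ($|p_s|=1$, $p_sp_d^*+p_dp_s^*=0$). Gain graph: $G=(V,E)$ finite simple graph, $V=\{v_1,\dots,v_n\}$; each edge $v_iv_j$ gives oriented edges $e_{ij},e_{ji}$; $\varphi$ maps them to $\hat{\mathbb V}$ with $\varphi(e_{ji})=\varphi(e_{ij})^{ -1}$. $A(\Phi)=(a_{ij})$, $a_{ij}=\varphi(e_{ij})$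 if $v_iv_j\in E$, else $0$. For a cycle $C$ of $G$, $\mathcal R(C)=Re(\varphi(e_{u_1u_2})\varphi(e_{u_2u_3})\cdots\varphi(e_{u_lu_1}))$ where $u_1u_2\cdots u_lu_1$ is a traversal of $C$ (this does not depend on the starting vertex or direction). An elementary graph is $K_2$ or a cycle $C_r$ ($r\ge3$); a basic graph is a disjoint union of elementary graphs. $\mathcal B_i(G)$ is the set of subgraphs of $G$ that are basic graphs on $i$ vertices. For $B$ basic: $p(B)$ = number of components, $c(B)$ = number of cycle components ($C_r$, $r\ge3$), $\mathcal R(B)=\prod_{C}\mathcal R(C)$ over cycle components (empty product $=1$). Moore determinant: for $M=(m_{ij})\in\hat{\mathbb G}^{n\times n}$ and a permutation $\sigma$ of $\{1,\dots,n\}$, write $\sigma$ as a product of disjoint cycles (fixed points included) $\sigma=(n_{11}\cdots n_{1l_1})\cdots(n_{r1}\cdots n_{rl_r})$ with $n_{i1}<n_{ij}$ for $j>1$ and $n_{11}>n_{21}>\cdots>n_{r1}$; set $m_\sigma=(m_{n_{11}n_{12}}m_{n_{12}n_{13}}\cdots m_{n_{1l_1}n_{11}})\cdots(m_{n_{r1}n_{r2}}\cdots m_{n_{rl_r}n_{r1}})$ and $\mathrm{Mdet}(M)=\sum_\sigma \mathrm{sgn}(\sigma)m_\sigma$. The characteristic polynomial is $p_{A(\Phi)}(x)=\mathrm{Mdet}(xI_n-A(\Phi))$ with $x$ a central indeterminate. -}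

module Defs where

open import Level using (Level; _⊔_) renaming (suc to lsuc)
open import Data.Bool using (Bool; true; false; if_then_else_; _∧_; _∨_; not)
open import Data.Nat using (ℕ; zero; suc; _∸_; _≤ᵇ_; _≤_) renaming (_+_ to _+ℕ_)
open import Data.Fin using (Fin; toℕ; _≟_)
open import Data.Product using (_×_; _,_; proj₁; proj₂)
open import Data.List using (List; []; _∷_; map; concatMap; filterᵇ; length; foldr; allFin; reverse; upTo)
open import Data.Bool.ListAction using (all; any)
open import Data.List.Relation.Unary.All using (All)
open import Data.List.Relation.Unary.Unique.Propositional using (Unique)
open import Data.List.Relation.Unary.AllPairs using (AllPairs)
open import Data.List.Membership.Propositional using (_∈_)
open import Data.Vec using (Vec; lookup) renaming ([] to []ᵛ; _∷_ to _∷ᵛ_)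
open import Relation.Nullary using (¬_; does)
open import Relation.Binary.PropositionalEquality using (_≡_)
open import Algebra.Bundles using (CommutativeRing)
open import Algebra.Bundles.Raw using (RawRing)

module RR {c ℓ : Level} (Rr : RawRing c ℓ) where
  open RawRing Rr

  prodL : List Carrier → Carrier
  prodL = foldr _*_ 1#

  sumL : List Carrier → Carrier
  sumL = foldr _+_ 0#

  sumTo : ℕ → (ℕ → Carrier) → Carrier
  sumTo zero    f = f 0
  sumTo (suc k) f = sumTo k f + f (suc k)

isEven : ℕ → Bool
isEven zero    = true
isEven (suc n) = not (isEven n)

_==_ : {n : ℕ} → Fin n → Fin n → Bool
i == j = does (i ≟ j)

allVecs : (n k : ℕ) → List (Vec (Fin n) k)
allVecs n zero    = []ᵛ ∷ []
allVecs n (suc k) = concatMap (λ v → map (λ i → i ∷ᵛ v) (allFin n)) (allVecs n k)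

injᵇ : {n : ℕ} → Vec (Fin n) n → Bool
injᵇ {n} v = all (λ i → all (λ j → (i == j) ∨ not (lookup v i == lookup v j)) (allFin n)) (allFin n)

perms : (n : ℕ) → List (Fin n → Fin n)
perms n = map lookup (filterᵇ injᵇ (allVecs n n))

iter : {n : ℕ} → (Fin n → Fin n) → ℕ → Fin n → Fin n
iter σ zero    i = i
iter σ (suc k) i = σ (iter σ k i)

isLeader : {n : ℕ} → (Fin n → Fin n) → Fin n → Bool
isLeader {n} σ i = all (λ k → toℕ i ≤ᵇ toℕ (iter σ (suc k) i)) (upTo n)

leaders : {n : ℕ} → (Fin n → Fin n) → List (Fin n)
leaders {n} σ = filterᵇ (isLeader σ) (reverse (allFin n))

module MooreDet {c ℓ : Level} (Rr : RawRing c ℓ) where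
  open RawRing Rr
  open RR Rr

  -- m_{i σi} m_{σi σ²i} ⋯ m_{σ^{l-1}i i}  (fuel n suffices)
  cycleProd : {n : ℕ} → (Fin n → Fin n → Carrier) → (Fin n → Fin n) → Fin n → Carrier
  cycleProd {n} M σ i = go n i
    where
    go : ℕ → Fin n → Carrier
    go zero    j = 1#
    go (suc f) j = M j (σ j) * (if σ j == i then 1# else go f (σ j))

  mσ : {n : ℕ} → (Fin n → Fin n → Carrier) → (Fin n → Fin n) → Carrier
  mσ M σ = prodL (map (cycleProd M σ) (leaders σ))

  -- sgn σ = (-1)^(n - number of cycles)
  signed : {n : ℕ} → (Fin n → Fin n) → Carrier → Carrier
  signed {n} σ x = if isEven (n ∸ length (leaders σ)) then x else - x

  Mdet : (n : ℕ) → (Fin n → Fin n → Carrier) → Carrier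
  Mdet n M = sumL (map (λ σ → signed σ (mσ M σ)) (perms n))

-- Polynomials in a central indeterminate x over a raw ring:
-- a polynomial is its coefficient sequence (coefficient of x^k at k).

PolyRing : {c ℓ : Level} → RawRing c ℓ → RawRing c ℓ
PolyRing Rr = record
  { Carrier = ℕ → Carrier
  ; _≈_ = λ p q → ∀ k → p k ≈ q k
  ; _+_ = λ p q k → p k + q k
  ; _*_ = λ p q k → sumTo k (λ j → p j * q (k ∸ j))
  ; -_ = λ p k → - p k
  ; 0# = λ _ → 0#
  ; 1# = λ { zero → 1# ; (suc _) → 0# }
  }
  where open RawRing Rr
        open RR Rr

module PolyOps {c ℓ : Level} (Rr : RawRing c ℓ) where
  open RawRing Rr
  constP : Carrier → ℕ → Carrier
  constP a zero    = a
  constP a (suc _) = 0#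

  X : ℕ → Carrier
  X 1 = 1#
  X _ = 0#

module Algebras {c ℓ : Level} (R : CommutativeRing c ℓ) where
  module R = CommutativeRing R

  record StarAlg : Set (lsuc (c ⊔ ℓ)) where
    field
      raw  : RawRing c ℓ
    open RawRing raw
    field
      conj : Carrier → Carrier
      re   : Carrier → R.Carrier
      emb  : R.Carrier → Carrier

  baseAlg : StarAlg
  baseAlg = record { raw = R.rawRing ; conj = λ a → a ; re = λ a → a ; emb = λ a → a }

  -- Cayley–Dickson doubling: (a,b)(c,d) = (ac − d*b , da + bc*), (a,b)* = (a*, −b)
  CD : StarAlg → StarAlg
  CD A = record
    { raw = record
      { Carrier = Carrier × Carrier
      ; _≈_ = λ x y → (proj₁ x ≈ proj₁ y) × (proj₂ x ≈ proj₂ y)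
      ; _+_ = λ x y → (proj₁ x + proj₁ y , proj₂ x + proj₂ y)
      ; _*_ = λ x y → ( proj₁ x * proj₁ y + - (conj (proj₂ y) * proj₂ x)
                      , proj₂ y * proj₁ x + proj₂ x * conj (proj₁ y) )
      ; -_ = λ x → (- proj₁ x , - proj₂ x)
      ; 0# = (0# , 0#)
      ; 1# = (1# , 0#)
      }
    ; conj = λ x → (conj (proj₁ x) , - proj₂ x)
    ; re = λ x → re (proj₁ x)
    ; emb = λ r → (emb r , 0#)
    }
    where open StarAlg A
          open RawRing raw

  data Kind : Set where
    realK complexK quaternionK : Kind

  𝔾 : Kind → StarAlg
  𝔾 realK       = baseAlg
  𝔾 complexK    = CD baseAlg
  𝔾 quaternionK = CD (CD baseAlg)

  -- dual elements over a star algebra: a_s + a_d ε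
  Dual : StarAlg → RawRing c ℓ
  Dual A = record
    { Carrier = Carrier × Carrier
    ; _≈_ = λ x y → (proj₁ x ≈ proj₁ y) × (proj₂ x ≈ proj₂ y)
    ; _+_ = λ x y → (proj₁ x + proj₁ y , proj₂ x + proj₂ y)
    ; _*_ = λ x y → (proj₁ x * proj₁ y , proj₁ x * proj₂ y + proj₂ x * proj₁ y)
    ; -_ = λ x → (- proj₁ x , - proj₂ x)
    ; 0# = (0# , 0#)
    ; 1# = (1# , 0#)
    }
    where open StarAlg A
          open RawRing raw

  DualReal : RawRing c ℓ
  DualReal = Dual baseAlg

  module _ (A : StarAlg) where
    open StarAlg A
    open RawRing raw

    dualRe : Carrier × Carrier → R.Carrier × R.Carrier
    dualRe x = (re (proj₁ x) , re (proj₂ x))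

    dualEmb : R.Carrier × R.Carrier → Carrier × Carrier
    dualEmb r = (emb (proj₁ r) , emb (proj₂ r))

    -- unit dual element: |p_s| = 1 (i.e. p_s p_s* = 1) and p_s p_d* + p_d p_s* = 0
    IsUnitDual : Carrier × Carrier → Set ℓ
    IsUnitDual p = (proj₁ p * conj (proj₁ p) ≈ 1#)
                 × (proj₁ p * conj (proj₂ p) + proj₂ p * conj (proj₁ p) ≈ 0#)

record SimpleGraph (n : ℕ) : Set where
  field
    adj    : Fin n → Fin n → Bool
    sym    : ∀ i j → adj i j ≡ adj j i
    irrefl : ∀ i → adj i i ≡ false

module GainGraphs {c ℓ : Level} (R : CommutativeRing c ℓ) where
  open Algebras R

  module _ (k : Kind) where
    DG : RawRing c ℓ
    DG = Dual (𝔾 k)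
    open RawRing DG

    record GainGraph {n : ℕ} (G : SimpleGraph n) : Set (c ⊔ ℓ) where
      open SimpleGraph G
      field
        φ    : Fin n → Fin n → Carrier
        unit : ∀ i j → adj i j ≡ true → IsUnitDual (𝔾 k) (φ i j)
        inv  : ∀ i j → adj i j ≡ true → (φ j i * φ i j ≈ 1#) × (φ i j * φ j i ≈ 1#)

    module _ {n : ℕ} {G : SimpleGraph n} (Φ : GainGraph G) where
      open SimpleGraph G
      open GainGraph Φ

      adjMat : Fin n → Fin n → Carrier
      adjMat i j = if adj i j then φ i j else 0#

      charPoly : ℕ → Carrier
      charPoly = MooreDet.Mdet (PolyRing DG) n
        (λ i j → RawRing._+_ (PolyRing DG)
                   (if i == j then PolyOps.X DG else RawRing.0# (PolyRing DG))
                   (RawRing.-_ (PolyRing DG) (PolyOps.constP DG (adjMat i j))))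

      walkGain : List (Fin n) → Carrier
      walkGain []        = 1#
      walkGain (u ∷ us) = go u (u ∷ us)
        where
        go : Fin n → List (Fin n) → Carrier
        go first []            = 1#
        go first (x ∷ [])      = φ x first
        go first (x ∷ y ∷ r)   = φ x y * go first (y ∷ r)

-- Basic subgraphs of G, represented as a list of elementary components.
-- A K₂ component is given by its two end vertices; a cycle component
-- C_r (r ≥ 3) is given by a traversal u1 u2 ⋯ ur (closing edge ur u1).

data Elem (n : ℕ) : Set where
  k2  : Fin n → Fin n → Elem n
  cyc : List (Fin n) → Elem n

Basic : ℕ → Set
Basic n = List (Elem n)

elemVerts : {n : ℕ} → Elem n → List (Fin n)
elemVerts (k2 u v) = u ∷ v ∷ []
elemVerts (cyc l)  = l

cycEdges : {n : ℕ} → List (Fin n) → List (Fin n × Fin n)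
cycEdges []       = []
cycEdges (u ∷ us) = go u (u ∷ us)
  where
  go : _ → List _ → List _
  go first []          = []
  go first (x ∷ [])    = (x , first) ∷ []
  go first (x ∷ y ∷ r) = (x , y) ∷ go first (y ∷ r)

elemEdges : {n : ℕ} → Elem n → List (Fin n × Fin n)
elemEdges (k2 u v) = (u , v) ∷ []
elemEdges (cyc l)  = cycEdges l

ElemWF : {n : ℕ} → SimpleGraph n → Elem n → Set
ElemWF G (k2 u v) = SimpleGraph.adj G u v ≡ true
ElemWF G (cyc l)  = (3 ≤ length l) × Unique l
                  × All (λ e → SimpleGraph.adj G (proj₁ e) (proj₂ e) ≡ true) (cycEdges l)

basicVerts : {n : ℕ} → Basic n → List (Fin n)
basicVerts = concatMap elemVerts

basicEdges : {n : ℕ} → Basic n → List (Fin n × Fin n)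
basicEdges = concatMap elemEdges

BasicWF : {n : ℕ} → SimpleGraph n → Basic n → Set
BasicWF G B = All (ElemWF G) B × Unique (basicVerts B)

nVerts : {n : ℕ} → Basic n → ℕ
nVerts B = length (basicVerts B)

inV : {n : ℕ} → Basic n → Fin n → Bool
inV B v = any (λ w → v == w) (basicVerts B)

inE : {n : ℕ} → Basic n → Fin n → Fin n → Bool
inE B u v = any (λ e → ((proj₁ e == u) ∧ (proj₂ e == v)) ∨ ((proj₁ e == v) ∧ (proj₂ e == u))) (basicEdges B)

SameSubgraph : {n : ℕ} → Basic n → Basic n → Set
SameSubgraph B B' = (∀ v → inV B v ≡ inV B' v) × (∀ u v → inE B u v ≡ inE B' u v)

Enumerates𝓑 : {n : ℕ} → SimpleGraph n → ℕ → List (Basic n) → Set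
Enumerates𝓑 G i L =
    All (λ B → BasicWF G B × nVerts B ≡ i) L
  × (∀ B → BasicWF G B → nVerts B ≡ i → Data.List.Relation.Unary.Any.Any (SameSubgraph B) L)
  × AllPairs (λ B B' → ¬ SameSubgraph B B') L
  where import Data.List.Relation.Unary.Any

pB : {n : ℕ} → Basic n → ℕ
pB = length

isCyc : {n : ℕ} → Elem n → Bool
isCyc (k2 _ _) = false
isCyc (cyc _)  = true

cB : {n : ℕ} → Basic n → ℕ
cB B = length (filterᵇ isCyc B)

module Terms {c ℓ : Level} (R : CommutativeRing c ℓ) where
  open Algebras R
  open GainGraphs R
  open RawRing DualReal
  open RR DualReal

  module _ {k : Kind} {n : ℕ} {G : SimpleGraph n} (Φ : GainGraph k G) where

    elemR : Elem n → Carrier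
    elemR (k2 _ _) = 1#
    elemR (cyc l)  = dualRe (𝔾 k) (walkGain k Φ l)

    RB : Basic n → Carrier
    RB B = prodL (map elemR (filterᵇ isCyc B))

    pow2 : ℕ → Carrier
    pow2 zero    = 1#
    pow2 (suc m) = (1# + 1#) * pow2 m

    term : ℕ → Basic n → Carrier
    term e B = (if isEven e then (λ x → x) else -_) (pow2 (cB B) * RB B)

    basicSum : ℕ → List (Basic n) → Carrier
    basicSum shift L = sumL (map (λ B → term (shift +ℕ pB B) B) L)

{-# OPTIONS --safe #-}

-- Since A(Φ) is Hermitian, reversing a cycle of a permutation σ turns its factor w of m_σ into
-- w*, and w + w* = 2 Re w is real, hence central.  The permutations whose cycles of length ≥ 2
-- span a given basic subgraph B are the orientations of the cycle components of B.  Summing m_σ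
-- over them one component at a time, the component with smallest vertex m only changes the factor
-- at m, so 2 Re w can be pulled out of the ordered product whatever surrounds it; a component K₂
-- contributes φ(e)φ(e)⁻¹ = 1.  All other permutations use a non-edge and contribute 0.  For the
-- characteristic polynomial, m_σ is a monomial whose exponent is the number of fixed points of σ.
module Submission where

open import Defs
open import Level using (Level; 0ℓ; _⊔_)
open import Algebra.Bundles using (Ring; CommutativeRing; AbelianGroup)
open import Algebra.Bundles.Raw using (RawRing)
import Algebra.Construct.DirectProduct as DirectProduct
import Algebra.Properties.Ring as RingProperties
import Algebra.Solver.Ring.NaturalCoefficients.Default as SemiringSolver
open import Algebra.Structures using (IsMonoid; IsRing)
import Data.Bool as Bool
open import Data.Bool using (Bool; true; false; if_then_else_; _∧_; _∨_; not)
open import Data.Bool.ListAction using (all; any; and)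
open import Data.Bool.Properties using (T-≡; ∨-zeroʳ; ¬-not)
open import Data.Empty using (⊥; ⊥-elim)
open import Data.Fin using (Fin; toℕ; _≟_)
import Data.Fin.Properties as Fin
open import Data.List using (List; []; _∷_; [_]; map; concatMap; filterᵇ; length; _++_; allFin; reverse; upTo)
import Data.List.Properties as List
open import Data.List.Membership.Propositional using (_∈_; _∉_; find)
open import Data.List.Membership.Propositional.Properties using (∈-∃++; ∈-++⁺ˡ; ∈-++⁺ʳ; ∈-++⁻; ∈-map⁺; ∈-map⁻; ∈-upTo⁺; ∈-allFin; ∈-concat⁺′; ∈-concat⁻′)
open import Data.List.Relation.Binary.Permutation.Propositional as Perm using (_↭_; ↭-sym; ↭-refl; ↭-trans; ↭-reflexive; prep; ↭⇒↭ₛ)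
import Data.List.Relation.Binary.Permutation.Propositional.Properties as Perm
import Data.List.Relation.Binary.Permutation.Setoid.Properties as PermSetoid
open import Data.List.Relation.Binary.Pointwise using (Pointwise; []; _∷_; Pointwise-length)
open import Data.List.Relation.Unary.All as All using (All; []; _∷_)
import Data.List.Relation.Unary.All.Properties as All
open import Data.List.Relation.Unary.AllPairs as AllPairs using (AllPairs; []; _∷_)
import Data.List.Relation.Unary.AllPairs.Properties as AllPairs
open import Data.List.Relation.Unary.Any as Any using (here; there)
import Data.List.Relation.Unary.Any.Properties as Any
open import Data.List.Relation.Unary.Unique.Propositional using (Unique)
import Data.List.Relation.Unary.Unique.Propositional.Properties as Unique
import Data.Nat
open import Data.Nat using (ℕ; zero; suc; _≤_; _<_; _∸_; _≤ᵇ_; z≤n; s≤s) renaming (_+_ to _+ℕ_; _*_ to _*ℕ_)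
open import Data.Nat.ListAction using (sum)
open import Data.Nat.ListAction.Properties using (sum-↭; sum-++)
import Data.Nat.Properties as ℕ
open import Data.Nat.Solver using (module +-*-Solver)
open import Data.Product using (∃; _×_; _,_; proj₁; proj₂; swap)
open import Data.Sum using (_⊎_; inj₁; inj₂; [_,_]′)
open import Data.Vec using (Vec; lookup; tabulate) renaming ([] to []ᵛ; _∷_ to _∷ᵛ_)
import Data.Vec.Properties as Vec
open import Function using (_∘_; id)
open import Function.Bundles using (Equivalence)
open import Function.Definitions using (Injective)
open import Relation.Binary.PropositionalEquality as ≡ using (_≡_; _≢_; ≢-sym)
import Relation.Binary.Reasoning.Setoid as SetoidReasoning
open import Relation.Nullary using (¬_; Dec; yes; no; does)
open import Relation.Nullary.Decidable using (dec-true; dec-false)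

private
  variable
    a : Level
    A B : Set a
    n : ℕ

module CycleDecompositions where
  open ≡ using (refl; sym; trans; cong; cong₂; subst; setoid; module ≡-Reasoning)
  open +-*-Solver using (solve; _:+_; _:=_; con)
  open Data.Nat using (_+_; _*_)

  -- Lists

  module _ (p : A → Bool) where

    all⁻ : ∀ xs → all p xs ≡ true → ∀ {x} → x ∈ xs → p x ≡ true
    all⁻ (y ∷ xs) eq (here refl) with p y
    ... | true = refl
    all⁻ (y ∷ xs) eq (there x∈) with p y
    ... | true = all⁻ xs eq x∈

    all⁺ : ∀ xs → (∀ {x} → x ∈ xs → p x ≡ true) → all p xs ≡ true
    all⁺ [] h = refl
    all⁺ (y ∷ xs) h rewrite h (here refl) = all⁺ xs (h ∘ there)

    any⁻ : ∀ xs → any p xs ≡ true → ∃ λ x → x ∈ xs × p x ≡ true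
    any⁻ (y ∷ xs) eq with p y in py
    ... | true  = y , here refl , py
    ... | false = let x , x∈ , px = any⁻ xs eq in x , there x∈ , px

    any⁺ : ∀ {xs x} → x ∈ xs → p x ≡ true → any p xs ≡ true
    any⁺ (here refl) px rewrite px = refl
    any⁺ {y ∷ _} (there x∈) px with p y
    ... | true  = refl
    ... | false = any⁺ x∈ px

    filterᵇ-∈⁺ : ∀ {x} xs → x ∈ xs → p x ≡ true → x ∈ filterᵇ p xs
    filterᵇ-∈⁺ (y ∷ xs) (here refl) px rewrite px = here refl
    filterᵇ-∈⁺ (y ∷ xs) (there x∈) px with p y
    ... | true  = there (filterᵇ-∈⁺ xs x∈ px)
    ... | false = filterᵇ-∈⁺ xs x∈ px

    filterᵇ-∈⁻ : ∀ {x} xs → x ∈ filterᵇ p xs → x ∈ xs × p x ≡ true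
    filterᵇ-∈⁻ (y ∷ xs) x∈ with p y in py
    filterᵇ-∈⁻ (y ∷ xs) (here refl) | true  = here refl , py
    filterᵇ-∈⁻ (y ∷ xs) (there x∈)  | true  = let q , r = filterᵇ-∈⁻ xs x∈ in there q , r
    filterᵇ-∈⁻ (y ∷ xs) x∈          | false = let q , r = filterᵇ-∈⁻ xs x∈ in there q , r

    filterᵇ-unique : ∀ {xs} → Unique xs → Unique (filterᵇ p xs)
    filterᵇ-unique [] = []
    filterᵇ-unique {x ∷ xs} (x∉ ∷ u) with p x
    ... | false = filterᵇ-unique u
    ... | true  = All.tabulate (λ y∈ → All.lookup x∉ (proj₁ (filterᵇ-∈⁻ xs y∈))) ∷ filterᵇ-unique u

  infix 4 _∈?_
  _∈?_ : (x : Fin n) (xs : List (Fin n)) → Dec (x ∈ xs)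
  x ∈? xs = Any.any? (x ≟_) xs

  true-iff⇒≡ : ∀ {a b} → (a ≡ true → b ≡ true) → (b ≡ true → a ≡ true) → a ≡ b
  true-iff⇒≡ {true}          f g = sym (f refl)
  true-iff⇒≡ {false} {true}  f g = g refl
  true-iff⇒≡ {false} {false} f g = refl

  ==⇒≡ : ∀ {n} {i j : Fin n} → (i == j) ≡ true → i ≡ j
  ==⇒≡ {i = i} {j} eq with i ≟ j
  ... | yes p = p

  ≡⇒== : ∀ {n} {i j : Fin n} → i ≡ j → (i == j) ≡ true
  ≡⇒== {i = i} {j} = dec-true (i ≟ j)

  ≢⇒== : ∀ {n} {i j : Fin n} → i ≢ j → (i == j) ≡ false
  ≢⇒== {i = i} {j} = dec-false (i ≟ j)

  Unique-resp-↭ : {xs ys : List A} → xs ↭ ys → Unique xs → Unique ys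
  Unique-resp-↭ p = PermSetoid.Unique-resp-↭ (setoid _) (↭⇒↭ₛ p)

  unique-++⁻ˡ : (xs : List A) {ys : List A} → Unique (xs ++ ys) → Unique xs
  unique-++⁻ˡ []       u        = []
  unique-++⁻ˡ (x ∷ xs) (x∉ ∷ u) = All.++⁻ˡ xs x∉ ∷ unique-++⁻ˡ xs u

  unique-++⁻ʳ : (xs : List A) {ys : List A} → Unique (xs ++ ys) → Unique ys
  unique-++⁻ʳ []       u        = u
  unique-++⁻ʳ (x ∷ xs) (x∉ ∷ u) = unique-++⁻ʳ xs u

  unique-++-disjoint : (xs : List A) {ys : List A} → Unique (xs ++ ys) → ∀ {x} → x ∈ xs → x ∈ ys → ⊥
  unique-++-disjoint (x ∷ xs) (x∉ ∷ u) (here refl) x∈ys = All.lookup x∉ (∈-++⁺ʳ xs x∈ys) refl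
  unique-++-disjoint (x ∷ xs) (x∉ ∷ u) (there x∈)  x∈ys = unique-++-disjoint xs u x∈ x∈ys

  unique-⊆⇒↭ : {xs ys : List A} → Unique xs → (∀ {x} → x ∈ xs → x ∈ ys) → ∃ λ zs → ys ↭ xs ++ zs
  unique-⊆⇒↭ {ys = ys} [] sub = ys , ↭-refl
  unique-⊆⇒↭ {xs = x ∷ xs} {ys} (x∉ ∷ u) sub with l , r , refl ← ∈-∃++ (sub (here refl)) =
    let zs , p = unique-⊆⇒↭ {ys = l ++ r} u sub′ in zs , ↭-trans (Perm.shift x l r) (prep x p)
    where
    sub′ : ∀ {y} → y ∈ xs → y ∈ l ++ r
    sub′ y∈ with Perm.∈-resp-↭ (Perm.shift x l r) (sub (there y∈))
    ... | here refl = ⊥-elim (All.lookup x∉ y∈ refl)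
    ... | there q   = q

  unique-map⇒injective : (f : A → B) {xs : List A} → Unique (map f xs) →
    ∀ {x y} → x ∈ xs → y ∈ xs → f x ≡ f y → x ≡ y
  unique-map⇒injective f (x∉ ∷ u) (here refl) (here refl) eq = refl
  unique-map⇒injective f (x∉ ∷ u) (here refl) (there y∈)  eq = ⊥-elim (All.lookup x∉ (∈-map⁺ f y∈) eq)
  unique-map⇒injective f (x∉ ∷ u) (there x∈)  (here refl) eq = ⊥-elim (All.lookup x∉ (∈-map⁺ f x∈) (sym eq))
  unique-map⇒injective f (x∉ ∷ u) (there x∈)  (there y∈)  eq = unique-map⇒injective f u x∈ y∈ eq

  unique-length≤ : ∀ {n} {xs : List (Fin n)} → Unique xs → length xs ≤ n
  unique-length≤ {n} {xs} u =
    let zs , p = unique-⊆⇒↭ {ys = allFin n} u (λ _ → ∈-allFin _) in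
    ℕ.≤-trans (ℕ.≤-trans (ℕ.m≤m+n (length xs) (length zs))
        (ℕ.≤-reflexive (trans (sym (List.length-++ xs)) (sym (Perm.↭-length p)))))
      (ℕ.≤-reflexive (List.length-tabulate {n = n} id))

  -- Closed walks as lists of directed edges

  pathE : A → List A → A → List (A × A)
  pathE a []      z = (a , z) ∷ []
  pathE a (x ∷ l) z = (a , x) ∷ pathE x l z

  pathE-++ : (a : A) (l : List A) (b : A) (r : List A) (z : A) →
    pathE a (l ++ b ∷ r) z ≡ pathE a l b ++ pathE b r z
  pathE-++ a []      b r z = refl
  pathE-++ a (x ∷ l) b r z = cong ((a , x) ∷_) (pathE-++ x l b r z)

  pathE-sources : (a : A) (l : List A) (z : A) → map proj₁ (pathE a l z) ≡ a ∷ l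
  pathE-sources a []      z = refl
  pathE-sources a (x ∷ l) z = cong (a ∷_) (pathE-sources x l z)

  pathE-targets : (a : A) (l : List A) (z : A) → map proj₂ (pathE a l z) ≡ l ++ [ z ]
  pathE-targets a []      z = refl
  pathE-targets a (x ∷ l) z = cong (x ∷_) (pathE-targets x l z)

  pathE-reverse : (a : A) (l : List A) (z : A) → pathE z (reverse l) a ≡ reverse (map swap (pathE a l z))
  pathE-reverse a []      z = refl
  pathE-reverse a (x ∷ l) z = begin
    pathE z (reverse (x ∷ l)) a              ≡⟨ cong (λ r → pathE z r a) (List.unfold-reverse x l) ⟩
    pathE z (reverse l ++ [ x ]) a           ≡⟨ pathE-++ z (reverse l) x [] a ⟩
    pathE z (reverse l) x ++ [ (x , a) ]     ≡⟨ cong (_++ _) (pathE-reverse x l z) ⟩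
    reverse (map swap (pathE x l z)) ++ [ (x , a) ] ≡⟨ List.unfold-reverse (x , a) (map swap (pathE x l z)) ⟨
    reverse (map swap (pathE a (x ∷ l) z))   ∎
    where open ≡-Reasoning

  ∈-pathE-reverse : (a : A) (l : List A) (z : A) {x y : A} → (x , y) ∈ pathE a l z → (y , x) ∈ pathE z (reverse l) a
  ∈-pathE-reverse a l z e∈ = subst (_ ∈_) (sym (pathE-reverse a l z)) (Any.reverse⁺ (∈-map⁺ swap e∈))

  private
    closedE : A → List A → List (A × A)
    closedE z []          = []
    closedE z (x ∷ [])    = (x , z) ∷ []
    closedE z (x ∷ y ∷ r) = (x , y) ∷ closedE z (y ∷ r)

    closedE≡pathE : (z x : A) (l : List A) → closedE z (x ∷ l) ≡ pathE x l z
    closedE≡pathE z x []      = refl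
    closedE≡pathE z x (y ∷ l) = cong ((x , y) ∷_) (closedE≡pathE z y l)

    -- The helper local to `cycEdges` has no name outside its clause; the `_` is solved with it
    -- because abstracting the list leaves it applied to distinct variables.
    mutual
      cycEdges-go≡ : ∀ {n} (u : Fin n) (us l : List (Fin n)) → _ ≡ closedE u l

      cycEdges≡closedE : ∀ {n} (u : Fin n) (us : List (Fin n)) → cycEdges (u ∷ us) ≡ closedE u (u ∷ us)
      cycEdges≡closedE u us with u ∷ us
      ... | l = cycEdges-go≡ u us l

      cycEdges-go≡ u us []          = refl
      cycEdges-go≡ u us (x ∷ [])    = refl
      cycEdges-go≡ u us (x ∷ y ∷ r) = cong ((x , y) ∷_) (cycEdges-go≡ u us (y ∷ r))

  cycEdges≡ : ∀ {n} (u : Fin n) (us : List (Fin n)) → cycEdges (u ∷ us) ≡ pathE u us u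
  cycEdges≡ u us = trans (cycEdges≡closedE u us) (closedE≡pathE u u us)

  -- Directed cycles

  Cycle : ℕ → Set
  Cycle n = Fin n × List (Fin n)

  edges : Cycle n → List (Fin n × Fin n)
  edges (u , us) = pathE u us u

  verts : Cycle n → List (Fin n)
  verts (u , us) = u ∷ us

  E : List (Cycle n) → List (Fin n × Fin n)
  E = concatMap edges

  V : List (Cycle n) → List (Fin n)
  V = concatMap verts

  WellFormed : List (Cycle n) → Set
  WellFormed ds = All (λ c → 1 ≤ length (proj₂ c)) ds × Unique (V ds)

  Follows : (Fin n → Fin n) → List (Fin n × Fin n) → Set
  Follows σ es = ∀ {x y} → (x , y) ∈ es → σ x ≡ y

  record Decomposes (ds : List (Cycle n)) (σ : Fin n → Fin n) : Set where
    field
      wellFormed : WellFormed ds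
      follows    : Follows σ (E ds)
      fixes      : ∀ {x} → x ∉ V ds → σ x ≡ x

  edges-sources : (c : Cycle n) → map proj₁ (edges c) ≡ verts c
  edges-sources (u , us) = pathE-sources u us u

  edges-targets : (c : Cycle n) → map proj₂ (edges c) ↭ verts c
  edges-targets (u , us) = ↭-trans (↭-reflexive (pathE-targets u us u)) (↭-sym (Perm.∷↭∷ʳ u us))

  E-sources : (ds : List (Cycle n)) → map proj₁ (E ds) ≡ V ds
  E-sources []       = refl
  E-sources (c ∷ ds) = trans (List.map-++ proj₁ (edges c) (E ds)) (cong₂ _++_ (edges-sources c) (E-sources ds))

  E-targets : (ds : List (Cycle n)) → map proj₂ (E ds) ↭ V ds
  E-targets []       = ↭-refl
  E-targets (c ∷ ds) = ↭-trans (↭-reflexive (List.map-++ proj₂ (edges c) (E ds)))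
    (Perm.++⁺ (edges-targets c) (E-targets ds))

  ∈-sources⁻ : {x : A} {es : List (A × B)} → x ∈ map proj₁ es → ∃ λ y → (x , y) ∈ es
  ∈-sources⁻ x∈ with (_ , y) , e∈ , refl ← ∈-map⁻ proj₁ x∈ = y , e∈

  ∈-targets⁻ : {y : B} {es : List (A × B)} → y ∈ map proj₂ es → ∃ λ x → (x , y) ∈ es
  ∈-targets⁻ x∈ with (x , _) , e∈ , refl ← ∈-map⁻ proj₂ x∈ = x , e∈

  ∈verts⇒out : (c : Cycle n) {x : Fin n} → x ∈ verts c → ∃ λ y → (x , y) ∈ edges c
  ∈verts⇒out c x∈ = ∈-sources⁻ (subst (_ ∈_) (sym (edges-sources c)) x∈)

  ∈verts⇒in : (c : Cycle n) {y : Fin n} → y ∈ verts c → ∃ λ x → (x , y) ∈ edges c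
  ∈verts⇒in c y∈ = ∈-targets⁻ (Perm.∈-resp-↭ (↭-sym (edges-targets c)) y∈)

  edges⇒source : (c : Cycle n) {x y : Fin n} → (x , y) ∈ edges c → x ∈ verts c
  edges⇒source c e∈ = subst (_ ∈_) (edges-sources c) (∈-map⁺ proj₁ e∈)

  edges⇒target : (c : Cycle n) {x y : Fin n} → (x , y) ∈ edges c → y ∈ verts c
  edges⇒target c e∈ = Perm.∈-resp-↭ (edges-targets c) (∈-map⁺ proj₂ e∈)

  ∈V⇒out : (ds : List (Cycle n)) {x : Fin n} → x ∈ V ds → ∃ λ y → (x , y) ∈ E ds
  ∈V⇒out ds x∈ = ∈-sources⁻ (subst (_ ∈_) (sym (E-sources ds)) x∈)

  E⇒source : (ds : List (Cycle n)) {x y : Fin n} → (x , y) ∈ E ds → x ∈ V ds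
  E⇒source ds e∈ = subst (_ ∈_) (E-sources ds) (∈-map⁺ proj₁ e∈)

  E⇒target : (ds : List (Cycle n)) {x y : Fin n} → (x , y) ∈ E ds → y ∈ V ds
  E⇒target ds e∈ = Perm.∈-resp-↭ (E-targets ds) (∈-map⁺ proj₂ e∈)

  pathE-irreflexive : {a : A} {l : List A} {z : A} → Unique (a ∷ l) → z ∉ a ∷ l →
    ∀ {x y} → (x , y) ∈ pathE a l z → x ≢ y
  pathE-irreflexive {l = []}    u         z∉ (here refl) refl = z∉ (here refl)
  pathE-irreflexive {l = b ∷ l} ((a≢b ∷ _) ∷ u) z∉ (here refl) eq = a≢b eq
  pathE-irreflexive {l = b ∷ l} (_ ∷ u)   z∉ (there e∈) eq = pathE-irreflexive u (z∉ ∘ there) e∈ eq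

  edges-irreflexive : (c : Cycle n) → 1 ≤ length (proj₂ c) → Unique (verts c) →
    ∀ {x y} → (x , y) ∈ edges c → x ≢ y
  edges-irreflexive (u , v ∷ us) _ ((u≢v ∷ _) ∷ _) (here refl) = u≢v
  edges-irreflexive (u , v ∷ us) _ (u∉ ∷ un) (there e∈) =
    pathE-irreflexive un (λ u∈ → All.lookup u∉ u∈ refl) e∈

  E-irreflexive : (ds : List (Cycle n)) → WellFormed ds → ∀ {x y} → (x , y) ∈ E ds → x ≢ y
  E-irreflexive (c ∷ ds) (l ∷ ls , u) e∈ with ∈-++⁻ (edges c) e∈
  ... | inj₁ e∈c  = edges-irreflexive c l (unique-++⁻ˡ (verts c) u) e∈c
  ... | inj₂ e∈ds = E-irreflexive ds (ls , unique-++⁻ʳ (verts c) u) e∈ds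

  module _ {ds : List (Cycle n)} {σ : Fin n → Fin n} (dec : Decomposes ds σ) where
    open Decomposes dec

    moves : ∀ {x} → x ∈ V ds → σ x ≢ x
    moves x∈ eq = let y , e∈ = ∈V⇒out ds x∈ in
      E-irreflexive ds wellFormed e∈ (trans (sym eq) (follows e∈))

    moved⇒edge : ∀ {x} → σ x ≢ x → (x , σ x) ∈ E ds
    moved⇒edge {x} σx≢x with x ∈? V ds
    ... | no x∉  = ⊥-elim (σx≢x (fixes x∉))
    ... | yes x∈ = let y , e∈ = ∈V⇒out ds x∈ in subst (λ z → (x , z) ∈ E ds) (sym (follows e∈)) e∈

    decomposes⇒injective : Injective _≡_ _≡_ σ
    decomposes⇒injective {x} {y} eq with x ∈? V ds | y ∈? V ds
    ... | no x∉  | no y∉  = trans (sym (fixes x∉)) (trans eq (fixes y∉))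
    ... | yes x∈ | no y∉  = let z , e∈ = ∈V⇒out ds x∈ in
      ⊥-elim (y∉ (subst (_∈ V ds) (trans (sym (follows e∈)) (trans eq (fixes y∉))) (E⇒target ds e∈)))
    ... | no x∉  | yes y∈ = let z , e∈ = ∈V⇒out ds y∈ in
      ⊥-elim (x∉ (subst (_∈ V ds) (trans (sym (follows e∈)) (trans (sym eq) (fixes x∉))) (E⇒target ds e∈)))
    ... | yes x∈ | yes y∈ =
      let z , e∈ = ∈V⇒out ds x∈ ; w , f∈ = ∈V⇒out ds y∈
          z≡w = trans (sym (follows e∈)) (trans eq (follows f∈))
      in cong proj₁ (unique-map⇒injective proj₂
           (Unique-resp-↭ (↭-sym (E-targets ds)) (proj₂ wellFormed)) e∈ f∈ z≡w)

  look : List (Fin n × Fin n) → Fin n → Fin n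
  look []             x = x
  look ((a , b) ∷ es) x = if a == x then b else look es x

  look-∈ : {es : List (Fin n × Fin n)} → Unique (map proj₁ es) → Follows (look es) es
  look-∈ {es = (a , b) ∷ es} (a∉ ∷ u) (here refl) rewrite ≡⇒== {i = a} refl = refl
  look-∈ {es = (a , b) ∷ es} (a∉ ∷ u) {x} (there e∈)
    rewrite ≢⇒== {i = a} {x} (All.lookup a∉ (∈-map⁺ proj₁ e∈)) = look-∈ u e∈

  look-∉ : {es : List (Fin n × Fin n)} {x : Fin n} → x ∉ map proj₁ es → look es x ≡ x
  look-∉ {es = []}           x∉ = refl
  look-∉ {es = (a , b) ∷ es} {x} x∉ rewrite ≢⇒== {i = a} {x} (x∉ ∘ here ∘ sym) = look-∉ {es = es} (x∉ ∘ there)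

  toVec : List (Cycle n) → Vec (Fin n) n
  toVec ds = tabulate (look (E ds))

  toVec-decomposes : {ds : List (Cycle n)} → WellFormed ds → Decomposes ds (lookup (toVec ds))
  toVec-decomposes {ds = ds} wf = record
    { wellFormed = wf
    ; follows = λ {x} e∈ → trans (Vec.lookup∘tabulate _ x)
        (look-∈ (subst Unique (sym (E-sources ds)) (proj₂ wf)) e∈)
    ; fixes = λ {x} x∉ → trans (Vec.lookup∘tabulate _ x)
        (look-∉ {es = E ds} (x∉ ∘ subst (x ∈_) (E-sources ds)))
    }

  decomposes-unique : {ds : List (Cycle n)} {σ τ : Fin n → Fin n} →
    Decomposes ds σ → Decomposes ds τ → ∀ x → σ x ≡ τ x
  decomposes-unique {ds = ds} d d′ x with x ∈? V ds
  ... | yes x∈ = let y , e∈ = ∈V⇒out ds x∈ in trans (Decomposes.follows d e∈) (sym (Decomposes.follows d′ e∈))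
  ... | no x∉  = trans (Decomposes.fixes d x∉) (sym (Decomposes.fixes d′ x∉))

  decomposes⇒toVec : {ds : List (Cycle n)} {v : Vec (Fin n) n} → Decomposes ds (lookup v) → v ≡ toVec ds
  decomposes⇒toVec {v = v} d = trans (sym (Vec.tabulate∘lookup v)) (trans
    (Vec.tabulate-cong (λ x → trans (decomposes-unique d (toVec-decomposes (Decomposes.wellFormed d)) x)
      (Vec.lookup∘tabulate _ x))) refl)

  -- Rotating a cycle swaps the two parts of its edge list.
  record Rotation (c : Cycle n) (v : Fin n) : Set where
    field
      rest   : List (Fin n)
      E₁ E₂  : List (Fin n × Fin n)
      before : edges c ≡ E₁ ++ E₂
      after  : edges (v , rest) ≡ E₂ ++ E₁

    rotated : Cycle _
    rotated = v , rest

    edges-↭ : edges rotated ↭ edges c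
    edges-↭ = ↭-trans (↭-reflexive after) (↭-trans (Perm.++-comm E₂ E₁) (↭-reflexive (sym before)))

    verts-↭ : verts rotated ↭ verts c
    verts-↭ = ↭-trans (↭-reflexive (sym (edges-sources rotated)))
      (↭-trans (Perm.map⁺ proj₁ edges-↭) (↭-reflexive (edges-sources c)))

  rotate : (c : Cycle n) {v : Fin n} → v ∈ verts c → Rotation c v
  rotate (u , us) (here refl) = record { rest = us ; E₁ = [] ; E₂ = pathE u us u ; before = refl ; after = sym (List.++-identityʳ _) }
  rotate (u , us) {v} (there v∈) with p , q , refl ← ∈-∃++ v∈ =
    record { rest = q ++ u ∷ p ; E₁ = pathE u p v ; E₂ = pathE v q u ; before = pathE-++ u p v q u ; after = pathE-++ v q u p v }

  -- Leaders

  ≤ᵇ⁺ : ∀ {i j} → i ≤ j → (i ≤ᵇ j) ≡ true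
  ≤ᵇ⁺ p = Equivalence.to T-≡ (ℕ.≤⇒≤ᵇ p)

  ≤ᵇ⁻ : ∀ {i j} → (i ≤ᵇ j) ≡ true → i ≤ j
  ≤ᵇ⁻ p = ℕ.≤ᵇ⇒≤ _ _ (Equivalence.from T-≡ p)

  isLeader⁺ : {σ : Fin n → Fin n} {v : Fin n} → (∀ k → toℕ v ≤ toℕ (iter σ (suc k) v)) → isLeader σ v ≡ true
  isLeader⁺ {n = n} h = all⁺ _ (upTo n) (λ {k} _ → ≤ᵇ⁺ (h k))

  isLeader⁻ : {σ : Fin n → Fin n} {v : Fin n} → isLeader σ v ≡ true →
    ∀ {k} → k < n → toℕ v ≤ toℕ (iter σ (suc k) v)
  isLeader⁻ {n = n} eq k<n = ≤ᵇ⁻ (all⁻ _ (upTo n) eq (∈-upTo⁺ k<n))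

  iter-shift : (σ : Fin n → Fin n) (k : ℕ) (x : Fin n) → iter σ k (σ x) ≡ iter σ (suc k) x
  iter-shift σ zero    x = refl
  iter-shift σ (suc k) x = cong σ (iter-shift σ k x)

  iter-closed : (P : Fin n → Set) {σ : Fin n → Fin n} → (∀ {x} → P x → P (σ x)) →
    ∀ k {x} → P x → P (iter σ k x)
  iter-closed P closed zero    px = px
  iter-closed P closed (suc k) px = closed (iter-closed P closed k px)

  iter-cong : (P : Fin n → Set) {σ τ : Fin n → Fin n} → (∀ {x} → P x → P (σ x)) →
    (∀ {x} → P x → σ x ≡ τ x) → ∀ k {x} → P x → iter σ k x ≡ iter τ k x
  iter-cong P closed agree zero px = refl
  iter-cong P {τ = τ} closed agree (suc k) px =
    trans (agree (iter-closed P closed k px)) (cong τ (iter-cong P closed agree k px))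

  isLeader-cong : (P : Fin n → Set) {σ τ : Fin n → Fin n} → (∀ {x} → P x → P (σ x)) →
    (∀ {x} → P x → σ x ≡ τ x) → ∀ {x} → P x → isLeader σ x ≡ isLeader τ x
  isLeader-cong {n = n} P closed agree {x} px = cong and (List.map-cong
    (λ k → cong (λ y → toℕ x ≤ᵇ toℕ y) (iter-cong P closed agree (suc k) px)) (upTo n))

  fixed⇒isLeader : {σ : Fin n → Fin n} {v : Fin n} → σ v ≡ v → isLeader σ v ≡ true
  fixed⇒isLeader {σ = σ} {v} eq = isLeader⁺ {σ = σ} (λ k → ℕ.≤-reflexive (cong toℕ (sym
    (iter-closed (_≡ v) {σ = σ} (λ { refl → eq }) (suc k) refl))))

  follows-closed : (c : Cycle n) {σ : Fin n → Fin n} → Follows σ (edges c) → ∀ {x} → x ∈ verts c → σ x ∈ verts c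
  follows-closed c fol x∈ = let y , e∈ = ∈verts⇒out c x∈ in
    subst (_∈ verts c) (sym (fol e∈)) (edges⇒target c e∈)

  minimal⇒isLeader : (c : Cycle n) {σ : Fin n → Fin n} → Follows σ (edges c) → ∀ {m} → m ∈ verts c →
    (∀ {x} → x ∈ verts c → toℕ m ≤ toℕ x) → isLeader σ m ≡ true
  minimal⇒isLeader c {σ} fol m∈ min = isLeader⁺ {σ = σ} (λ k → min (iter-closed (_∈ verts c) (follows-closed c fol) (suc k) m∈))

  path-iterates : {σ : Fin n → Fin n} (a : Fin n) (l : List (Fin n)) {z : Fin n} → Follows σ (pathE a l z) →
    ∀ {x} → x ∈ l → ∃ λ k → k < length l × x ≡ iter σ (suc k) a
  path-iterates a (b ∷ l) fol (here refl) = zero , s≤s z≤n , sym (fol (here refl))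
  path-iterates {σ = σ} a (b ∷ l) fol (there x∈) with k , k<l , eq ← path-iterates {σ = σ} b l (fol ∘ there) x∈ =
    suc k , s≤s k<l , trans eq (trans (cong (iter σ (suc k)) (sym (fol (here refl)))) (iter-shift σ (suc k) a))

  isLeader⇒minimal : (c : Cycle n) {σ : Fin n → Fin n} → Follows σ (edges c) → Unique (verts c) →
    ∀ {v x} → v ∈ verts c → x ∈ verts c → isLeader σ v ≡ true → toℕ v ≤ toℕ x
  isLeader⇒minimal {n = n} c {σ} fol u {v} v∈ x∈ lead with Perm.∈-resp-↭ (↭-sym (Rotation.verts-↭ (rotate c v∈))) x∈
  ... | here refl = ℕ.≤-refl
  ... | there x∈r with k , k<r , refl ← path-iterates v (Rotation.rest (rotate c v∈))
                         (fol ∘ Perm.∈-resp-↭ (Rotation.edges-↭ (rotate c v∈))) x∈r =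
    isLeader⁻ {σ = σ} lead (ℕ.<-trans k<r (unique-length≤ (Unique-resp-↭ (↭-sym (Rotation.verts-↭ (rotate c v∈))) u)))

  minimum : (u : Fin n) (us : List (Fin n)) → ∃ λ m → m ∈ u ∷ us × (∀ {x} → x ∈ u ∷ us → toℕ m ≤ toℕ x)
  minimum u [] = u , here refl , λ { (here refl) → ℕ.≤-refl }
  minimum u (v ∷ us) with m , m∈ , min ← minimum v us with ℕ.≤-total (toℕ u) (toℕ m)
  ... | inj₁ u≤m = u , here refl , λ { (here refl) → ℕ.≤-refl ; (there x∈) → ℕ.≤-trans u≤m (min x∈) }
  ... | inj₂ m≤u = m , there m∈ , λ { (here refl) → m≤u ; (there x∈) → min x∈ }

  -- Every permutation decomposes into cycles

  least : {P : ℕ → Set} → (∀ k → Dec (P k)) → ∀ {k} → P k → ∃ λ m → P m × (∀ j → j < m → ¬ P j)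
  least {P} P? {k} pk with search (suc k)
    where
    search : ∀ b → (∃ λ m → P m × (∀ j → j < m → ¬ P j)) ⊎ (∀ j → j < b → ¬ P j)
    search zero = inj₂ (λ _ ())
    search (suc b) with search b
    ... | inj₁ found = inj₁ found
    ... | inj₂ none with P? b
    ...   | yes pb = inj₁ (b , pb , none)
    ...   | no ¬pb = inj₂ λ j j<1+b → [ none j , (λ { refl → ¬pb }) ]′ (ℕ.m≤n⇒m<n∨m≡n (ℕ.≤-pred j<1+b))
  ... | inj₁ found = found
  ... | inj₂ none  = ⊥-elim (none k (ℕ.n<1+n k) pk)

  module _ (σ : Fin n → Fin n) (inj : Injective _≡_ _≡_ σ) where

    iter-cancel : ∀ i d v → iter σ i v ≡ iter σ (i + d) v → v ≡ iter σ d v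
    iter-cancel zero    d v eq = eq
    iter-cancel (suc i) d v eq = iter-cancel i d v (inj eq)

    returns : ∀ v → ∃ λ k → iter σ (suc k) v ≡ v
    returns v with i , j , i<j , eq ← Fin.pigeonhole (ℕ.n<1+n n) (λ i → iter σ (toℕ i) v) =
      toℕ j ∸ suc (toℕ i) , sym (iter-cancel (toℕ i) _ v (trans eq (cong (λ k → iter σ k v) (sym
        (trans (ℕ.+-suc (toℕ i) _) (ℕ.m+[n∸m]≡n i<j))))))

    orbit : ℕ → Fin n → List (Fin n)
    orbit zero    x = []
    orbit (suc k) x = x ∷ orbit k (σ x)

    ∈-orbit⁻ : ∀ k x {y} → y ∈ orbit k x → ∃ λ j → j < k × y ≡ iter σ j x
    ∈-orbit⁻ (suc k) x (here refl) = 0 , s≤s z≤n , refl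
    ∈-orbit⁻ (suc k) x (there y∈) with j , j<k , eq ← ∈-orbit⁻ k (σ x) y∈ =
      suc j , s≤s j<k , trans eq (iter-shift σ j x)

    orbit-follows : ∀ r x {z} → iter σ (suc r) x ≡ z → Follows σ (pathE x (orbit r (σ x)) z)
    orbit-follows zero    x eq (here refl) = eq
    orbit-follows (suc r) x eq (here refl) = refl
    orbit-follows (suc r) x eq (there e∈)  = orbit-follows r (σ x) (trans (iter-shift σ (suc r) x) eq) e∈

    orbit-unique : ∀ r x → (∀ k → k < r → iter σ (suc k) x ≢ x) → Unique (x ∷ orbit r (σ x))
    orbit-unique zero    x ne = [] ∷ []
    orbit-unique (suc r) x ne =
      All.tabulate (λ y∈ x≡y → let j , j<r , eq = ∈-orbit⁻ (suc r) (σ x) y∈ in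
        ne j j<r (sym (trans x≡y (trans eq (iter-shift σ j x)))))
      ∷ orbit-unique r (σ x) (λ k k<r eq → ne k (ℕ.m<n⇒m<1+n k<r) (inj (trans (sym (iter-shift σ (suc k) x)) eq)))

    cycleThrough : ∀ v → σ v ≢ v → ∃ λ us → 1 ≤ length us × Unique (v ∷ us) × Follows σ (edges (v , us))
    cycleThrough v σv≢v with least (λ k → iter σ (suc k) v ≟ v) {proj₁ (returns v)} (proj₂ (returns v))
    ... | zero  , eq , ne = ⊥-elim (σv≢v eq)
    ... | suc r , eq , ne = orbit (suc r) (σ v) , s≤s z≤n , orbit-unique (suc r) v ne , orbit-follows (suc r) v eq

  module _ (σ : Fin n → Fin n) (inj : Injective _≡_ _≡_ σ) (c : Cycle n) (fol : Follows σ (edges c)) where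

    removeCycle : Fin n → Fin n
    removeCycle x = if does (x ∈? verts c) then x else σ x

    removeCycle-∈ : ∀ {x} → x ∈ verts c → removeCycle x ≡ x
    removeCycle-∈ {x} x∈ rewrite dec-true (x ∈? verts c) x∈ = refl

    removeCycle-∉ : ∀ {x} → x ∉ verts c → removeCycle x ≡ σ x
    removeCycle-∉ {x} x∉ rewrite dec-false (x ∈? verts c) x∉ = refl

    follows-closed⁻ : ∀ {x} → σ x ∈ verts c → x ∈ verts c
    follows-closed⁻ σx∈ = let p , e∈ = ∈verts⇒in c σx∈ in
      subst (_∈ verts c) (inj (fol e∈)) (edges⇒source c e∈)

    removeCycle-injective : Injective _≡_ _≡_ removeCycle
    removeCycle-injective {x} {y} eq with x ∈? verts c | y ∈? verts c
    ... | yes x∈ | yes y∈ = trans (sym (removeCycle-∈ x∈)) (trans eq (removeCycle-∈ y∈))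
    ... | no x∉  | no y∉  = inj (trans (sym (removeCycle-∉ x∉)) (trans eq (removeCycle-∉ y∉)))
    ... | yes x∈ | no y∉  = ⊥-elim (y∉ (follows-closed⁻ (subst (_∈ verts c)
      (trans (sym (removeCycle-∈ x∈)) (trans eq (removeCycle-∉ y∉))) x∈)))
    ... | no x∉  | yes y∈ = ⊥-elim (x∉ (follows-closed⁻ (subst (_∈ verts c)
      (trans (sym (removeCycle-∈ y∈)) (trans (sym eq) (removeCycle-∉ x∉))) y∈)))

  decompose-within : (vs : List (Fin n)) (σ : Fin n → Fin n) → Injective _≡_ _≡_ σ →
    (∀ {x} → x ∉ vs → σ x ≡ x) → ∃ λ ds → Decomposes ds σ
  decompose-within [] σ inj fixed = [] , record
    { wellFormed = [] , [] ; follows = λ () ; fixes = λ _ → fixed λ () }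
  decompose-within (v ∷ vs) σ inj fixed with σ v ≟ v
  ... | yes σv≡v = decompose-within vs σ inj fixed′
    where
    fixed′ : ∀ {x} → x ∉ vs → σ x ≡ x
    fixed′ {x} x∉ with x ≟ v
    ... | yes refl = σv≡v
    ... | no x≢v   = fixed λ { (here x≡v) → x≢v x≡v ; (there x∈) → x∉ x∈ }
  ... | no σv≢v with us , 1≤us , u , fol ← cycleThrough σ inj v σv≢v =
    let c = v , us
        τ = removeCycle σ inj c fol
        ds , dec = decompose-within vs τ (removeCycle-injective σ inj c fol) fixed′
        open Decomposes dec
        ∉c : ∀ {x} → x ∈ V ds → x ∉ verts c
        ∉c x∈ x∈c = moves dec x∈ (removeCycle-∈ σ inj c fol x∈c)
    in c ∷ ds , record
      { wellFormed = 1≤us ∷ proj₁ wellFormed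
                   , Unique.++⁺ u (proj₂ wellFormed) (λ (x∈c , x∈) → ∉c x∈ x∈c)
      ; follows = λ e∈ → [ fol , (λ e∈ds → trans (sym (removeCycle-∉ σ inj c fol (∉c (E⇒source ds e∈ds))))
                                                 (follows e∈ds)) ]′ (∈-++⁻ (edges c) e∈)
      ; fixes = λ x∉ → trans (sym (removeCycle-∉ σ inj c fol (x∉ ∘ ∈-++⁺ˡ))) (fixes (x∉ ∘ ∈-++⁺ʳ (verts c)))
      }
    where
    fixed′ : ∀ {x} → x ∉ vs → removeCycle σ inj (v , us) fol x ≡ x
    fixed′ {x} x∉ with x ∈? (v ∷ us)
    ... | yes x∈c = removeCycle-∈ σ inj (v , us) fol x∈c
    ... | no x∉c  = trans (removeCycle-∉ σ inj (v , us) fol x∉c)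
      (fixed λ { (here x≡v) → x∉c (here x≡v) ; (there x∈) → x∉ x∈ })

  decompose : (σ : Fin n → Fin n) → Injective _≡_ _≡_ σ → ∃ λ ds → Decomposes ds σ
  decompose {n} σ inj = decompose-within (allFin n) σ inj (λ x∉ → ⊥-elim (x∉ (∈-allFin _)))

  -- Orientations of a basic graph

  orient : Elem n → List (Cycle n)
  orient (k2 u v)       = (u , [ v ]) ∷ []
  orient (cyc [])       = []
  orient (cyc (u ∷ us)) = (u , us) ∷ (u , reverse us) ∷ []

  orientations : Basic n → List (List (Cycle n))
  orientations []      = [] ∷ []
  orientations (e ∷ B) = concatMap (λ c → map (c ∷_) (orientations B)) (orient e)

  Oriented : List (Cycle n) → Basic n → Set
  Oriented = Pointwise (λ c e → c ∈ orient e)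

  ∈-orientations⁺ : {ds : List (Cycle n)} {B : Basic n} → Oriented ds B → ds ∈ orientations B
  ∈-orientations⁺ []         = here refl
  ∈-orientations⁺ (c∈ ∷ ori) = ∈-concat⁺′ (∈-map⁺ (_ ∷_) (∈-orientations⁺ ori)) (∈-map⁺ _ c∈)

  ∈-orientations⁻ : {ds : List (Cycle n)} (B : Basic n) → ds ∈ orientations B → Oriented ds B
  ∈-orientations⁻ []      (here refl) = []
  ∈-orientations⁻ (e ∷ B) ds∈
    with _ , ds∈l , l∈ ← ∈-concat⁻′ (map (λ c → map (c ∷_) (orientations B)) (orient e)) ds∈
    with c , c∈ , refl ← ∈-map⁻ (λ c → map (c ∷_) (orientations B)) l∈
    with _ , ds′∈ , refl ← ∈-map⁻ (c ∷_) ds∈l = c∈ ∷ ∈-orientations⁻ B ds′∈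

  _∈ᵘ_ : A × A → List (A × A) → Set _
  (x , y) ∈ᵘ es = (x , y) ∈ es ⊎ (y , x) ∈ es

  ∈ᵘ-++⁻ : (es : List (A × A)) {fs : List (A × A)} {x y : A} → (x , y) ∈ᵘ (es ++ fs) → (x , y) ∈ᵘ es ⊎ (x , y) ∈ᵘ fs
  ∈ᵘ-++⁻ es (inj₁ p) = [ inj₁ ∘ inj₁ , inj₂ ∘ inj₁ ]′ (∈-++⁻ es p)
  ∈ᵘ-++⁻ es (inj₂ p) = [ inj₁ ∘ inj₂ , inj₂ ∘ inj₂ ]′ (∈-++⁻ es p)

  ∈ᵘ-++⁺ˡ : {es fs : List (A × A)} {x y : A} → (x , y) ∈ᵘ es → (x , y) ∈ᵘ (es ++ fs)
  ∈ᵘ-++⁺ˡ = [ inj₁ ∘ ∈-++⁺ˡ , inj₂ ∘ ∈-++⁺ˡ ]′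

  ∈ᵘ-++⁺ʳ : (es : List (A × A)) {fs : List (A × A)} {x y : A} → (x , y) ∈ᵘ fs → (x , y) ∈ᵘ (es ++ fs)
  ∈ᵘ-++⁺ʳ es = [ inj₁ ∘ ∈-++⁺ʳ es , inj₂ ∘ ∈-++⁺ʳ es ]′

  edges-reverse : {u x y : Fin n} (us : List (Fin n)) → (x , y) ∈ edges (u , reverse us) → (y , x) ∈ edges (u , us)
  edges-reverse {u = u} us e∈ = subst (λ l → _ ∈ pathE u l u) (List.reverse-involutive us) (∈-pathE-reverse u (reverse us) u e∈)

  orient-verts : {c : Cycle n} (e : Elem n) → c ∈ orient e → verts c ↭ elemVerts e
  orient-verts (k2 u v)       (here refl)         = ↭-refl
  orient-verts (cyc (u ∷ us)) (here refl)         = ↭-refl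
  orient-verts (cyc (u ∷ us)) (there (here refl)) = prep u (Perm.↭-reverse us)

  orient-edges⁻ : {c : Cycle n} (e : Elem n) → c ∈ orient e → ∀ {x y} → (x , y) ∈ᵘ edges c → (x , y) ∈ᵘ elemEdges e
  orient-edges⁻ (k2 u v) (here refl) (inj₁ (here refl))         = inj₁ (here refl)
  orient-edges⁻ (k2 u v) (here refl) (inj₁ (there (here refl))) = inj₂ (here refl)
  orient-edges⁻ (k2 u v) (here refl) (inj₂ (here refl))         = inj₂ (here refl)
  orient-edges⁻ (k2 u v) (here refl) (inj₂ (there (here refl))) = inj₁ (here refl)
  orient-edges⁻ (cyc (u ∷ us)) (here refl)         p rewrite cycEdges≡ u us = p
  orient-edges⁻ (cyc (u ∷ us)) (there (here refl)) p rewrite cycEdges≡ u us =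
    [ inj₂ ∘ edges-reverse us , inj₁ ∘ edges-reverse us ]′ p

  orient-edges⁺ : {c : Cycle n} (e : Elem n) → c ∈ orient e → ∀ {x y} → (x , y) ∈ᵘ elemEdges e → (x , y) ∈ᵘ edges c
  orient-edges⁺ (k2 u v) (here refl) (inj₁ (here refl)) = inj₁ (here refl)
  orient-edges⁺ (k2 u v) (here refl) (inj₂ (here refl)) = inj₁ (there (here refl))
  orient-edges⁺ (cyc (u ∷ us)) (here refl)         p rewrite cycEdges≡ u us = p
  orient-edges⁺ (cyc (u ∷ us)) (there (here refl)) p rewrite cycEdges≡ u us =
    [ inj₂ ∘ ∈-pathE-reverse u us u , inj₁ ∘ ∈-pathE-reverse u us u ]′ p

  oriented-verts : {ds : List (Cycle n)} {B : Basic n} → Oriented ds B → V ds ↭ basicVerts B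
  oriented-verts []                   = ↭-refl
  oriented-verts (_∷_ {y = e} c∈ ori) = Perm.++⁺ (orient-verts e c∈) (oriented-verts ori)

  oriented-edges⁻ : {ds : List (Cycle n)} {B : Basic n} → Oriented ds B → ∀ {x y} → (x , y) ∈ᵘ E ds → (x , y) ∈ᵘ basicEdges B
  oriented-edges⁻ [] p = p
  oriented-edges⁻ (_∷_ {x = c} {y = e} c∈ ori) p =
    [ ∈ᵘ-++⁺ˡ ∘ orient-edges⁻ e c∈ , ∈ᵘ-++⁺ʳ (elemEdges e) ∘ oriented-edges⁻ ori ]′ (∈ᵘ-++⁻ (edges c) p)

  oriented-edges⁺ : {ds : List (Cycle n)} {B : Basic n} → Oriented ds B → ∀ {x y} → (x , y) ∈ᵘ basicEdges B → (x , y) ∈ᵘ E ds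
  oriented-edges⁺ [] p = p
  oriented-edges⁺ (_∷_ {x = c} {y = e} c∈ ori) p =
    [ ∈ᵘ-++⁺ˡ ∘ orient-edges⁺ e c∈ , ∈ᵘ-++⁺ʳ (edges c) ∘ oriented-edges⁺ ori ]′ (∈ᵘ-++⁻ (elemEdges e) p)

  orient-length : {G : SimpleGraph n} {c : Cycle n} (e : Elem n) → ElemWF G e → c ∈ orient e → 1 ≤ length (proj₂ c)
  orient-length (k2 u v)       wf                 (here refl)         = s≤s z≤n
  orient-length (cyc (u ∷ us)) (s≤s 2≤ , _) (here refl)         = ℕ.≤-trans (s≤s z≤n) 2≤
  orient-length (cyc (u ∷ us)) (s≤s 2≤ , _)      (there (here refl)) =
    ℕ.≤-trans (ℕ.≤-trans (s≤s z≤n) 2≤) (ℕ.≤-reflexive (sym (List.length-reverse us)))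

  oriented-wellFormed : {G : SimpleGraph n} {ds : List (Cycle n)} {B : Basic n} →
    BasicWF G B → Oriented ds B → WellFormed ds
  oriented-wellFormed {G = G} {ds} {B} (wf , u) ori =
    lengths wf ori , Unique-resp-↭ (↭-sym (oriented-verts ori)) u
    where
    lengths : ∀ {B ds} → All (ElemWF G) B → Oriented ds B → All (λ c → 1 ≤ length (proj₂ c)) ds
    lengths []       []                   = []
    lengths (w ∷ ws) (_∷_ {y = e} c∈ ori) = orient-length e w c∈ ∷ lengths ws ori

  -- The permutations supported on the basic subgraphs

  permVecs : (n : ℕ) → List (Vec (Fin n) n)
  permVecs n = filterᵇ injᵇ (allVecs n n)

  injᵇ⁻ : (v : Vec (Fin n) n) → injᵇ v ≡ true → Injective _≡_ _≡_ (lookup v)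
  injᵇ⁻ {n} v h {i} {j} eq with all⁻ _ (allFin n) (all⁻ _ (allFin n) h (∈-allFin i)) (∈-allFin j)
  ... | q with i ≟ j
  ... | yes i≡j = i≡j
  ... | no _ with () ← trans (sym q) (cong not (≡⇒== eq))

  injᵇ⁺ : (v : Vec (Fin n) n) → Injective _≡_ _≡_ (lookup v) → injᵇ v ≡ true
  injᵇ⁺ {n} v inj = all⁺ _ (allFin n) (λ {i} _ → all⁺ _ (allFin n) (λ {j} _ → distinct i j))
    where
    distinct : ∀ i j → ((i == j) ∨ not (lookup v i == lookup v j)) ≡ true
    distinct i j with i ≟ j
    ... | yes _   = refl
    ... | no i≢j = cong not (≢⇒== (i≢j ∘ inj))

  ∈-allVecs : ∀ {k} (v : Vec (Fin n) k) → v ∈ allVecs n k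
  ∈-allVecs []ᵛ      = here refl
  ∈-allVecs (i ∷ᵛ v) = ∈-concat⁺′ (∈-map⁺ (_∷ᵛ v) (∈-allFin i)) (∈-map⁺ _ (∈-allVecs v))

  allVecs-unique : ∀ n k → Unique (allVecs n k)
  allVecs-unique n zero    = [] ∷ []
  allVecs-unique n (suc k) = Unique.concat⁺
    (All.map⁺ (All.tabulate (λ {v} _ → Unique.map⁺ {f = _∷ᵛ v} (λ { refl → refl }) (Unique.allFin⁺ n))))
    (AllPairs.map⁺ (AllPairs.map disjoint (allVecs-unique n k)))
    where
    disjoint : ∀ {v w} → v ≢ w → ∀ {x} → ¬ (x ∈ map (_∷ᵛ v) (allFin n) × x ∈ map (_∷ᵛ w) (allFin n))
    disjoint v≢w (p , q) with _ , _ , refl ← ∈-map⁻ (_∷ᵛ _) p with _ , _ , refl ← ∈-map⁻ (_∷ᵛ _) q = v≢w refl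

  permVecs-unique : ∀ n → Unique (permVecs n)
  permVecs-unique n = filterᵇ-unique injᵇ (allVecs-unique n n)

  ∈-permVecs⁻ : {v : Vec (Fin n) n} → v ∈ permVecs n → Injective _≡_ _≡_ (lookup v)
  ∈-permVecs⁻ {n} {v} v∈ = injᵇ⁻ v (proj₂ (filterᵇ-∈⁻ injᵇ (allVecs n n) v∈))

  ∈-permVecs⁺ : {v : Vec (Fin n) n} → Injective _≡_ _≡_ (lookup v) → v ∈ permVecs n
  ∈-permVecs⁺ {n} {v} inj = filterᵇ-∈⁺ injᵇ (allVecs n n) (∈-allVecs v) (injᵇ⁺ v inj)

  inV⁻ : (B : Basic n) {x : Fin n} → inV B x ≡ true → x ∈ basicVerts B
  inV⁻ B eq with y , y∈ , q ← any⁻ _ (basicVerts B) eq = subst (_∈ basicVerts B) (sym (==⇒≡ q)) y∈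

  inV⁺ : (B : Basic n) {x : Fin n} → x ∈ basicVerts B → inV B x ≡ true
  inV⁺ B {x} x∈ = any⁺ _ x∈ (≡⇒== {i = x} refl)

  inE⁻ : (B : Basic n) {x y : Fin n} → inE B x y ≡ true → (x , y) ∈ᵘ basicEdges B
  inE⁻ B {x} {y} eq with (a , b) , e∈ , q ← any⁻ _ (basicEdges B) eq
    with a ≟ x | b ≟ y | a ≟ y | b ≟ x
  ... | yes refl | yes refl | _        | _        = inj₁ e∈
  ... | _        | _        | yes refl | yes refl = inj₂ e∈
  ... | yes refl | no _     | yes refl | no _     with () ← q
  ... | yes refl | no _     | no _     | _        with () ← q
  ... | no _     | _        | yes refl | no _     with () ← q
  ... | no _     | _        | no _     | _        with () ← q

  inE⁺ : (B : Basic n) {x y : Fin n} → (x , y) ∈ᵘ basicEdges B → inE B x y ≡ true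
  inE⁺ B {x} {y} (inj₁ e∈) = any⁺ _ e∈ (cong (_∨ ((x == y) ∧ (y == x))) (cong₂ _∧_ (≡⇒== {i = x} refl) (≡⇒== {i = y} refl)))
  inE⁺ B {x} {y} (inj₂ e∈) = any⁺ _ e∈ (trans
    (cong (((y == x) ∧ (x == y)) ∨_) (cong₂ _∧_ (≡⇒== {i = y} refl) (≡⇒== {i = x} refl)))
    (∨-zeroʳ ((y == x) ∧ (x == y))))

  elemEdges⇒verts : (e : Elem n) {x y : Fin n} → (x , y) ∈ elemEdges e → x ∈ elemVerts e × y ∈ elemVerts e
  elemEdges⇒verts (k2 u v) (here refl) = here refl , there (here refl)
  elemEdges⇒verts (cyc (u ∷ us)) e∈ rewrite cycEdges≡ u us = edges⇒source (u , us) e∈ , edges⇒target (u , us) e∈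

  basicEdges⇒verts : (B : Basic n) {x y : Fin n} → (x , y) ∈ basicEdges B → x ∈ basicVerts B × y ∈ basicVerts B
  basicEdges⇒verts (e ∷ B) e∈ with ∈-++⁻ (elemEdges e) e∈
  ... | inj₁ p = let q , r = elemEdges⇒verts e p in ∈-++⁺ˡ q , ∈-++⁺ˡ r
  ... | inj₂ p = let q , r = basicEdges⇒verts B p in ∈-++⁺ʳ (elemVerts e) q , ∈-++⁺ʳ (elemVerts e) r

  -- Once one edge of a walk is directed along R, all later ones are: an edge directed
  -- backwards would give some vertex two R-predecessors.
  module _ (R : A → A → Set) (unique-pred : ∀ {x y z} → R x z → R y z → x ≡ y) where

    path-directed : (a b : A) (l : List A) {z : A} → Unique (a ∷ b ∷ l) → z ∉ a ∷ b ∷ l → R a b →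
      (∀ {x y} → (x , y) ∈ pathE b l z → R x y ⊎ R y x) → ∀ {x y} → (x , y) ∈ pathE b l z → R x y
    path-directed a b [] u z∉ r h (here refl) with h (here refl)
    ... | inj₁ q = q
    ... | inj₂ q = ⊥-elim (z∉ (here (sym (unique-pred r q))))
    path-directed a b (c ∷ l) ((_ ∷ a≢c ∷ _) ∷ u) z∉ r h e∈ with h (here refl)
    ... | inj₂ q = ⊥-elim (a≢c (unique-pred r q))
    path-directed a b (c ∷ l) (_ ∷ u) z∉ r h (here refl) | inj₁ q = q
    path-directed a b (c ∷ l) (_ ∷ u) z∉ r h (there e∈)  | inj₁ q =
      path-directed b c l u (z∉ ∘ there) q (h ∘ there) e∈

    cycle-directed : (u v w : A) (l : List A) → Unique (u ∷ v ∷ w ∷ l) → R u v →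
      (∀ {x y} → (x , y) ∈ pathE u (v ∷ w ∷ l) u → R x y ⊎ R y x) →
      ∀ {x y} → (x , y) ∈ pathE u (v ∷ w ∷ l) u → R x y
    cycle-directed u v w l _ r h (here refl) = r
    cycle-directed u v w l ((u≢v ∷ u≢w ∷ u∉l) ∷ un) r h (there e∈) with h (there (here refl))
    ... | inj₂ q = ⊥-elim (u≢w (unique-pred r q))
    cycle-directed u v w l (_ ∷ un) r h (there (here refl)) | inj₁ q = q
    cycle-directed u v w l (u∉ ∷ un) r h (there (there e∈)) | inj₁ q =
      path-directed v w l un (λ u∈ → All.lookup u∉ u∈ refl) q (h ∘ there ∘ there) e∈

  module _ {G : SimpleGraph n} {σ : Fin n → Fin n} (inj : Injective _≡_ _≡_ σ) where

    orient-complete : (e : Elem n) → ElemWF G e → Unique (elemVerts e) →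
      (∀ {x y} → (x , y) ∈ elemEdges e → σ x ≡ y ⊎ σ y ≡ x) →
      (∀ {x} → x ∈ elemVerts e → (x , σ x) ∈ᵘ elemEdges e) →
      ∃ λ c → c ∈ orient e × Follows σ (edges c)
    orient-complete (k2 u v) wf ((u≢v ∷ _) ∷ _) h₁ h₂ = (u , [ v ]) , here refl , fol
      where
      fol : Follows σ (edges (u , [ v ]))
      fol (here refl) with h₂ (here refl)
      ... | inj₁ (here eq) = cong proj₂ eq
      ... | inj₂ (here eq) = ⊥-elim (u≢v (cong proj₂ eq))
      fol (there (here refl)) with h₂ (there (here refl))
      ... | inj₁ (here eq) = ⊥-elim (u≢v (sym (cong proj₁ eq)))
      ... | inj₂ (here eq) = cong proj₁ eq
    orient-complete (cyc (u ∷ []))      (s≤s () , _) _ _ _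
    orient-complete (cyc (u ∷ v ∷ []))  (s≤s (s≤s ()) , _) _ _ _
    orient-complete (cyc (u ∷ v ∷ w ∷ l)) wf un h₁ h₂
      rewrite cycEdges≡ u (v ∷ w ∷ l) with h₁ (here refl)
    ... | inj₁ σu≡v = (u , v ∷ w ∷ l) , here refl ,
      cycle-directed (λ x y → σ x ≡ y) (λ p q → inj (trans p (sym q))) u v w l un σu≡v h₁
    ... | inj₂ σv≡u = (u , reverse (v ∷ w ∷ l)) , there (here refl) ,
      λ e∈ → cycle-directed (λ x y → σ y ≡ x) (λ p q → trans (sym p) q) u v w l un σv≡u
        ([ inj₂ , inj₁ ]′ ∘ h₁) (edges-reverse (v ∷ w ∷ l) e∈)

    orientations-complete : (B : Basic n) → BasicWF G B →
      (∀ {x y} → (x , y) ∈ basicEdges B → σ x ≡ y ⊎ σ y ≡ x) →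
      (∀ {x} → x ∈ basicVerts B → (x , σ x) ∈ᵘ basicEdges B) →
      ∃ λ ds → Oriented ds B × Follows σ (E ds)
    orientations-complete [] wf h₁ h₂ = [] , [] , λ ()
    orientations-complete (e ∷ B) (w ∷ ws , u) h₁ h₂ =
      let c , c∈ , fol = orient-complete e w (unique-++⁻ˡ (elemVerts e) u) (h₁ ∘ ∈-++⁺ˡ) inner
          ds , ori , fols = orientations-complete B (ws , unique-++⁻ʳ (elemVerts e) u) (h₁ ∘ ∈-++⁺ʳ (elemEdges e)) outer
      in c ∷ ds , c∈ ∷ ori , λ e∈ → [ fol , fols ]′ (∈-++⁻ (edges c) e∈)
      where
      disjoint : ∀ {x} → x ∈ elemVerts e → x ∈ basicVerts B → ⊥
      disjoint = unique-++-disjoint (elemVerts e) u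
      inner : ∀ {x} → x ∈ elemVerts e → (x , σ x) ∈ᵘ elemEdges e
      inner x∈ with ∈ᵘ-++⁻ (elemEdges e) (h₂ (∈-++⁺ˡ x∈))
      ... | inj₁ p = p
      ... | inj₂ (inj₁ p) = ⊥-elim (disjoint x∈ (proj₁ (basicEdges⇒verts B p)))
      ... | inj₂ (inj₂ p) = ⊥-elim (disjoint x∈ (proj₂ (basicEdges⇒verts B p)))
      outer : ∀ {x} → x ∈ basicVerts B → (x , σ x) ∈ᵘ basicEdges B
      outer x∈ with ∈ᵘ-++⁻ (elemEdges e) (h₂ (∈-++⁺ʳ (elemVerts e) x∈))
      ... | inj₂ p = p
      ... | inj₁ (inj₁ p) = ⊥-elim (disjoint (proj₁ (elemEdges⇒verts e p)) x∈)
      ... | inj₁ (inj₂ p) = ⊥-elim (disjoint (proj₂ (elemEdges⇒verts e p)) x∈)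

  toElem : Cycle n → Elem n
  toElem (u , v ∷ []) = k2 u v
  toElem (u , us)     = cyc (u ∷ us)

  toElem-oriented : (ds : List (Cycle n)) → Oriented ds (map toElem ds)
  toElem-oriented []                       = []
  toElem-oriented ((u , [])         ∷ ds) = here refl ∷ toElem-oriented ds
  toElem-oriented ((u , v ∷ [])     ∷ ds) = here refl ∷ toElem-oriented ds
  toElem-oriented ((u , v ∷ w ∷ us) ∷ ds) = here refl ∷ toElem-oriented ds

  Adjacent : SimpleGraph n → Fin n × Fin n → Set
  Adjacent G (x , y) = SimpleGraph.adj G x y ≡ true

  toElem-wellFormed : {G : SimpleGraph n} (ds : List (Cycle n)) → WellFormed ds → All (Adjacent G) (E ds) →
    All (ElemWF G) (map toElem ds)
  toElem-wellFormed [] wf adj = []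
  toElem-wellFormed ((u , []) ∷ ds) (() ∷ _ , _) adj
  toElem-wellFormed ((u , v ∷ []) ∷ ds) (_ ∷ ls , _ ∷ _ ∷ un) (uv ∷ _ ∷ adj) = uv ∷ toElem-wellFormed ds (ls , un) adj
  toElem-wellFormed {G = G} ((u , v ∷ w ∷ us) ∷ ds) (_ ∷ ls , un) adj =
    (s≤s (s≤s (s≤s z≤n)) , unique-++⁻ˡ (u ∷ v ∷ w ∷ us) un ,
      subst (All (Adjacent G)) (sym (cycEdges≡ u (v ∷ w ∷ us))) (All.++⁻ˡ (edges (u , v ∷ w ∷ us)) adj))
    ∷ toElem-wellFormed ds (ls , unique-++⁻ʳ (u ∷ v ∷ w ∷ us) un) (All.++⁻ʳ (edges (u , v ∷ w ∷ us)) adj)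

  same-permutation⇒sameSubgraph : {σ : Fin n → Fin n} {ds ds′ : List (Cycle n)} {B B′ : Basic n} →
    Decomposes ds σ → Decomposes ds′ σ → Oriented ds B → Oriented ds′ B′ → SameSubgraph B B′
  same-permutation⇒sameSubgraph {σ = σ} d d′ o o′ =
      (λ x → true-iff⇒≡ (inV-mono {x = x} d d′ o o′) (inV-mono {x = x} d′ d o′ o))
    , (λ x y → true-iff⇒≡ (inE-mono {x = x} {y} d d′ o o′) (inE-mono {x = x} {y} d′ d o′ o))
    where
    E-mono : ∀ {ds ds′ x y} → Decomposes ds σ → Decomposes ds′ σ → (x , y) ∈ E ds → (x , y) ∈ E ds′
    E-mono {ds} {ds′} {x} d d′ e∈ = subst (λ z → (x , z) ∈ E ds′) (Decomposes.follows d e∈)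
      (moved⇒edge d′ (moves d (E⇒source ds e∈)))
    inV-mono : ∀ {ds ds′ B B′ x} → Decomposes ds σ → Decomposes ds′ σ → Oriented ds B → Oriented ds′ B′ →
      inV B x ≡ true → inV B′ x ≡ true
    inV-mono {ds} {ds′} {B} {B′} {x} d d′ o o′ p = inV⁺ B′ {x} (Perm.∈-resp-↭ (oriented-verts o′) (E⇒source ds′
      (E-mono d d′ (proj₂ (∈V⇒out ds (Perm.∈-resp-↭ (↭-sym (oriented-verts o)) (inV⁻ B {x} p)))))))
    inE-mono : ∀ {ds ds′ B B′ x y} → Decomposes ds σ → Decomposes ds′ σ → Oriented ds B → Oriented ds′ B′ →
      inE B x y ≡ true → inE B′ x y ≡ true
    inE-mono {B = B} {B′} d d′ o o′ p = inE⁺ B′ (oriented-edges⁻ o′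
      ([ inj₁ ∘ E-mono d d′ , inj₂ ∘ E-mono d d′ ]′ (oriented-edges⁺ o (inE⁻ B p))))

  sameSubgraph⇒oriented : {G : SimpleGraph n} {σ : Fin n → Fin n} {ds : List (Cycle n)} {B₀ B : Basic n} →
    Decomposes ds σ → Oriented ds B₀ → SameSubgraph B₀ B → BasicWF G B →
    ∃ λ ds′ → Oriented ds′ B × Decomposes ds′ σ
  sameSubgraph⇒oriented {G = G} {σ} {ds} {B₀} {B} d o (sameV , sameE) wf =
    let ds′ , o′ , fol = orientations-complete {G = G} (decomposes⇒injective d) B wf h₁ h₂
    in ds′ , o′ , record
      { wellFormed = oriented-wellFormed {G = G} wf o′
      ; follows = fol
      ; fixes = λ {x} x∉ → Decomposes.fixes d (λ x∈ → x∉ (Perm.∈-resp-↭ (↭-sym (oriented-verts o′))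
          (inV⁻ B {x} (trans (sym (sameV x)) (inV⁺ B₀ (Perm.∈-resp-↭ (oriented-verts o) x∈))))))
      }
    where
    h₁ : ∀ {x y} → (x , y) ∈ basicEdges B → σ x ≡ y ⊎ σ y ≡ x
    h₁ {x} {y} e∈ with oriented-edges⁺ o (inE⁻ B₀ (trans (sameE x y) (inE⁺ B (inj₁ e∈))))
    ... | inj₁ p = inj₁ (Decomposes.follows d p)
    ... | inj₂ p = inj₂ (Decomposes.follows d p)
    h₂ : ∀ {x} → x ∈ basicVerts B → (x , σ x) ∈ᵘ basicEdges B
    h₂ {x} x∈ = inE⁻ B (trans (sym (sameE x (σ x))) (inE⁺ B₀ (oriented-edges⁻ o (inj₁ (moved⇒edge d (moves d
      (Perm.∈-resp-↭ (↭-sym (oriented-verts o)) (inV⁻ B₀ {x} (trans (sameV x) (inV⁺ B x∈))))))))))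

  module _ {σ τ : Fin n → Fin n} {c : Cycle n} {ds : List (Cycle n)}
      (d : Decomposes (c ∷ ds) σ) (d′ : Decomposes ds τ) where
    open Decomposes

    tail-fixes : ∀ {x} → x ∈ verts c → τ x ≡ x
    tail-fixes x∈ = fixes d′ (unique-++-disjoint (verts c) (proj₂ (wellFormed d)) x∈)

    tail-agrees : ∀ {x} → x ∉ verts c → τ x ≡ σ x
    tail-agrees {x} x∉ with x ∈? V ds
    ... | yes x∈ = let y , e∈ = ∈V⇒out ds x∈ in
      trans (follows d′ e∈) (sym (follows d (∈-++⁺ʳ (edges c) e∈)))
    ... | no x∉ds = trans (fixes d′ x∉ds) (sym (fixes d ([ x∉ , x∉ds ]′ ∘ ∈-++⁻ (verts c))))

  wellFormed-tail : {c : Cycle n} {ds : List (Cycle n)} → WellFormed (c ∷ ds) → WellFormed ds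
  wellFormed-tail {c = c} (_ ∷ ls , u) = ls , unique-++⁻ʳ (verts c) u

  AllPairs-map∈ : {R S : A → A → Set} {xs : List A} → (∀ {x y} → x ∈ xs → y ∈ xs → R x y → S x y) →
    AllPairs R xs → AllPairs S xs
  AllPairs-map∈ f []       = []
  AllPairs-map∈ f (r ∷ rs) = All.tabulate (λ y∈ → f (here refl) (there y∈) (All.lookup r y∈))
    ∷ AllPairs-map∈ (λ x∈ y∈ → f (there x∈) (there y∈)) rs

  Distinct : List (Cycle n) → List (Cycle n) → Set
  Distinct ds ds′ = toVec ds ≢ toVec ds′

  toVec≡⇒decomposes : {ds : List (Cycle n)} (ds′ : List (Cycle n)) → WellFormed ds → toVec ds′ ≡ toVec ds → Decomposes ds (lookup (toVec ds′))
  toVec≡⇒decomposes {ds = ds} ds′ wf eq = subst (λ v → Decomposes ds (lookup v)) (sym eq) (toVec-decomposes wf)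

  distinct-∷ : {c : Cycle n} {ds ds′ : List (Cycle n)} → WellFormed (c ∷ ds) → WellFormed (c ∷ ds′) →
    Distinct ds ds′ → Distinct (c ∷ ds) (c ∷ ds′)
  distinct-∷ {c = c} {ds} {ds′} wf wf′ ne eq = ne (trans (sym (Vec.tabulate∘lookup _))
    (trans (Vec.tabulate-cong agree) (Vec.tabulate∘lookup _)))
    where
    d₁ = toVec-decomposes wf
    d₂ = toVec≡⇒decomposes (c ∷ ds) wf′ eq
    t₁ = toVec-decomposes (wellFormed-tail {c = c} wf)
    t₂ = toVec-decomposes (wellFormed-tail {c = c} wf′)
    agree : ∀ x → lookup (toVec ds) x ≡ lookup (toVec ds′) x
    agree x with x ∈? verts c
    ... | yes x∈ = trans (tail-fixes {c = c} d₁ t₁ x∈) (sym (tail-fixes {c = c} d₂ t₂ x∈))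
    ... | no x∉  = trans (tail-agrees {c = c} d₁ t₁ x∉) (sym (tail-agrees {c = c} d₂ t₂ x∉))

  distinct-reverse : {u v w : Fin n} {l : List (Fin n)} {ds ds′ : List (Cycle n)} →
    WellFormed ((u , v ∷ w ∷ l) ∷ ds) → WellFormed ((u , reverse (v ∷ w ∷ l)) ∷ ds′) →
    Distinct ((u , v ∷ w ∷ l) ∷ ds) ((u , reverse (v ∷ w ∷ l)) ∷ ds′)
  distinct-reverse {u = u} {v} {w} {l} {ds} wf@(_ , (_ ∷ u≢w ∷ _) ∷ _) wf′ eq =
    u≢w (decomposes⇒injective d (trans (Decomposes.follows d (here refl)) (sym (Decomposes.follows d′
      (∈-++⁺ˡ (∈-pathE-reverse u (v ∷ w ∷ l) u (there (here refl))))))))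
    where
    d  = toVec-decomposes wf
    d′ = toVec≡⇒decomposes ((u , v ∷ w ∷ l) ∷ ds) wf′ eq

  orientations-distinct : {G : SimpleGraph n} (B : Basic n) → BasicWF G B → AllPairs Distinct (orientations B)
  orientations-distinct [] wf = [] ∷ []
  orientations-distinct {n} {G} (e ∷ B) wf@(w ∷ ws , u) = AllPairs.concat⁺
      (All.map⁺ (All.tabulate λ {c} c∈ → AllPairs.map⁺ (AllPairs-map∈
        (λ ds∈ ds∈′ → distinct-∷ {c = c} (wf′ c∈ ds∈) (wf′ c∈ ds∈′)) (orientations-distinct {G = G} B (ws , unique-++⁻ʳ (elemVerts e) u)))))
      (AllPairs.map⁺ (orient-distinct e w wf′))
    where
    wf′ : ∀ {c ds} → c ∈ orient e → ds ∈ orientations B → WellFormed (c ∷ ds)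
    wf′ c∈ ds∈ = oriented-wellFormed {G = G} wf (c∈ ∷ ∈-orientations⁻ B ds∈)
    orient-distinct : (e : Elem n) → ElemWF G e →
      (∀ {c ds} → c ∈ orient e → ds ∈ orientations B → WellFormed (c ∷ ds)) →
      AllPairs (λ c c′ → All (λ ds → All (Distinct ds) (map (c′ ∷_) (orientations B))) (map (c ∷_) (orientations B))) (orient e)
    orient-distinct (k2 u v) _ _ = [] ∷ []
    orient-distinct (cyc []) _ _ = []
    orient-distinct (cyc (u ∷ [])) (s≤s () , _) _
    orient-distinct (cyc (u ∷ v ∷ [])) (s≤s (s≤s ()) , _) _
    orient-distinct (cyc (u ∷ v ∷ w ∷ l)) _ wfs =
      (All.map⁺ (All.tabulate λ ds∈ → All.map⁺ (All.tabulate λ ds∈′ →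
        distinct-reverse (wfs (here refl) ds∈) (wfs (there (here refl)) ds∈′))) ∷ []) ∷ [] ∷ []

  module _ (G : SimpleGraph n) (i : ℕ) (L : List (Basic n)) (enum : Enumerates𝓑 G i L) where
    private
      allWF    = proj₁ enum
      complete = proj₁ (proj₂ enum)
      separate = proj₂ (proj₂ enum)

    supported : List (Vec (Fin n) n)
    supported = map toVec (concatMap orientations L)

    ∈-orientations⇒wellFormed : ∀ {B ds} → B ∈ L → ds ∈ orientations B → WellFormed ds
    ∈-orientations⇒wellFormed {B} B∈ ds∈ =
      oriented-wellFormed {G = G} (proj₁ (All.lookup allWF B∈)) (∈-orientations⁻ B ds∈)

    supported-unique : Unique supported
    supported-unique = AllPairs.map⁺ (AllPairs.concat⁺
      (All.map⁺ (All.map (λ {B} (wf , _) → orientations-distinct {G = G} B wf) allWF))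
      (AllPairs.map⁺ (AllPairs-map∈ separated separate)))
      where
      separated : ∀ {B B′} → B ∈ L → B′ ∈ L → ¬ SameSubgraph B B′ →
        All (λ ds → All (Distinct ds) (orientations B′)) (orientations B)
      separated {B} {B′} B∈ B∈′ ns = All.tabulate λ {ds} ds∈ → All.tabulate λ ds∈′ eq →
        ns (same-permutation⇒sameSubgraph
          (toVec-decomposes (∈-orientations⇒wellFormed B∈ ds∈))
          (toVec≡⇒decomposes ds (∈-orientations⇒wellFormed B∈′ ds∈′) eq)
          (∈-orientations⁻ B ds∈) (∈-orientations⁻ B′ ds∈′))

    supported⊆permVecs : ∀ {v} → v ∈ supported → v ∈ permVecs n
    supported⊆permVecs v∈ with ds , ds∈ , refl ← ∈-map⁻ toVec v∈
      with _ , ds∈l , l∈ ← ∈-concat⁻′ (map orientations L) ds∈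
      with B , B∈ , refl ← ∈-map⁻ orientations l∈ =
      ∈-permVecs⁺ (decomposes⇒injective (toVec-decomposes (∈-orientations⇒wellFormed B∈ ds∈l)))

    supported-complete : ∀ {v ds} → Decomposes ds (lookup v) → All (Adjacent G) (E ds) → length (V ds) ≡ i → v ∈ supported
    supported-complete {v} {ds} d adj len =
      let o = toElem-oriented ds
          wf = Decomposes.wellFormed d
          B , B∈ , same = find (complete (map toElem ds)
            (toElem-wellFormed {G = G} ds wf adj , Unique-resp-↭ (oriented-verts o) (proj₂ wf))
            (trans (sym (Perm.↭-length (oriented-verts o))) len))
          ds′ , o′ , d′ = sameSubgraph⇒oriented {G = G} d o same (proj₁ (All.lookup allWF B∈))
      in subst (_∈ supported) (sym (decomposes⇒toVec d′))
           (∈-map⁺ toVec (∈-concat⁺′ (∈-orientations⁺ o′) (∈-map⁺ orientations B∈)))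

    permVecs-split : ∃ λ vs → permVecs n ↭ supported ++ vs ×
      (∀ {v} → v ∈ vs → ∃ λ ds → Decomposes ds (lookup v) × (All (Adjacent G) (E ds) → length (V ds) ≢ i))
    permVecs-split =
      let vs , p = unique-⊆⇒↭ supported-unique supported⊆permVecs
      in vs , p , λ {v} v∈ →
        let ds , d = decompose (lookup v) (∈-permVecs⁻ (Perm.∈-resp-↭ (↭-sym p) (∈-++⁺ʳ supported v∈)))
        in ds , d , λ adj len → unique-++-disjoint supported (Unique-resp-↭ p (permVecs-unique n))
             (supported-complete d adj len) v∈

  -- Moore products, one vertex at a time

  module _ {σ τ : Fin n → Fin n} {c : Cycle n} {ds : List (Cycle n)}
      (d : Decomposes (c ∷ ds) σ) (d′ : Decomposes ds τ) where

    tail-closed : ∀ {x} → x ∉ verts c → τ x ∉ verts c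
    tail-closed {x} x∉ τx∈ with x ∈? V ds
    ... | no x∉ds = x∉ (subst (_∈ verts c) (Decomposes.fixes d′ x∉ds) τx∈)
    ... | yes x∈ = let y , e∈ = ∈V⇒out ds x∈ in
      unique-++-disjoint (verts c) (proj₂ (Decomposes.wellFormed d)) τx∈
        (subst (_∈ V ds) (sym (Decomposes.follows d′ e∈)) (E⇒target ds e∈))

    isLeader-outside : ∀ {x} → x ∉ verts c → isLeader σ x ≡ isLeader τ x
    isLeader-outside x∉ = sym (isLeader-cong (_∉ verts c) tail-closed (tail-agrees {c = c} d d′) x∉)

  module _ {r ℓ : Level} (Rr : RawRing r ℓ) where
    open RawRing Rr using (Carrier; _≈_; 1#) renaming (_*_ to _·_)
    open MooreDet Rr
    open RR Rr

    cycleProdFrom : (Fin n → Fin n → Carrier) → (Fin n → Fin n) → Fin n → ℕ → Fin n → Carrier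
    cycleProdFrom M σ i zero    j = 1#
    cycleProdFrom M σ i (suc f) j = M j (σ j) · (if σ j == i then 1# else cycleProdFrom M σ i f (σ j))

    -- As for `cycEdges`; abstracting `suc m` separates the number of vertices from the remaining fuel m.
    private
      mutual
        cycleProd-go≡ : (M : Fin n → Fin n → Carrier) (σ : Fin n → Fin n) (i : Fin n) (f : ℕ) (j : Fin n) →
          _ ≡ cycleProdFrom M σ i f j

        cycleProd-unfold : ∀ m (M : Fin (suc m) → Fin (suc m) → Carrier) (σ : Fin (suc m) → Fin (suc m)) (i : Fin (suc m)) →
          cycleProd M σ i ≡ M i (σ i) · (if σ i == i then 1# else cycleProdFrom M σ i m (σ i))
        cycleProd-unfold m M σ i with suc m
        ... | w with σ i
        ... | j = cong (λ z → M i j · (if j == i then 1# else z)) (cycleProd-go≡ {w} M σ i m j)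

        cycleProd-go≡ M σ i zero    j = refl
        cycleProd-go≡ M σ i (suc f) j =
          cong (λ z → M j (σ j) · (if σ j == i then 1# else z)) (cycleProd-go≡ M σ i f (σ j))

    cycleProd≡ : (M : Fin n → Fin n → Carrier) (σ : Fin n → Fin n) (i : Fin n) →
      cycleProd M σ i ≡ cycleProdFrom M σ i n i
    cycleProd≡ {suc m} M σ i = cycleProd-unfold m M σ i

    cycleProd-congσ : (M : Fin n → Fin n → Carrier) (P : Fin n → Set) {σ τ : Fin n → Fin n} →
      (∀ {x} → P x → P (σ x)) → (∀ {x} → P x → σ x ≡ τ x) → ∀ {x} → P x → cycleProd M σ x ≡ cycleProd M τ x
    cycleProd-congσ {n} M P {σ} {τ} closed agree {i} pi = trans (cycleProd≡ M σ i) (trans (from n pi) (sym (cycleProd≡ M τ i)))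
      where
      from : ∀ f {j} → P j → cycleProdFrom M σ i f j ≡ cycleProdFrom M τ i f j
      from zero    pj = refl
      from (suc f) {j} pj rewrite sym (agree pj) = cong (λ z → M j (σ j) · (if σ j == i then 1# else z)) (from f (closed pj))

    factor : (Fin n → Fin n → Carrier) → (Fin n → Fin n) → Fin n → Carrier
    factor M σ v = if isLeader σ v then cycleProd M σ v else 1#

    factor-outside : (M : Fin n → Fin n → Carrier) {σ τ : Fin n → Fin n} {c : Cycle n} {ds : List (Cycle n)} →
      Decomposes (c ∷ ds) σ → Decomposes ds τ → ∀ {x} → x ∉ verts c → factor M σ x ≡ factor M τ x
    factor-outside M {c = c} d d′ x∉ rewrite isLeader-outside {c = c} d d′ x∉
      | cycleProd-congσ M (_∉ verts c) (tail-closed {c = c} d d′) (tail-agrees {c = c} d d′) x∉ = refl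

    walkProd : (Fin n → Fin n → Carrier) → List (Fin n × Fin n) → Carrier
    walkProd M es = prodL (map (λ (x , y) → M x y) es)

    module _ (isMonoid : IsMonoid _≈_ _·_ 1#) where
      open IsMonoid isMonoid using (∙-cong; ∙-congˡ; identityˡ; identityʳ) renaming (refl to ≈-refl; trans to ≈-trans; sym to ≈-sym; reflexive to ≈-reflexive)

      prodL-cong : {f g : A → Carrier} (xs : List A) → (∀ {x} → x ∈ xs → f x ≈ g x) → prodL (map f xs) ≈ prodL (map g xs)
      prodL-cong []       h = ≈-refl
      prodL-cong (x ∷ xs) h = ∙-cong (h (here refl)) (prodL-cong xs (h ∘ there))

      prodL-filter : (p : A → Bool) (f : A → Carrier) (xs : List A) →
        prodL (map f (filterᵇ p xs)) ≈ prodL (map (λ x → if p x then f x else 1#) xs)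
      prodL-filter p f [] = ≈-refl
      prodL-filter p f (x ∷ xs) with p x
      ... | true  = ∙-congˡ (prodL-filter p f xs)
      ... | false = ≈-trans (prodL-filter p f xs) (≈-sym (identityˡ _))

      mσ≈factors : (M : Fin n → Fin n → Carrier) (σ : Fin n → Fin n) →
        mσ M σ ≈ prodL (map (factor M σ) (reverse (allFin n)))
      mσ≈factors {n} M σ = prodL-filter (isLeader σ) (cycleProd M σ) (reverse (allFin n))

      mσ-cong : {M M′ : Fin n → Fin n → Carrier} {σ : Fin n → Fin n} →
        (∀ x → M x (σ x) ≈ M′ x (σ x)) → mσ M σ ≈ mσ M′ σ
      mσ-cong {n} {M} {M′} {σ} h = prodL-cong (leaders σ) (λ {i} _ → ≈-trans (≈-reflexive (cycleProd≡ M σ i))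
        (≈-trans (from n i i) (≈-reflexive (sym (cycleProd≡ M′ σ i)))))
        where
        from : ∀ f i j → cycleProdFrom M σ i f j ≈ cycleProdFrom M′ σ i f j
        from zero    i j = ≈-refl
        from (suc f) i j with σ j == i
        ... | true  = ∙-cong (h j) ≈-refl
        ... | false = ∙-cong (h j) (from f i (σ j))

      cycleProd-cycle : (M : Fin n → Fin n → Carrier) {σ : Fin n → Fin n} (c : Cycle n) →
        Follows σ (edges c) → Unique (verts c) → cycleProd M σ (proj₁ c) ≈ walkProd M (edges c)
      cycleProd-cycle {n} M {σ} (i , us) fol u@(i∉ ∷ _) =
        ≈-trans (≈-reflexive (cycleProd≡ M σ i)) (from n i us (unique-length≤ u) fol (λ i∈ → All.lookup i∉ i∈ refl))
        where
        from : ∀ f x r → length r < f → Follows σ (pathE x r i) → i ∉ r →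
          cycleProdFrom M σ i f x ≈ walkProd M (pathE x r i)
        from (suc f) x [] _ fol i∉ rewrite fol (here refl) | ≡⇒== {i = i} refl = ≈-refl
        from (suc f) x (y ∷ r) (s≤s r<f) fol i∉ rewrite fol (here refl) | ≢⇒== {i = y} {i} (i∉ ∘ here ∘ sym) =
          ∙-congˡ (from f y r r<f (fol ∘ there) (i∉ ∘ there))

      factor-leader : (M : Fin n → Fin n → Carrier) {σ : Fin n → Fin n} (c : Cycle n) →
        Follows σ (edges c) → Unique (verts c) → (∀ {x} → x ∈ verts c → toℕ (proj₁ c) ≤ toℕ x) →
        factor M σ (proj₁ c) ≈ walkProd M (edges c)
      factor-leader M {σ} c fol u min rewrite minimal⇒isLeader c {σ} fol (here refl) min = cycleProd-cycle M c fol u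

      factor-nonleader : (M : Fin n → Fin n → Carrier) {σ : Fin n → Fin n} (c : Cycle n) →
        Follows σ (edges c) → Unique (verts c) → ∀ {m v} → m ∈ verts c → (∀ {x} → x ∈ verts c → toℕ m ≤ toℕ x) →
        v ∈ verts c → v ≢ m → factor M σ v ≡ 1#
      factor-nonleader M {σ} c fol u {m} {v} m∈ min v∈ v≢m with isLeader σ v in lead
      ... | false = refl
      ... | true  = ⊥-elim (v≢m (Fin.toℕ-injective (ℕ.≤-antisym (isLeader⇒minimal c {σ} fol u v∈ m∈ lead) (min v∈))))

      factor-fixed : (M : Fin n → Fin n → Carrier) {σ : Fin n → Fin n} {v : Fin n} → σ v ≡ v → factor M σ v ≈ M v v
      factor-fixed M {σ} {v} eq = ≈-trans
        (factor-leader M (v , []) (λ { (here refl) → eq }) ([] ∷ []) (λ { (here refl) → ℕ.≤-refl })) (identityʳ _)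

  cycleOf : {ds : List (Cycle n)} {σ : Fin n → Fin n} → Decomposes ds σ → ∀ x →
    ∃ λ c → Follows σ (edges c) × Unique (verts c) × x ∈ verts c
  cycleOf {ds = ds} d x with x ∈? V ds
  ... | no x∉ = (x , []) , (λ { (here refl) → Decomposes.fixes d x∉ }) , [] ∷ [] , here refl
  ... | yes x∈ = within ds (proj₂ (Decomposes.wellFormed d)) (Decomposes.follows d) x∈
    where
    within : ∀ {σ} ds → Unique (V ds) → Follows σ (E ds) → x ∈ V ds →
      ∃ λ c → Follows σ (edges c) × Unique (verts c) × x ∈ verts c
    within (c ∷ ds) u fol x∈ with ∈-++⁻ (verts c) x∈
    ... | inj₁ x∈c  = c , fol ∘ ∈-++⁺ˡ , unique-++⁻ˡ (verts c) u , x∈c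
    ... | inj₂ x∈ds = within ds (unique-++⁻ʳ (verts c) u) (fol ∘ ∈-++⁺ʳ (edges c)) x∈ds

  -- Counting leaders and fixed points

  indicator : Bool → ℕ
  indicator b = if b then 1 else 0

  vertices : (n : ℕ) → List (Fin n)
  vertices n = reverse (allFin n)

  ∈-vertices : (x : Fin n) → x ∈ vertices n
  ∈-vertices x = Any.reverse⁺ (∈-allFin x)

  vertices-unique : ∀ n → Unique (vertices n)
  vertices-unique n = Unique-resp-↭ (↭-sym (Perm.↭-reverse (allFin n))) (Unique.allFin⁺ n)

  length-vertices : ∀ n → length (vertices n) ≡ n
  length-vertices n = trans (List.length-reverse (allFin n)) (List.length-tabulate {n = n} id)

  sum-map-+ : (f g : A → ℕ) (xs : List A) → sum (map (λ x → f x + g x) xs) ≡ sum (map f xs) + sum (map g xs)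
  sum-map-+ f g [] = refl
  sum-map-+ f g (x ∷ xs) = trans (cong (f x + g x +_) (sum-map-+ f g xs))
    (solve 4 (λ a b c d → a :+ b :+ (c :+ d) := a :+ c :+ (b :+ d)) refl (f x) (g x) (sum (map f xs)) (sum (map g xs)))

  sum-map-const : {f : A → ℕ} {k : ℕ} (xs : List A) → (∀ {x} → x ∈ xs → f x ≡ k) → sum (map f xs) ≡ length xs * k
  sum-map-const []       h = refl
  sum-map-const (x ∷ xs) h = cong₂ _+_ (h (here refl)) (sum-map-const xs (h ∘ there))

  sum-indicator : {l : List (Fin n)} → Unique l → sum (map (λ v → indicator (does (v ∈? l))) (vertices n)) ≡ length l
  sum-indicator {n} {l} u with zs , p ← unique-⊆⇒↭ {ys = vertices n} u (λ _ → ∈-vertices _) = begin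
    sum (map f (vertices n))             ≡⟨ sum-↭ (Perm.map⁺ f p) ⟩
    sum (map f (l ++ zs))                ≡⟨ cong sum (List.map-++ f l zs) ⟩
    sum (map f l ++ map f zs)            ≡⟨ sum-++ (map f l) (map f zs) ⟩
    sum (map f l) + sum (map f zs)       ≡⟨ cong₂ _+_
      (sum-map-const l (λ x∈ → cong indicator (dec-true (_ ∈? l) x∈)))
      (sum-map-const zs (λ x∈ → cong indicator (dec-false (_ ∈? l) (λ x∈l →
        unique-++-disjoint l (Unique-resp-↭ p (vertices-unique n)) x∈l x∈)))) ⟩
    length l * 1 + length zs * 0         ≡⟨ cong₂ _+_ (ℕ.*-identityʳ _) (ℕ.*-zeroʳ (length zs)) ⟩
    length l + 0                         ≡⟨ ℕ.+-identityʳ _ ⟩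
    length l                             ∎
    where
    open ≡-Reasoning
    f = λ v → indicator (does (v ∈? l))

  length-filterᵇ : (p : A → Bool) (xs : List A) → length (filterᵇ p xs) ≡ sum (map (indicator ∘ p) xs)
  length-filterᵇ p []       = refl
  length-filterᵇ p (x ∷ xs) with p x
  ... | true  = cong suc (length-filterᵇ p xs)
  ... | false = length-filterᵇ p xs

  unique-head : {c : Cycle n} {ds : List (Cycle n)} {σ : Fin n → Fin n} → Decomposes (c ∷ ds) σ → Unique (verts c)
  unique-head {c = c} d = unique-++⁻ˡ (verts c) (proj₂ (Decomposes.wellFormed d))

  leaders-count : (ds : List (Cycle n)) {σ : Fin n → Fin n} → Decomposes ds σ →
    length (leaders σ) + length (V ds) ≡ n + length ds
  leaders-count {n} [] {σ} d = cong (_+ 0) (trans (length-filterᵇ (isLeader σ) (vertices n))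
    (trans (sum-map-const (vertices n) (λ {x} _ → cong indicator (fixed⇒isLeader {σ = σ} (Decomposes.fixes d {x} λ ()))))
      (trans (ℕ.*-identityʳ _) (length-vertices n))))
  leaders-count {n} (c@(u , us) ∷ ds) {σ} d = let open ≡-Reasoning in begin
    length (leaders σ) + length (V (c ∷ ds))
      ≡⟨ cong₂ _+_ (length-filterᵇ (isLeader σ) (vertices n)) (List.length-++ (verts c)) ⟩
    Σ (indicator ∘ isLeader σ) + (length (verts c) + length (V ds))
      ≡⟨ ℕ.+-assoc (Σ (indicator ∘ isLeader σ)) _ _ ⟨
    Σ (indicator ∘ isLeader σ) + length (verts c) + length (V ds)
      ≡⟨ cong (λ k → Σ (indicator ∘ isLeader σ) + k + length (V ds)) (sum-indicator (unique-head {c = c} d)) ⟨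
    Σ (indicator ∘ isLeader σ) + Σ (λ v → indicator (does (v ∈? verts c))) + length (V ds)
      ≡⟨ cong (_+ length (V ds)) vertexwise ⟩
    Σ (indicator ∘ isLeader τ) + Σ (λ v → indicator (does (v ∈? [ m ]))) + length (V ds)
      ≡⟨ cong₂ (λ j k → j + k + length (V ds)) (sym (length-filterᵇ (isLeader τ) (vertices n))) (sum-indicator {l = [ m ]} ([] ∷ [])) ⟩
    length (leaders τ) + 1 + length (V ds)
      ≡⟨ solve 2 (λ a b → a :+ con 1 :+ b := con 1 :+ (a :+ b)) refl (length (leaders τ)) (length (V ds)) ⟩
    suc (length (leaders τ) + length (V ds))
      ≡⟨ cong suc (leaders-count ds d′) ⟩
    suc (n + length ds)
      ≡⟨ ℕ.+-suc n (length ds) ⟨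
    n + length (c ∷ ds) ∎
    where
    Σ : (Fin n → ℕ) → ℕ
    Σ f = sum (map f (vertices n))
    τ = lookup (toVec ds)
    d′ : Decomposes ds τ
    d′ = toVec-decomposes (wellFormed-tail {c = c} (Decomposes.wellFormed d))
    m = proj₁ (minimum u us)
    m∈ = proj₁ (proj₂ (minimum u us))
    min = proj₂ (proj₂ (minimum u us))
    fol : Follows σ (edges c)
    fol = Decomposes.follows d ∘ ∈-++⁺ˡ
    pointwise : ∀ v → indicator (isLeader σ v) + indicator (does (v ∈? verts c))
                    ≡ indicator (isLeader τ v) + indicator (does (v ∈? [ m ]))
    pointwise v = by (v ∈? verts c) (v ≟ m)
      where
      by : Dec (v ∈ verts c) → Dec (v ≡ m) → indicator (isLeader σ v) + indicator (does (v ∈? verts c))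
                    ≡ indicator (isLeader τ v) + indicator (does (v ∈? [ m ]))
      by (no v∉) _
        rewrite dec-false (v ∈? verts c) v∉ | dec-false (v ∈? [ m ]) (λ { (here refl) → v∉ m∈ })
              | isLeader-outside {c = c} d d′ v∉ = refl
      by (yes v∈) (yes refl)
        rewrite dec-true (v ∈? verts c) v∈ | dec-true (v ∈? [ m ]) (here refl)
              | fixed⇒isLeader {σ = τ} (tail-fixes {c = c} d d′ v∈) | minimal⇒isLeader c {σ} fol v∈ min = refl
      by (yes v∈) (no v≢m)
        rewrite dec-true (v ∈? verts c) v∈ | dec-false (v ∈? [ m ]) (λ { (here eq) → v≢m eq })
              | fixed⇒isLeader {σ = τ} (tail-fixes {c = c} d d′ v∈) with isLeader σ v in lead
      ... | false = refl
      ... | true  = ⊥-elim (v≢m (Fin.toℕ-injective (ℕ.≤-antisym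
        (isLeader⇒minimal c {σ} fol (unique-head {c = c} d) v∈ m∈ lead) (min v∈))))
    vertexwise : Σ (indicator ∘ isLeader σ) + Σ (λ v → indicator (does (v ∈? verts c)))
               ≡ Σ (indicator ∘ isLeader τ) + Σ (λ v → indicator (does (v ∈? [ m ])))
    vertexwise = trans (sym (sum-map-+ (indicator ∘ isLeader σ) _ (vertices n))) (trans
      (cong sum (List.map-cong pointwise (vertices n))) (sum-map-+ (indicator ∘ isLeader τ) _ (vertices n)))

  -- With + in the role of the product, Moore products add up exponents.
  exponents : RawRing 0ℓ 0ℓ
  exponents = record
    { Carrier = ℕ ; _≈_ = _≡_ ; _+_ = _+_ ; _*_ = _+_ ; -_ = id ; 0# = 0 ; 1# = 0 }

  loops : Fin n → Fin n → ℕ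
  loops i j = indicator (i == j)

  exponent : (Fin n → Fin n) → ℕ
  exponent = MooreDet.mσ exponents loops

  exponent≡factors : (σ : Fin n → Fin n) → exponent σ ≡ sum (map (factor exponents loops σ) (vertices n))
  exponent≡factors = mσ≈factors exponents ℕ.+-0-isMonoid loops

  walkProd-loops : (es : List (Fin n × Fin n)) → (∀ {x y} → (x , y) ∈ es → x ≢ y) → walkProd exponents loops es ≡ 0
  walkProd-loops []             h = refl
  walkProd-loops ((x , y) ∷ es) h = cong₂ _+_ (cong indicator (≢⇒== (h (here refl)))) (walkProd-loops es (h ∘ there))

  factor-loops-fixed : {σ : Fin n → Fin n} {v : Fin n} → σ v ≡ v → factor exponents loops σ v ≡ 1
  factor-loops-fixed {v = v} eq = trans (factor-fixed exponents ℕ.+-0-isMonoid loops eq) (cong indicator (≡⇒== {i = v} refl))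

  exponent-count : (ds : List (Cycle n)) {σ : Fin n → Fin n} → Decomposes ds σ → exponent σ + length (V ds) ≡ n
  exponent-count {n} [] {σ} d = trans (ℕ.+-identityʳ _) (trans (exponent≡factors σ) (trans
    (sum-map-const (vertices n) (λ {x} _ → factor-loops-fixed {σ = σ} (Decomposes.fixes d {x} λ ())))
    (trans (ℕ.*-identityʳ _) (length-vertices n))))
  exponent-count {n} (c@(u , us) ∷ ds) {σ} d = begin
    exponent σ + length (V (c ∷ ds))
      ≡⟨ cong₂ _+_ (exponent≡factors σ) (List.length-++ (verts c)) ⟩
    total σ + (length (verts c) + length (V ds))
      ≡⟨ ℕ.+-assoc (total σ) _ _ ⟨
    total σ + length (verts c) + length (V ds)
      ≡⟨ cong (λ k → total σ + k + length (V ds)) (sum-indicator (unique-head {c = c} d)) ⟨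
    total σ + sum (map (λ v → indicator (does (v ∈? verts c))) (vertices n)) + length (V ds)
      ≡⟨ cong (_+ length (V ds)) (trans (sym (sum-map-+ (factor exponents loops σ) _ (vertices n)))
           (cong sum (List.map-cong (λ v → pointwise v (v ∈? verts c)) (vertices n)))) ⟩
    total τ + length (V ds)
      ≡⟨ cong (_+ length (V ds)) (exponent≡factors τ) ⟨
    exponent τ + length (V ds)
      ≡⟨ exponent-count ds d′ ⟩
    n ∎
    where
    open ≡-Reasoning
    total : (Fin n → Fin n) → ℕ
    total σ = sum (map (factor exponents loops σ) (vertices n))
    τ = lookup (toVec ds)
    d′ : Decomposes ds τ
    d′ = toVec-decomposes (wellFormed-tail {c = c} (Decomposes.wellFormed d))
    m∈ = proj₁ (proj₂ (minimum u us))
    min = proj₂ (proj₂ (minimum u us))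
    fol : Follows σ (edges c)
    fol = Decomposes.follows d ∘ ∈-++⁺ˡ
    rot = rotate c m∈
    open Rotation rot
    inside : ∀ {v} → v ∈ verts c → factor exponents loops σ v ≡ 0
    inside {v} v∈ with v ≟ proj₁ (minimum u us)
    ... | no v≢m = factor-nonleader exponents ℕ.+-0-isMonoid loops c fol (unique-head {c = c} d) m∈ min v∈ v≢m
    ... | yes refl = trans (factor-leader exponents ℕ.+-0-isMonoid loops rotated
        (fol ∘ Perm.∈-resp-↭ edges-↭) (Unique-resp-↭ (↭-sym verts-↭) (unique-head {c = c} d)) (min ∘ Perm.∈-resp-↭ verts-↭))
      (walkProd-loops (edges rotated) (λ e∈ → E-irreflexive (c ∷ ds) (Decomposes.wellFormed d)
        (∈-++⁺ˡ (Perm.∈-resp-↭ edges-↭ e∈))))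
    pointwise : ∀ v → Dec (v ∈ verts c) →
      factor exponents loops σ v + indicator (does (v ∈? verts c)) ≡ factor exponents loops τ v
    pointwise v (yes v∈) = trans (cong₂ _+_ (inside v∈) (cong indicator (dec-true (v ∈? verts c) v∈)))
      (sym (factor-loops-fixed {σ = τ} (tail-fixes {c = c} d d′ v∈)))
    pointwise v (no v∉) = trans (cong₂ _+_ (factor-outside exponents loops {c = c} d d′ v∉)
      (cong indicator (dec-false (v ∈? verts c) v∉))) (ℕ.+-identityʳ _)

open CycleDecompositions

-- Cayley–Dickson doubling and dual numbers

IsRing′ : {c ℓ : Level} → RawRing c ℓ → Set (c ⊔ ℓ)
IsRing′ A = IsRing _≈_ _+_ _*_ -_ 0# 1#
  where open RawRing A

record IsStarAlgebra {c ℓ : Level} (K : CommutativeRing c ℓ) (A : RawRing c ℓ)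
    (conj : RawRing.Carrier A → RawRing.Carrier A)
    (re : RawRing.Carrier A → CommutativeRing.Carrier K)
    (emb : CommutativeRing.Carrier K → RawRing.Carrier A) : Set (c ⊔ ℓ) where
  private module K = CommutativeRing K
  open RawRing A
  field
    isRing    : IsRing′ A
    conj-cong : ∀ {x y} → x ≈ y → conj x ≈ conj y
    conj-+    : ∀ x y → conj (x + y) ≈ conj x + conj y
    conj-*    : ∀ x y → conj (x * y) ≈ conj y * conj x
    conj-neg  : ∀ x → conj (- x) ≈ - conj x
    conj-0    : conj 0# ≈ 0#
    conj-1    : conj 1# ≈ 1#
    conj-conj : ∀ x → conj (conj x) ≈ x
    re-cong   : ∀ {x y} → x ≈ y → re x K.≈ re y
    re-+      : ∀ x y → re (x + y) K.≈ re x K.+ re y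
    re-neg    : ∀ x → re (- x) K.≈ K.- re x
    re-conj   : ∀ x → re (conj x) K.≈ re x
    re-comm   : ∀ x y → re (x * y) K.≈ re (y * x)
    emb-cong  : ∀ {r s} → r K.≈ s → emb r ≈ emb s
    emb-+     : ∀ r s → emb (r K.+ s) ≈ emb r + emb s
    emb-*     : ∀ r s → emb (r K.* s) ≈ emb r * emb s
    emb-neg   : ∀ r → emb (K.- r) ≈ - emb r
    emb-0     : emb K.0# ≈ 0#
    emb-1     : emb K.1# ≈ 1#
    conj-emb  : ∀ r → conj (emb r) ≈ emb r
    central   : ∀ r x → emb r * x ≈ x * emb r
    trace     : ∀ x → x + conj x ≈ emb (re x K.+ re x)

  ring : Ring c ℓ
  ring = record { isRing = isRing }

module _ {c ℓ : Level} (R : CommutativeRing c ℓ) where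
  open Algebras R

  IsStar : StarAlg → Set (c ⊔ ℓ)
  IsStar A = IsStarAlgebra R (StarAlg.raw A) (StarAlg.conj A) (StarAlg.re A) (StarAlg.emb A)

  base-isStar : IsStar baseAlg
  base-isStar = record
    { isRing = R.isRing
    ; conj-cong = λ p → p
    ; conj-+ = λ _ _ → R.refl
    ; conj-* = R.*-comm
    ; conj-neg = λ _ → R.refl
    ; conj-0 = R.refl
    ; conj-1 = R.refl
    ; conj-conj = λ _ → R.refl
    ; re-cong = λ p → p
    ; re-+ = λ _ _ → R.refl
    ; re-neg = λ _ → R.refl
    ; re-conj = λ _ → R.refl
    ; re-comm = R.*-comm
    ; emb-cong = λ p → p
    ; emb-+ = λ _ _ → R.refl
    ; emb-* = λ _ _ → R.refl
    ; emb-neg = λ _ → R.refl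
    ; emb-0 = R.refl
    ; emb-1 = R.refl
    ; conj-emb = λ _ → R.refl
    ; central = R.*-comm
    ; trace = λ _ → R.refl
    }

  module _ (A : StarAlg) (A-isStar : IsStar A)
      (*-comm : ∀ x y → RawRing._≈_ (StarAlg.raw A) (RawRing._*_ (StarAlg.raw A) x y) (RawRing._*_ (StarAlg.raw A) y x)) where
    open StarAlg A using (conj; re; emb)
    open IsStarAlgebra A-isStar

    private
      commutativeRing : CommutativeRing c ℓ
      commutativeRing = record { isCommutativeRing = record { isRing = isRing ; *-comm = *-comm } }

    open CommutativeRing commutativeRing hiding (isRing; *-comm; ring)
    open RingProperties ring
    open SemiringSolver commutativeSemiring using (solve; _:+_; _:*_; _:=_)
    open SetoidReasoning setoid

    private
      -- Writing −x as m x turns the ring identities below into semiring identities.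
      m : Carrier
      m = - 1#

      neg : ∀ x → - x ≈ m * x
      neg x = sym (-1*x≈-x x)

      sub : ∀ x y → x + - y ≈ x + m * y
      sub x y = +-congˡ (neg y)

      open RawRing (StarAlg.raw (CD A)) using () renaming (_*_ to _⊛_; _≈_ to _≋_; _+_ to _⊕_)

    CD-assoc : ∀ x y z → (x ⊛ y) ⊛ z ≋ x ⊛ (y ⊛ z)
    CD-assoc (a , b) (p , q) (e , f) = eq₁ , eq₂
      where
      eq₁ : (a * p + - (conj q * b)) * e + - (conj f * (q * a + b * conj p))
            ≈ a * (p * e + - (conj f * q)) + - (conj (f * p + q * conj e) * b)
      eq₁ = begin
        (a * p + - (conj q * b)) * e + - (conj f * (q * a + b * conj p))
          ≈⟨ +-cong (*-congʳ (sub _ _)) (neg _) ⟩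
        (a * p + m * (conj q * b)) * e + m * (conj f * (q * a + b * conj p))
          ≈⟨ solve 9 (λ m a b p p' q q' e f' →
               (a :* p :+ m :* (q' :* b)) :* e :+ m :* (f' :* (q :* a :+ b :* p'))
               := a :* (p :* e :+ m :* (f' :* q)) :+ m :* ((p' :* f' :+ e :* q') :* b))
               refl m a b p (conj p) q (conj q) e (conj f) ⟩
        a * (p * e + m * (conj f * q)) + m * ((conj p * conj f + e * conj q) * b)
          ≈⟨ +-cong (*-congˡ (sub _ _)) (*-congˡ (*-congʳ (trans (conj-+ _ _) (+-cong (conj-* _ _) (trans (conj-* _ _) (*-congʳ (conj-conj _))))))) ⟨
        a * (p * e + - (conj f * q)) + m * (conj (f * p + q * conj e) * b)
          ≈⟨ sub _ _ ⟨
        a * (p * e + - (conj f * q)) + - (conj (f * p + q * conj e) * b) ∎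
      eq₂ : f * (a * p + - (conj q * b)) + (q * a + b * conj p) * conj e
            ≈ (f * p + q * conj e) * a + b * conj (p * e + - (conj f * q))
      eq₂ = begin
        f * (a * p + - (conj q * b)) + (q * a + b * conj p) * conj e
          ≈⟨ +-congʳ (*-congˡ (sub _ _)) ⟩
        f * (a * p + m * (conj q * b)) + (q * a + b * conj p) * conj e
          ≈⟨ solve 9 (λ m a b p p' q q' e' f →
               f :* (a :* p :+ m :* (q' :* b)) :+ (q :* a :+ b :* p') :* e'
               := (f :* p :+ q :* e') :* a :+ b :* (e' :* p' :+ m :* (q' :* f)))
               refl m a b p (conj p) q (conj q) (conj e) f ⟩
        (f * p + q * conj e) * a + b * (conj e * conj p + m * (conj q * f))
          ≈⟨ +-congˡ (*-congˡ (trans (conj-+ _ _) (+-cong (conj-* _ _) (trans (conj-neg _) (trans (neg _) (*-congˡ (trans (conj-* _ _) (*-congˡ (conj-conj _))))))))) ⟨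
        (f * p + q * conj e) * a + b * conj (p * e + - (conj f * q)) ∎

    CD-distribˡ : ∀ x y z → x ⊛ (y ⊕ z) ≋ (x ⊛ y) ⊕ (x ⊛ z)
    CD-distribˡ (a , b) (p , q) (e , f) =
      (begin
        a * (p + e) + - (conj (q + f) * b)
          ≈⟨ +-congˡ (trans (neg _) (*-congˡ (*-congʳ (conj-+ _ _)))) ⟩
        a * (p + e) + m * ((conj q + conj f) * b)
          ≈⟨ solve 7 (λ m a b p q' e f' → a :* (p :+ e) :+ m :* ((q' :+ f') :* b)
               := (a :* p :+ m :* (q' :* b)) :+ (a :* e :+ m :* (f' :* b)))
               refl m a b p (conj q) e (conj f) ⟩
        (a * p + m * (conj q * b)) + (a * e + m * (conj f * b))
          ≈⟨ +-cong (sub _ _) (sub _ _) ⟨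
        (a * p + - (conj q * b)) + (a * e + - (conj f * b)) ∎) ,
      (begin
        (q + f) * a + b * conj (p + e)
          ≈⟨ +-congˡ (*-congˡ (conj-+ _ _)) ⟩
        (q + f) * a + b * (conj p + conj e)
          ≈⟨ solve 6 (λ a b p' q e' f → (q :+ f) :* a :+ b :* (p' :+ e')
               := (q :* a :+ b :* p') :+ (f :* a :+ b :* e'))
               refl a b (conj p) q (conj e) f ⟩
        (q * a + b * conj p) + (f * a + b * conj e) ∎)

    CD-distribʳ : ∀ x y z → (y ⊕ z) ⊛ x ≋ (y ⊛ x) ⊕ (z ⊛ x)
    CD-distribʳ (a , b) (p , q) (e , f) =
      (begin
        (p + e) * a + - (conj b * (q + f))
          ≈⟨ sub _ _ ⟩
        (p + e) * a + m * (conj b * (q + f))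
          ≈⟨ solve 7 (λ m a b' p q e f → (p :+ e) :* a :+ m :* (b' :* (q :+ f))
               := (p :* a :+ m :* (b' :* q)) :+ (e :* a :+ m :* (b' :* f)))
               refl m a (conj b) p q e f ⟩
        (p * a + m * (conj b * q)) + (e * a + m * (conj b * f))
          ≈⟨ +-cong (sub _ _) (sub _ _) ⟨
        (p * a + - (conj b * q)) + (e * a + - (conj b * f)) ∎) ,
      solve 6 (λ a' b p q e f → b :* (p :+ e) :+ (q :+ f) :* a'
               := (b :* p :+ q :* a') :+ (b :* e :+ f :* a'))
               refl (conj a) b p q e f

    private
      +-neg-0 : ∀ {x y} → y ≈ 0# → x + - y ≈ x
      +-neg-0 y≈0 = trans (+-congˡ (trans (-‿cong y≈0) -0#≈0#)) (+-identityʳ _)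

      -x*-y≈x*y : ∀ x y → (- x) * (- y) ≈ x * y
      -x*-y≈x*y x y = trans (sym (-‿distribˡ-* x (- y)))
        (trans (-‿cong (sym (-‿distribʳ-* x y))) (-‿involutive _))

      0*≈0 : ∀ {x y} → x ≈ 0# → x * y ≈ 0#
      0*≈0 x≈0 = trans (*-congʳ x≈0) (zeroˡ _)

    CD-isRing : IsRing′ (StarAlg.raw (CD A))
    CD-isRing = record
      { +-isAbelianGroup = AbelianGroup.isAbelianGroup
          (DirectProduct.abelianGroup +-abelianGroup +-abelianGroup)
      ; *-cong = λ (p , q) (r , s) →
            +-cong (*-cong p r) (-‿cong (*-cong (conj-cong s) q))
          , +-cong (*-cong s p) (*-cong q (conj-cong r))
      ; *-assoc = CD-assoc
      ; *-identity =
            (λ (a , b) → trans (+-neg-0 (zeroʳ _)) (*-identityˡ a)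
                       , trans (+-cong (*-identityʳ b) (zeroˡ _)) (+-identityʳ b))
          , (λ (a , b) → trans (+-neg-0 (0*≈0 conj-0)) (*-identityʳ a)
                       , trans (+-cong (zeroˡ _) (trans (*-congˡ conj-1) (*-identityʳ b))) (+-identityˡ b))
      ; distrib = CD-distribˡ , CD-distribʳ
      }

    CD-isStar : IsStar (CD A)
    CD-isStar = record
      { isRing = CD-isRing
      ; conj-cong = λ (p , q) → conj-cong p , -‿cong q
      ; conj-+ = λ (a , b) (p , q) → conj-+ a p , sym (-‿+-comm b q)
      ; conj-* = λ (a , b) (p , q) →
            (begin
              conj (a * p + - (conj q * b))
                ≈⟨ conj-+ _ _ ⟩
              conj (a * p) + conj (- (conj q * b))
                ≈⟨ +-cong (conj-* _ _) (trans (conj-neg _) (-‿cong (trans (conj-* _ _) (*-congˡ (conj-conj q))))) ⟩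
              conj p * conj a + - (conj b * q)
                ≈⟨ +-congˡ (-‿cong (trans (*-congʳ (conj-neg b)) (-x*-y≈x*y _ _))) ⟨
              conj p * conj a + - (conj (- b) * (- q)) ∎)
          , (begin
              - (q * a + b * conj p)
                ≈⟨ -‿+-comm _ _ ⟨
              - (q * a) + - (b * conj p)
                ≈⟨ +-cong (-‿distribˡ-* _ _) (-‿distribˡ-* _ _) ⟩
              (- q) * a + (- b) * conj p
                ≈⟨ +-comm _ _ ⟩
              (- b) * conj p + (- q) * a
                ≈⟨ +-congˡ (*-congˡ (conj-conj a)) ⟨
              (- b) * conj p + (- q) * conj (conj a) ∎)
      ; conj-neg = λ (a , b) → conj-neg a , refl
      ; conj-0 = conj-0 , -0#≈0#
      ; conj-1 = conj-1 , -0#≈0#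
      ; conj-conj = λ (a , b) → conj-conj a , -‿involutive b
      ; re-cong = λ (p , _) → re-cong p
      ; re-+ = λ (a , _) (p , _) → re-+ a p
      ; re-neg = λ (a , _) → re-neg a
      ; re-conj = λ (a , _) → re-conj a
      ; re-comm = λ (a , b) (p , q) →
          R.trans (re-+ _ _) (R.trans
            (R.+-cong (re-comm a p) (R.trans (re-neg _) (R.trans (R.-‿cong (R.trans (R.sym (re-conj _))
              (re-cong (trans (conj-* _ _) (*-congˡ (conj-conj q)))))) (R.sym (re-neg _)))))
            (R.sym (re-+ _ _)))
      ; emb-cong = λ p → emb-cong p , refl
      ; emb-+ = λ r s → emb-+ r s , sym (+-identityʳ 0#)
      ; emb-* = λ r s → trans (emb-* r s) (sym (+-neg-0 (zeroʳ _)))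
                      , sym (trans (+-cong (zeroˡ _) (zeroˡ _)) (+-identityʳ 0#))
      ; emb-neg = λ r → emb-neg r , sym -0#≈0#
      ; emb-0 = emb-0 , refl
      ; emb-1 = emb-1 , refl
      ; conj-emb = λ r → conj-emb r , -0#≈0#
      ; central = λ r (a , b) →
            trans (+-neg-0 (zeroʳ _)) (trans (central r a) (sym (+-neg-0 (0*≈0 conj-0))))
          , trans (+-congˡ (zeroˡ _)) (trans (+-comm _ _)
              (+-cong (sym (zeroˡ _)) (*-congˡ (sym (conj-emb r)))))
      ; trace = λ (a , b) → trace a , -‿inverseʳ b
      }

  𝔾-isStar : ∀ k → IsStar (𝔾 k)
  𝔾-isStar realK       = base-isStar
  𝔾-isStar complexK    = CD-isStar baseAlg base-isStar R.*-comm
  𝔾-isStar quaternionK = CD-isStar (CD baseAlg) (𝔾-isStar complexK) CD-base-comm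
    where
    CD-base-comm : ∀ x y → RawRing._≈_ (StarAlg.raw (CD baseAlg))
      (RawRing._*_ (StarAlg.raw (CD baseAlg)) x y) (RawRing._*_ (StarAlg.raw (CD baseAlg)) y x)
    CD-base-comm (a , b) (p , q) =
        R.+-cong (R.*-comm a p) (R.-‿cong (R.*-comm q b))
      , R.+-comm (q R.* a) (b R.* p)

  module _ (A : StarAlg) (A-isStar : IsStar A) where
    open IsStarAlgebra A-isStar
    open Ring ring hiding (isRing)
    open RingProperties ring
    private
      rearrange : ∀ a b c d → (a + b) + (c + d) ≈ (a + c) + (b + d)
      rearrange a b c d = trans (+-assoc a b (c + d)) (trans (+-congˡ (trans (sym (+-assoc b c d))
        (trans (+-congʳ (+-comm b c)) (+-assoc c b d)))) (sym (+-assoc a c (b + d))))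

    Dual-isRing : IsRing′ (Dual A)
    Dual-isRing = record
      { +-isAbelianGroup = AbelianGroup.isAbelianGroup
          (DirectProduct.abelianGroup +-abelianGroup +-abelianGroup)
      ; *-cong = λ (p , q) (r , s) → *-cong p r , +-cong (*-cong p s) (*-cong q r)
      ; *-assoc = λ (a , b) (p , q) (e , f) → *-assoc a p e ,
          trans (+-cong (*-assoc a p f) (trans (distribʳ e _ _) (+-cong (*-assoc a q e) (*-assoc b p e))))
            (trans (sym (+-assoc _ _ _)) (+-congʳ (sym (distribˡ a _ _))))
      ; *-identity =
            (λ (a , b) → *-identityˡ a , trans (+-cong (*-identityˡ b) (zeroˡ a)) (+-identityʳ b))
          , (λ (a , b) → *-identityʳ a , trans (+-cong (zeroʳ a) (*-identityʳ b)) (+-identityˡ b))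
      ; distrib =
            (λ (a , b) (p , q) (e , f) → distribˡ a p e ,
              trans (+-cong (distribˡ a q f) (distribˡ b p e)) (rearrange _ _ _ _))
          , (λ (a , b) (p , q) (e , f) → distribʳ a p e ,
              trans (+-cong (distribʳ b p e) (distribʳ a q f)) (rearrange _ _ _ _))
      }

  dualConj : (A : StarAlg) → RawRing.Carrier (Dual A) → RawRing.Carrier (Dual A)
  dualConj A (a , b) = StarAlg.conj A a , StarAlg.conj A b

  dualReal : CommutativeRing c ℓ
  dualReal = record
    { isCommutativeRing = record
      { isRing = Dual-isRing baseAlg base-isStar
      ; *-comm = λ (a , b) (p , q) → R.*-comm a p ,
          R.trans (R.+-comm _ _) (R.+-cong (R.*-comm b p) (R.*-comm a q))
      }
    }

  Dual-isStar : (A : StarAlg) → IsStar A →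
    IsStarAlgebra dualReal (Dual A) (dualConj A) (dualRe A) (dualEmb A)
  Dual-isStar A A-isStar = record
    { isRing = Dual-isRing A A-isStar
    ; conj-cong = λ (p , q) → conj-cong p , conj-cong q
    ; conj-+ = λ (a , b) (p , q) → conj-+ a p , conj-+ b q
    ; conj-* = λ (a , b) (p , q) → conj-* a p ,
        trans (conj-+ _ _) (trans (+-cong (conj-* a q) (conj-* b p)) (+-comm _ _))
    ; conj-neg = λ (a , b) → conj-neg a , conj-neg b
    ; conj-0 = conj-0 , conj-0
    ; conj-1 = conj-1 , conj-0
    ; conj-conj = λ (a , b) → conj-conj a , conj-conj b
    ; re-cong = λ (p , q) → re-cong p , re-cong q
    ; re-+ = λ (a , b) (p , q) → re-+ a p , re-+ b q
    ; re-neg = λ (a , b) → re-neg a , re-neg b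
    ; re-conj = λ (a , b) → re-conj a , re-conj b
    ; re-comm = λ (a , b) (p , q) → re-comm a p ,
        R.trans (re-+ _ _) (R.trans (R.+-cong (re-comm a q) (re-comm b p))
          (R.trans (R.+-comm _ _) (R.sym (re-+ _ _))))
    ; emb-cong = λ (p , q) → emb-cong p , emb-cong q
    ; emb-+ = λ (a , b) (p , q) → emb-+ a p , emb-+ b q
    ; emb-* = λ (a , b) (p , q) → emb-* a p , trans (emb-+ _ _) (+-cong (emb-* a q) (emb-* b p))
    ; emb-neg = λ (a , b) → emb-neg a , emb-neg b
    ; emb-0 = emb-0 , emb-0
    ; emb-1 = emb-1 , emb-0
    ; conj-emb = λ (a , b) → conj-emb a , conj-emb b
    ; central = λ (r , s) (a , b) → central r a ,
        trans (+-comm _ _) (+-cong (central s a) (central r b))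
    ; trace = λ (a , b) → trace a , trace b
    }
    where
    open IsStarAlgebra A-isStar
    open Ring ring using (trans; sym; +-cong; +-comm)

-- Finite sums and signs in a ring

module _ {c ℓ : Level} (R : Ring c ℓ) where
  open Ring R
  open RR rawRing
  open RingProperties R
  open SetoidReasoning setoid

  sumL-cong : {f g : A → Carrier} (xs : List A) → (∀ {x} → x ∈ xs → f x ≈ g x) → sumL (map f xs) ≈ sumL (map g xs)
  sumL-cong []       h = refl
  sumL-cong (x ∷ xs) h = +-cong (h (here ≡.refl)) (sumL-cong xs (h ∘ there))

  sumL-zero : {f : A → Carrier} (xs : List A) → (∀ {x} → x ∈ xs → f x ≈ 0#) → sumL (map f xs) ≈ 0#
  sumL-zero []       h = refl
  sumL-zero (x ∷ xs) h = trans (+-cong (h (here ≡.refl)) (sumL-zero xs (h ∘ there))) (+-identityʳ 0#)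

  sumL-map-++ : (f : A → Carrier) (xs ys : List A) → sumL (map f (xs ++ ys)) ≈ sumL (map f xs) + sumL (map f ys)
  sumL-map-++ f []       ys = sym (+-identityˡ _)
  sumL-map-++ f (x ∷ xs) ys = trans (+-congˡ (sumL-map-++ f xs ys)) (sym (+-assoc (f x) _ _))

  sumL-↭ : {xs ys : List Carrier} → xs ↭ ys → sumL xs ≈ sumL ys
  sumL-↭ Perm.refl         = refl
  sumL-↭ (prep x p)        = +-congˡ (sumL-↭ p)
  sumL-↭ (Perm.swap x y p) = trans (sym (+-assoc x y _)) (trans (+-cong (+-comm x y) (sumL-↭ p)) (+-assoc y x _))
  sumL-↭ (Perm.trans p q)  = trans (sumL-↭ p) (sumL-↭ q)

  sumL-map-+ : (f g : A → Carrier) (xs : List A) → sumL (map (λ x → f x + g x) xs) ≈ sumL (map f xs) + sumL (map g xs)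
  sumL-map-+ f g []       = sym (+-identityʳ 0#)
  sumL-map-+ f g (x ∷ xs) = begin
    (f x + g x) + sumL (map (λ x → f x + g x) xs)  ≈⟨ +-congˡ (sumL-map-+ f g xs) ⟩
    (f x + g x) + (F + H)                          ≈⟨ +-assoc (f x) (g x) _ ⟩
    f x + (g x + (F + H))                          ≈⟨ +-congˡ (+-assoc (g x) F H) ⟨
    f x + ((g x + F) + H)                          ≈⟨ +-congˡ (+-congʳ (+-comm (g x) F)) ⟩
    f x + ((F + g x) + H)                          ≈⟨ +-congˡ (+-assoc F (g x) H) ⟩
    f x + (F + (g x + H))                          ≈⟨ +-assoc (f x) F _ ⟨
    (f x + F) + (g x + H)                          ∎
    where F = sumL (map f xs) ; H = sumL (map g xs)

  sumL-map-* : (z : Carrier) (f : A → Carrier) (xs : List A) → sumL (map (λ x → z * f x) xs) ≈ z * sumL (map f xs)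
  sumL-map-* z f []       = sym (zeroʳ z)
  sumL-map-* z f (x ∷ xs) = trans (+-congˡ (sumL-map-* z f xs)) (sym (distribˡ z _ _))

  sumL-concatMap : (f : B → Carrier) (g : A → List B) (xs : List A) →
    sumL (map f (concatMap g xs)) ≈ sumL (map (λ x → sumL (map f (g x))) xs)
  sumL-concatMap f g []       = refl
  sumL-concatMap f g (x ∷ xs) = trans (sumL-map-++ f (g x) (concatMap g xs)) (+-congˡ (sumL-concatMap f g xs))

  prodL-zero : {f : A → Carrier} {xs : List A} {x : A} → x ∈ xs → f x ≈ 0# → prodL (map f xs) ≈ 0#
  prodL-zero (here ≡.refl) h = trans (*-congʳ h) (zeroˡ _)
  prodL-zero (there x∈)    h = trans (*-congˡ (prodL-zero x∈ h)) (zeroʳ _)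

  prodL-map-++ : (f : A → Carrier) (xs ys : List A) → prodL (map f (xs ++ ys)) ≈ prodL (map f xs) * prodL (map f ys)
  prodL-map-++ f []       ys = sym (*-identityˡ _)
  prodL-map-++ f (x ∷ xs) ys = trans (*-congˡ (prodL-map-++ f xs ys)) (sym (*-assoc (f x) _ _))

  prodL-merge : {f f′ h : A → Carrier} {z : Carrier} {m : A} (xs : List A) → Unique xs → m ∈ xs →
    (∀ {x} → x ≢ m → f x ≈ h x) → (∀ {x} → x ≢ m → f′ x ≈ h x) → h m ≈ 1# → f m + f′ m ≈ z →
    (∀ y → z * y ≈ y * z) → prodL (map f xs) + prodL (map f′ xs) ≈ z * prodL (map h xs)
  prodL-merge {f = f} {f′} {h} {z} {m} (x ∷ xs) (x∉ ∷ u) (here ≡.refl) fh f′h hm sum central = begin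
    f x * prodL (map f xs) + f′ x * prodL (map f′ xs)
      ≈⟨ +-cong (*-congˡ (prodL-cong rawRing *-isMonoid xs (λ y∈ → fh (≢-sym (All.lookup x∉ y∈)))))
                (*-congˡ (prodL-cong rawRing *-isMonoid xs (λ y∈ → f′h (≢-sym (All.lookup x∉ y∈))))) ⟩
    f x * prodL (map h xs) + f′ x * prodL (map h xs)  ≈⟨ distribʳ _ (f x) (f′ x) ⟨
    (f x + f′ x) * prodL (map h xs)                   ≈⟨ *-cong sum (sym (*-identityˡ _)) ⟩
    z * (1# * prodL (map h xs))                       ≈⟨ *-congˡ (*-congʳ hm) ⟨
    z * (h x * prodL (map h xs))                      ∎
  prodL-merge {f = f} {f′} {h} {z} {m} (x ∷ xs) (x∉ ∷ u) (there m∈) fh f′h hm sum central = begin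
    f x * prodL (map f xs) + f′ x * prodL (map f′ xs)
      ≈⟨ +-cong (*-congʳ (fh (All.lookup x∉ m∈))) (*-congʳ (f′h (All.lookup x∉ m∈))) ⟩
    h x * prodL (map f xs) + h x * prodL (map f′ xs)  ≈⟨ distribˡ (h x) _ _ ⟨
    h x * (prodL (map f xs) + prodL (map f′ xs))      ≈⟨ *-congˡ (prodL-merge xs u m∈ fh f′h hm sum central) ⟩
    h x * (z * prodL (map h xs))                      ≈⟨ *-assoc (h x) z _ ⟨
    (h x * z) * prodL (map h xs)                      ≈⟨ *-congʳ (central (h x)) ⟨
    (z * h x) * prodL (map h xs)                      ≈⟨ *-assoc z (h x) _ ⟩
    z * (h x * prodL (map h xs))                      ∎

  sgn : ℕ → Carrier → Carrier
  sgn zero    x = x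
  sgn (suc e) x = - sgn e x

  sgn-cong : ∀ e {x y} → x ≈ y → sgn e x ≈ sgn e y
  sgn-cong zero    p = p
  sgn-cong (suc e) p = -‿cong (sgn-cong e p)

  sgn-+ : ∀ e f x → sgn (e +ℕ f) x ≡ sgn e (sgn f x)
  sgn-+ zero    f x = ≡.refl
  sgn-+ (suc e) f x = ≡.cong -_ (sgn-+ e f x)

  sgn-neg : ∀ e x → sgn e (- x) ≈ - sgn e x
  sgn-neg zero    x = refl
  sgn-neg (suc e) x = -‿cong (sgn-neg e x)

  sgn-double : ∀ e x → sgn e (sgn e x) ≈ x
  sgn-double zero    x = refl
  sgn-double (suc e) x = trans (-‿cong (sgn-neg e _)) (trans (-‿involutive _) (sgn-double e x))

  sgn-*ˡ : ∀ e x y → sgn e x * y ≈ sgn e (x * y)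
  sgn-*ˡ zero    x y = refl
  sgn-*ˡ (suc e) x y = trans (sym (-‿distribˡ-* _ y)) (-‿cong (sgn-*ˡ e x y))

  sgn-*ʳ : ∀ e x y → x * sgn e y ≈ sgn e (x * y)
  sgn-*ʳ zero    x y = refl
  sgn-*ʳ (suc e) x y = trans (sym (-‿distribʳ-* x _)) (-‿cong (sgn-*ʳ e x y))

  sgn-* : ∀ e f x y → sgn e x * sgn f y ≈ sgn (e +ℕ f) (x * y)
  sgn-* e f x y = trans (sgn-*ˡ e x _) (trans (sgn-cong e (sgn-*ʳ f x y)) (reflexive (≡.sym (sgn-+ e f _))))

  sgn-0 : ∀ e → sgn e 0# ≈ 0#
  sgn-0 zero    = refl
  sgn-0 (suc e) = trans (-‿cong (sgn-0 e)) -0#≈0#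

  sgn-sumL : ∀ e (f : A → Carrier) xs → sumL (map (λ x → sgn e (f x)) xs) ≈ sgn e (sumL (map f xs))
  sgn-sumL zero    f xs = refl
  sgn-sumL (suc e) f xs = begin
    sumL (map (λ x → - sgn e (f x)) xs)          ≈⟨ sumL-cong xs (λ _ → -1*x≈-x _) ⟨
    sumL (map (λ x → - 1# * sgn e (f x)) xs)     ≈⟨ sumL-map-* (- 1#) _ xs ⟩
    - 1# * sumL (map (λ x → sgn e (f x)) xs)     ≈⟨ -1*x≈-x _ ⟩
    - sumL (map (λ x → sgn e (f x)) xs)          ≈⟨ -‿cong (sgn-sumL e f xs) ⟩
    - sgn e (sumL (map f xs))                    ∎

  if-isEven≈sgn : ∀ e x → (if isEven e then x else - x) ≈ sgn e x
  if-isEven≈sgn zero    x = refl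
  if-isEven≈sgn (suc e) x with isEven e | if-isEven≈sgn e x
  ... | true  | p = -‿cong p
  ... | false | p = trans (sym (-‿involutive x)) (-‿cong p)

  signed≈sgn : {ds : List (Cycle n)} {σ : Fin n → Fin n} → Decomposes ds σ → ∀ x →
    MooreDet.signed rawRing σ x ≈ sgn (length (V ds) +ℕ length ds) x
  signed≈sgn {n = n} {ds} {σ} d x = begin
    MooreDet.signed rawRing σ x                   ≈⟨ if-isEven≈sgn k x ⟩
    sgn k x                                       ≈⟨ sgn-cong k (sgn-double (length ds) x) ⟨
    sgn k (sgn (length ds) (sgn (length ds) x))   ≡⟨ sgn-+ k (length ds) _ ⟨
    sgn (k +ℕ length ds) (sgn (length ds) x)      ≡⟨ ≡.cong (λ j → sgn j (sgn (length ds) x)) k+p≡V ⟩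
    sgn (length (V ds)) (sgn (length ds) x)       ≡⟨ sgn-+ (length (V ds)) (length ds) x ⟨
    sgn (length (V ds) +ℕ length ds) x            ∎
    where
    k = n ∸ length (leaders σ)
    leaders≤n : length (leaders σ) ≤ n
    leaders≤n = unique-length≤ (filterᵇ-unique (isLeader σ) (vertices-unique n))
    k+p≡V : k +ℕ length ds ≡ length (V ds)
    k+p≡V = ℕ.+-cancelˡ-≡ (length (leaders σ)) _ _ (≡.trans (≡.sym (ℕ.+-assoc (length (leaders σ)) k _))
      (≡.trans (≡.cong (_+ℕ length ds) (ℕ.m+[n∸m]≡n leaders≤n)) (≡.sym (leaders-count ds d))))

  mσ-zero : {M : Fin n → Fin n → Carrier} {ds : List (Cycle n)} {σ : Fin n → Fin n} → Decomposes ds σ →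
    ∀ x → M x (σ x) ≈ 0# → MooreDet.mσ rawRing M σ ≈ 0#
  mσ-zero {n = n} {M} {ds} {σ} d x Mx≈0 with c , fol , u , x∈ ← cycleOf d x
    with m , m∈ , min ← minimum (proj₁ c) (proj₂ c) = trans (mσ≈factors rawRing *-isMonoid M σ)
      (prodL-zero (∈-vertices m) (trans
        (factor-leader rawRing *-isMonoid M rotated (fol ∘ Perm.∈-resp-↭ edges-↭)
          (Unique-resp-↭ (↭-sym verts-↭) u) (min ∘ Perm.∈-resp-↭ verts-↭))
        (prodL-zero (Perm.∈-resp-↭ (↭-sym edges-↭) edge) Mx≈0)))
    where
    open Rotation (rotate c m∈)
    edge : (x , σ x) ∈ edges c
    edge = let y , e∈ = ∈verts⇒out c x∈ in ≡.subst (λ z → (x , z) ∈ edges c) (≡.sym (fol e∈)) e∈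

  signed-cong : (σ : Fin n → Fin n) → ∀ {x y} → x ≈ y →
    MooreDet.signed rawRing σ x ≈ MooreDet.signed rawRing σ y
  signed-cong {n = n} σ p with isEven (n ∸ length (leaders σ))
  ... | true  = p
  ... | false = -‿cong p

  perms-sum : {G : SimpleGraph n} {i : ℕ} {L : List (Basic n)} → Enumerates𝓑 G i L → (F : (Fin n → Fin n) → Carrier) →
    (∀ {ds σ} → Decomposes ds σ → (All (Adjacent G) (E ds) → length (V ds) ≢ i) → F σ ≈ 0#) →
    sumL (map F (perms n)) ≈ sumL (map (λ B → sumL (map (λ ds → F (lookup (toVec ds))) (orientations B))) L)
  perms-sum {n = n} {G} {i} {L} enum F vanish = begin
    sumL (map F (perms n))
      ≡⟨ ≡.cong sumL (List.map-∘ (permVecs n)) ⟨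
    sumL (map f (permVecs n))
      ≈⟨ sumL-↭ (Perm.map⁺ f p) ⟩
    sumL (map f (supported G i L enum ++ vs))
      ≈⟨ sumL-map-++ f (supported G i L enum) vs ⟩
    sumL (map f (supported G i L enum)) + sumL (map f vs)
      ≈⟨ +-congˡ (sumL-zero vs (λ v∈ → let _ , d , bad = off v∈ in vanish d bad)) ⟩
    sumL (map f (supported G i L enum)) + 0#
      ≈⟨ +-identityʳ _ ⟩
    sumL (map f (map toVec (concatMap orientations L)))
      ≡⟨ ≡.cong sumL (List.map-∘ (concatMap orientations L)) ⟨
    sumL (map (λ ds → F (lookup (toVec ds))) (concatMap orientations L))
      ≈⟨ sumL-concatMap _ orientations L ⟩
    sumL (map (λ B → sumL (map (λ ds → F (lookup (toVec ds))) (orientations B))) L) ∎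
    where
    f : Vec (Fin n) n → Carrier
    f v = F (lookup v)
    split = permVecs-split G i L enum
    vs = proj₁ split
    p = proj₁ (proj₂ split)
    off = proj₂ (proj₂ split)

-- Summing over orientations

module _ {c ℓ : Level} (K : CommutativeRing c ℓ) (D : RawRing c ℓ)
    (conj : RawRing.Carrier D → RawRing.Carrier D)
    (re : RawRing.Carrier D → CommutativeRing.Carrier K)
    (emb : CommutativeRing.Carrier K → RawRing.Carrier D)
    (isStar : IsStarAlgebra K D conj re emb) where
  open IsStarAlgebra isStar
  open Ring ring hiding (isRing)
  open RingProperties ring
  open MooreDet D
  open RR D
  open SetoidReasoning setoid
  private module K = CommutativeRing K

  walkProd-++ : (M : Fin n → Fin n → Carrier) (es fs : List (Fin n × Fin n)) →
    walkProd D M (es ++ fs) ≈ walkProd D M es * walkProd D M fs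
  walkProd-++ M es fs = prodL-map-++ ring _ es fs

  walkProd-reverse : {M : Fin n → Fin n → Carrier} → (∀ x y → conj (M x y) ≈ M y x) →
    ∀ es → walkProd D M (reverse (map swap es)) ≈ conj (walkProd D M es)
  walkProd-reverse herm [] = sym conj-1
  walkProd-reverse {M = M} herm ((x , y) ∷ es) = begin
    walkProd D M (reverse (map swap ((x , y) ∷ es)))
      ≡⟨ ≡.cong (walkProd D M) (List.unfold-reverse (y , x) (map swap es)) ⟩
    walkProd D M (reverse (map swap es) ++ [ (y , x) ])
      ≈⟨ walkProd-++ M (reverse (map swap es)) _ ⟩
    walkProd D M (reverse (map swap es)) * (M y x * 1#)
      ≈⟨ *-cong (walkProd-reverse herm es) (trans (*-identityʳ _) (sym (herm x y))) ⟩
    conj (walkProd D M es) * conj (M x y)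
      ≈⟨ conj-* _ _ ⟨
    conj (M x y * walkProd D M es) ∎

  re-rotate : (M : Fin n → Fin n → Carrier) {u : Cycle n} {v : Fin n} (rot : Rotation u v) →
    re (walkProd D M (edges (Rotation.rotated rot))) K.≈ re (walkProd D M (edges u))
  re-rotate M rot = K.trans (re-cong (trans (reflexive (≡.cong (walkProd D M) after)) (walkProd-++ M E₂ E₁)))
    (K.trans (re-comm _ _) (re-cong (sym (trans (reflexive (≡.cong (walkProd D M) before)) (walkProd-++ M E₁ E₂)))))
    where open Rotation rot

  module _ {M : Fin n → Fin n → Carrier} (diag : ∀ x → M x x ≈ 1#) (herm : ∀ x y → conj (M x y) ≈ M y x) where

    -- w + w* = 2 Re w is central, so it can be pulled out of the product at the leader of the cycle.
    mσ-cycle : {u : Fin n} {us : List (Fin n)} {ds : List (Cycle n)} {σ σ′ τ : Fin n → Fin n} →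
      Decomposes ((u , us) ∷ ds) σ → Decomposes ((u , reverse us) ∷ ds) σ′ → Decomposes ds τ →
      let r = re (walkProd D M (edges (u , us))) in mσ M σ + mσ M σ′ ≈ emb (r K.+ r) * mσ M τ
    mσ-cycle {u} {us} {ds} {σ} {σ′} {τ} d d° d′ = begin
      mσ M σ + mσ M σ′
        ≈⟨ +-cong (mσ≈factors D *-isMonoid M σ) (mσ≈factors D *-isMonoid M σ′) ⟩
      prodL (map (factor D M σ) (vertices n)) + prodL (map (factor D M σ′) (vertices n))
        ≈⟨ prodL-merge ring (vertices n) (vertices-unique n) (∈-vertices m)
             (λ {x} → away {us} d fol (unique-head d) m∈ min x) (λ {x} → away {reverse us} d° fol° (unique-head d°) m∈° min° x)
             (inside d m∈) total (central _) ⟩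
      emb (r K.+ r) * prodL (map (factor D M τ) (vertices n))
        ≈⟨ *-congˡ (mσ≈factors D *-isMonoid M τ) ⟨
      emb (r K.+ r) * mσ M τ ∎
      where
      r = re (walkProd D M (edges (u , us)))
      m = proj₁ (minimum u us)
      m∈ = proj₁ (proj₂ (minimum u us))
      min = proj₂ (proj₂ (minimum u us))
      rev-↭ : u ∷ reverse us ↭ u ∷ us
      rev-↭ = prep u (Perm.↭-reverse us)
      m∈° = Perm.∈-resp-↭ (↭-sym rev-↭) m∈
      min° : ∀ {x} → x ∈ u ∷ reverse us → toℕ m ≤ toℕ x
      min° = min ∘ Perm.∈-resp-↭ rev-↭
      fol : Follows σ (edges (u , us))
      fol = Decomposes.follows d ∘ ∈-++⁺ˡ
      fol° : Follows σ′ (edges (u , reverse us))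
      fol° = Decomposes.follows d° ∘ ∈-++⁺ˡ
      open Rotation (rotate (u , us) m∈)
      inside : ∀ {c x} {ρ : Fin n → Fin n} → Decomposes (c ∷ ds) ρ → x ∈ verts c → factor D M τ x ≈ 1#
      inside {c} {x} dρ x∈ = trans (factor-fixed D *-isMonoid M (tail-fixes {c = c} dρ d′ x∈)) (diag x)
      away : ∀ {us ρ} (dρ : Decomposes ((u , us) ∷ ds) ρ) → Follows ρ (edges (u , us)) → Unique (u ∷ us) →
        m ∈ u ∷ us → (∀ {x} → x ∈ u ∷ us → toℕ m ≤ toℕ x) → ∀ x → x ≢ m → factor D M ρ x ≈ factor D M τ x
      away {us} dρ fol un m∈ min x x≢m with x ∈? (u ∷ us)
      ... | yes x∈ = trans (reflexive (factor-nonleader D *-isMonoid M (u , us) fol un m∈ min x∈ x≢m)) (sym (inside dρ x∈))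
      ... | no x∉  = reflexive (factor-outside D M {c = u , us} dρ d′ x∉)
      w = walkProd D M (edges (m , rest))
      at-σ : factor D M σ m ≈ w
      at-σ = factor-leader D *-isMonoid M rotated (fol ∘ Perm.∈-resp-↭ edges-↭)
        (Unique-resp-↭ (↭-sym verts-↭) (unique-head d)) (min ∘ Perm.∈-resp-↭ verts-↭)
      rest-↭ : m ∷ reverse rest ↭ u ∷ us
      rest-↭ = ↭-trans (prep m (Perm.↭-reverse rest)) verts-↭
      at-σ′ : factor D M σ′ m ≈ conj w
      at-σ′ = trans (factor-leader D *-isMonoid M (m , reverse rest)
          (λ e∈ → fol° (∈-pathE-reverse u us u (Perm.∈-resp-↭ edges-↭ (edges-reverse rest e∈))))
          (Unique-resp-↭ (↭-sym rest-↭) (unique-head d)) (min ∘ Perm.∈-resp-↭ rest-↭))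
        (trans (reflexive (≡.cong (walkProd D M) (pathE-reverse m rest m))) (walkProd-reverse herm (edges (m , rest))))
      total : factor D M σ m + factor D M σ′ m ≈ emb (r K.+ r)
      total = trans (+-cong at-σ at-σ′) (trans (trace w)
        (emb-cong (K.+-cong (re-rotate M (rotate (u , us) m∈)) (re-rotate M (rotate (u , us) m∈)))))

    mσ-edge : {u v : Fin n} {ds : List (Cycle n)} {σ τ : Fin n → Fin n} →
      Decomposes ((u , [ v ]) ∷ ds) σ → Decomposes ds τ → M u v * M v u ≈ 1# → M v u * M u v ≈ 1# → mσ M σ ≈ mσ M τ
    mσ-edge {u} {v} {ds} {σ} {τ} d d′ uv vu = trans (mσ≈factors D *-isMonoid M σ)
      (trans (prodL-cong D *-isMonoid (vertices n) (λ {x} _ → pointwise x)) (sym (mσ≈factors D *-isMonoid M τ)))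
      where
      e = u , [ v ]
      m∈ = proj₁ (proj₂ (minimum u [ v ]))
      min = proj₂ (proj₂ (minimum u [ v ]))
      fol : Follows σ (edges e)
      fol = Decomposes.follows d ∘ ∈-++⁺ˡ
      around : ∀ {m} → m ∈ verts e → (∀ {x} → x ∈ verts e → toℕ m ≤ toℕ x) → factor D M σ m ≈ 1#
      around (here ≡.refl) min = trans (factor-leader D *-isMonoid M e fol (unique-head {c = e} d) min)
        (trans (*-congˡ (*-identityʳ _)) uv)
      around (there (here ≡.refl)) min = trans (factor-leader D *-isMonoid M (v , [ u ])
          (fol ∘ λ { (here p) → there (here p) ; (there (here p)) → here p })
          (Unique-resp-↭ (Perm.swap u v Perm.refl) (unique-head {c = e} d))
          (min ∘ λ { (here p) → there (here p) ; (there (here p)) → here p }))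
        (trans (*-congˡ (*-identityʳ _)) vu)
      pointwise : ∀ x → factor D M σ x ≈ factor D M τ x
      pointwise x with x ∈? verts e
      ... | no x∉ = reflexive (factor-outside D M {c = e} d d′ x∉)
      ... | yes x∈ with x ≟ proj₁ (minimum u [ v ])
      ...   | yes ≡.refl = trans (around m∈ min) (sym (trans (factor-fixed D *-isMonoid M (tail-fixes {c = e} d d′ x∈)) (diag x)))
      ...   | no x≢m = trans (reflexive (factor-nonleader D *-isMonoid M e fol (unique-head {c = e} d) m∈ min x∈ x≢m))
        (sym (trans (factor-fixed D *-isMonoid M (tail-fixes {c = e} d d′ x∈)) (diag x)))

    weight : Elem n → K.Carrier
    weight (k2 _ _)       = K.1#
    weight (cyc [])       = K.1#
    weight (cyc (u ∷ us)) = let r = re (walkProd D M (edges (u , us))) in r K.+ r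

    orientation-sum : {G : SimpleGraph n} → (∀ {x y} → Adjacent G (x , y) → M x y * M y x ≈ 1# × M y x * M x y ≈ 1#) →
      (B : Basic n) → BasicWF G B →
      sumL (map (λ ds → mσ M (lookup (toVec ds))) (orientations B)) ≈ emb (RR.prodL K.rawRing (map weight B))
    orientation-sum unit [] wf = trans (+-identityʳ _) (trans
      (trans (mσ≈factors D *-isMonoid M _) (trans (prodL-cong D *-isMonoid (vertices n)
        (λ {x} _ → trans (factor-fixed D *-isMonoid M (Decomposes.fixes (toVec-decomposes ([] , [])) λ ())) (diag x)))
        (ones (vertices n)))) (sym emb-1))
      where
      ones : (xs : List A) → prodL (map (λ _ → 1#) xs) ≈ 1#
      ones []       = refl
      ones (x ∷ xs) = trans (*-identityˡ _) (ones xs)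
    orientation-sum {G} unit (e ∷ B) wf@(w ∷ ws , un) = begin
      sumL (map f (orientations (e ∷ B)))                 ≈⟨ peel e w wf′ ⟩
      emb (weight e) * sumL (map f (orientations B))      ≈⟨ *-congˡ (orientation-sum {G} unit B (ws , unique-++⁻ʳ (elemVerts e) un)) ⟩
      emb (weight e) * emb (RR.prodL K.rawRing (map weight B)) ≈⟨ emb-* _ _ ⟨
      emb (weight e K.* RR.prodL K.rawRing (map weight B)) ∎
      where
      f : List (Cycle n) → Carrier
      f ds = mσ M (lookup (toVec ds))
      wf′ : ∀ {c ds} → c ∈ orient e → ds ∈ orientations B → WellFormed (c ∷ ds)
      wf′ c∈ ds∈ = oriented-wellFormed {G = G} wf (c∈ ∷ ∈-orientations⁻ B ds∈)
      peel : (e : Elem n) → ElemWF G e → (∀ {c ds} → c ∈ orient e → ds ∈ orientations B → WellFormed (c ∷ ds)) →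
        sumL (map f (concatMap (λ c → map (c ∷_) (orientations B)) (orient e))) ≈ emb (weight e) * sumL (map f (orientations B))
      peel (k2 u v) adj wfs = begin
        sumL (map f (map ((u , [ v ]) ∷_) (orientations B) ++ []))
          ≡⟨ ≡.cong (sumL ∘ map f) (List.++-identityʳ (map ((u , [ v ]) ∷_) (orientations B))) ⟩
        sumL (map f (map ((u , [ v ]) ∷_) (orientations B)))
          ≡⟨ ≡.cong sumL (List.map-∘ (orientations B)) ⟨
        sumL (map (λ ds → f ((u , [ v ]) ∷ ds)) (orientations B))
          ≈⟨ sumL-cong ring (orientations B) (λ ds∈ → let wf = wfs (here ≡.refl) ds∈ in
               mσ-edge (toVec-decomposes wf) (toVec-decomposes (wellFormed-tail {c = u , [ v ]} wf))
                 (proj₁ (unit adj)) (proj₂ (unit adj))) ⟩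
        sumL (map f (orientations B))
          ≈⟨ trans (*-congʳ emb-1) (*-identityˡ _) ⟨
        emb K.1# * sumL (map f (orientations B)) ∎
      peel (cyc []) (() , _) wfs
      peel (cyc (u ∷ us)) _ wfs = begin
        sumL (map f (map ((u , us) ∷_) (orientations B) ++ map ((u , reverse us) ∷_) (orientations B) ++ []))
          ≡⟨ ≡.cong (λ l → sumL (map f (map ((u , us) ∷_) (orientations B) ++ l))) (List.++-identityʳ _) ⟩
        sumL (map f (map ((u , us) ∷_) (orientations B) ++ map ((u , reverse us) ∷_) (orientations B)))
          ≈⟨ sumL-map-++ ring f (map ((u , us) ∷_) (orientations B)) _ ⟩
        sumL (map f (map ((u , us) ∷_) (orientations B))) + sumL (map f (map ((u , reverse us) ∷_) (orientations B)))
          ≡⟨ ≡.cong₂ (λ x y → sumL x + sumL y) (List.map-∘ (orientations B)) (List.map-∘ (orientations B)) ⟨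
        sumL (map (λ ds → f ((u , us) ∷ ds)) (orientations B)) + sumL (map (λ ds → f ((u , reverse us) ∷ ds)) (orientations B))
          ≈⟨ sumL-map-+ ring _ _ (orientations B) ⟨
        sumL (map (λ ds → f ((u , us) ∷ ds) + f ((u , reverse us) ∷ ds)) (orientations B))
          ≈⟨ sumL-cong ring (orientations B) (λ ds∈ → let wf = wfs (here ≡.refl) ds∈ in
               mσ-cycle (toVec-decomposes wf) (toVec-decomposes (wfs (there (here ≡.refl)) ds∈))
                 (toVec-decomposes (wellFormed-tail {c = u , us} wf))) ⟩
        sumL (map (λ ds → emb (weight (cyc (u ∷ us))) * f ds) (orientations B))
          ≈⟨ sumL-map-* ring _ f (orientations B) ⟩
        emb (weight (cyc (u ∷ us))) * sumL (map f (orientations B)) ∎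

-- Monomials

module _ {c ℓ : Level} (R : Ring c ℓ) where
  open Ring R
  open RR rawRing using (sumTo)
  open MooreDet rawRing using (mσ)
  private module Poly = RawRing (PolyRing rawRing)
  open MooreDet (PolyRing rawRing) using () renaming (mσ to mσP; cycleProd to cycleProdP)

  Monomial : (ℕ → Carrier) → ℕ → Carrier → Set ℓ
  Monomial p e a = p e ≈ a × (∀ k → k ≢ e → p k ≈ 0#)

  sumTo-zero : ∀ k {f : ℕ → Carrier} → (∀ j → j ≤ k → f j ≈ 0#) → sumTo k f ≈ 0#
  sumTo-zero zero    h = h 0 z≤n
  sumTo-zero (suc k) h = trans (+-cong (sumTo-zero k (λ j j≤k → h j (ℕ.m≤n⇒m≤1+n j≤k))) (h (suc k) ℕ.≤-refl)) (+-identityʳ 0#)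

  sumTo-single : ∀ k e {f : ℕ → Carrier} → e ≤ k → (∀ j → j ≢ e → f j ≈ 0#) → sumTo k f ≈ f e
  sumTo-single zero    zero z≤n h = refl
  sumTo-single (suc k) e e≤ h with ℕ.m≤n⇒m<n∨m≡n e≤
  ... | inj₁ e<1+k    = trans (+-cong (sumTo-single k e (ℕ.≤-pred e<1+k) h) (h (suc k) (λ { ≡.refl → ℕ.<-irrefl ≡.refl e<1+k }))) (+-identityʳ _)
  ... | inj₂ ≡.refl = trans (+-congʳ (sumTo-zero k (λ j j≤k → h j (λ { ≡.refl → ℕ.<-irrefl ≡.refl j≤k })))) (+-identityˡ _)

  monomial-1 : Monomial Poly.1# 0 1#
  monomial-1 = refl , λ { zero 0≢0 → ⊥-elim (0≢0 ≡.refl) ; (suc k) _ → refl }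

  monomial-* : ∀ {p q e f a b} → Monomial p e a → Monomial q f b → Monomial (p Poly.* q) (e +ℕ f) (a * b)
  monomial-* {p} {q} {e} {f} (pe , p0) (qf , q0) =
      trans (sumTo-single (e +ℕ f) e (ℕ.m≤m+n e f) (λ j j≢e → trans (*-congʳ (p0 j j≢e)) (zeroˡ _)))
        (*-cong pe (trans (reflexive (≡.cong q (ℕ.m+n∸m≡n e f))) qf))
    , λ k k≢ → sumTo-zero k (λ j j≤k → vanish k k≢ j j≤k)
    where
    vanish : ∀ k → k ≢ e +ℕ f → ∀ j → j ≤ k → p j * q (k ∸ j) ≈ 0#
    vanish k k≢ j j≤k with j ℕ.≟ e
    ... | no j≢e     = trans (*-congʳ (p0 j j≢e)) (zeroˡ _)
    ... | yes ≡.refl = trans (*-congˡ (q0 (k ∸ j) (λ eq → k≢ (≡.trans (≡.sym (ℕ.m+[n∸m]≡n j≤k)) (≡.cong (j +ℕ_) eq))))) (zeroʳ _)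

  mσ-monomial : {Q : Fin n → Fin n → ℕ → Carrier} {M : Fin n → Fin n → Carrier} {σ : Fin n → Fin n} →
    (∀ x → Monomial (Q x (σ x)) (loops x (σ x)) (M x (σ x))) → Monomial (mσP Q σ) (exponent σ) (mσ M σ)
  mσ-monomial {n = n} {Q} {M} {σ} h = product (leaders σ)
    where
    from : ∀ f i j → Monomial (cycleProdFrom (PolyRing rawRing) Q σ i f j)
      (cycleProdFrom exponents loops σ i f j) (cycleProdFrom rawRing M σ i f j)
    from zero    i j = monomial-1
    from (suc f) i j with σ j == i
    ... | true  = monomial-* {Q j (σ j)} (h j) monomial-1
    ... | false = monomial-* {Q j (σ j)} (h j) (from f i (σ j))
    factors : ∀ i → Monomial (cycleProdP Q σ i) (MooreDet.cycleProd exponents loops σ i) (MooreDet.cycleProd rawRing M σ i)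
    factors i rewrite cycleProd≡ (PolyRing rawRing) Q σ i | cycleProd≡ exponents loops σ i | cycleProd≡ rawRing M σ i = from n i i
    product : ∀ is → Monomial (RR.prodL (PolyRing rawRing) (map (cycleProdP Q σ) is))
      (RR.prodL exponents (map (MooreDet.cycleProd exponents loops σ) is)) (RR.prodL rawRing (map (MooreDet.cycleProd rawRing M σ) is))
    product []       = monomial-1
    product (i ∷ is) = monomial-* {cycleProdP Q σ i} (factors i) (product is)

  Mdet-coefficient : (Q : Fin n → Fin n → ℕ → Carrier) (k : ℕ) →
    MooreDet.Mdet (PolyRing rawRing) n Q k ≡ RR.sumL rawRing (map (λ σ → MooreDet.signed rawRing σ (mσP Q σ k)) (perms n))
  Mdet-coefficient {n = n} Q k = sums (perms n)
    where
    signedP : ∀ σ p → MooreDet.signed (PolyRing rawRing) {n} σ p k ≡ MooreDet.signed rawRing σ (p k)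
    signedP σ p with isEven (n ∸ length (leaders σ))
    ... | true  = ≡.refl
    ... | false = ≡.refl
    sums : ∀ σs → RR.sumL (PolyRing rawRing) (map (λ σ → MooreDet.signed (PolyRing rawRing) σ (mσP Q σ)) σs) k
      ≡ RR.sumL rawRing (map (λ σ → MooreDet.signed rawRing σ (mσP Q σ k)) σs)
    sums []       = ≡.refl
    sums (σ ∷ σs) = ≡.cong₂ _+_ (signedP σ (mσP Q σ)) (sums σs)

-- Gain graphs

uncovered : {ds : List (Cycle n)} → WellFormed ds → length (V ds) ≢ n → ∃ λ x → x ∉ V ds
uncovered {n = n} {ds} (_ , u) len with unique-⊆⇒↭ {ys = vertices n} u (λ _ → ∈-vertices _)
... | [] , p = ⊥-elim (len (≡.trans (≡.cong length (≡.sym (List.++-identityʳ (V ds))))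
  (≡.trans (≡.sym (Perm.↭-length p)) (length-vertices n))))
... | z ∷ zs , p = z , λ z∈ → unique-++-disjoint (V ds) (Unique-resp-↭ p (vertices-unique n)) z∈ (here ≡.refl)

covered : {ds : List (Cycle n)} → WellFormed ds → length (V ds) ≡ n → ∀ x → x ∈ V ds
covered {n = n} {ds} (_ , u) len x with unique-⊆⇒↭ {ys = vertices n} u (λ _ → ∈-vertices _)
... | [] , p = ≡.subst (x ∈_) (List.++-identityʳ (V ds)) (Perm.∈-resp-↭ p (∈-vertices x))
... | z ∷ zs , p = ⊥-elim (ℕ.m≢1+m+n (length (V ds)) (≡.trans len (≡.trans (≡.sym (length-vertices n))
  (≡.trans (Perm.↭-length p) (≡.trans (List.length-++ (V ds)) (ℕ.+-suc _ _))))))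

non-adjacent : (G : SimpleGraph n) (es : List (Fin n × Fin n)) → ¬ All (Adjacent G) es →
  ∃ λ x → ∃ λ y → (x , y) ∈ es × SimpleGraph.adj G x y ≡ false
non-adjacent G es ¬adj with find (All.¬All⇒Any¬ (λ (x , y) → SimpleGraph.adj G x y Bool.≟ true) es ¬adj)
... | (x , y) , e∈ , ne = x , y , e∈ , ¬-not ne

module _ {c ℓ : Level} (R : CommutativeRing c ℓ) (k : Algebras.Kind R)
    {n : ℕ} {G : SimpleGraph n} (Φ : GainGraphs.GainGraph R k G) where
  open Algebras R using (𝔾; dualRe; dualEmb)
  open GainGraphs R using (DG; adjMat; walkGain; charPoly)
  open GainGraphs.GainGraph Φ
  open SimpleGraph G using (adj; irrefl) renaming (sym to adj-sym)

  private
    K : CommutativeRing c ℓ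
    K = dualReal R
    module K = CommutativeRing K
    D : RawRing c ℓ
    D = DG k
    conj = dualConj R (𝔾 k)
    re = dualRe (𝔾 k)
    emb = dualEmb (𝔾 k)
    elemR = Terms.elemR R Φ
    RB = Terms.RB R Φ
    pow2 = Terms.pow2 R Φ
    term = Terms.term R Φ
    basicSum = Terms.basicSum R Φ
    isStar : IsStarAlgebra K D conj re emb
    isStar = Dual-isStar R (𝔾 k) (𝔾-isStar R k)

  open IsStarAlgebra isStar
  open Ring ring hiding (isRing)
  open RingProperties ring
  open MooreDet D
  open RR D
  open SetoidReasoning setoid

  closedProd : Fin n → List (Fin n) → Carrier
  closedProd z []          = 1#
  closedProd z (x ∷ [])    = φ x z
  closedProd z (x ∷ y ∷ r) = φ x y * closedProd z (y ∷ r)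

  private
    mutual
      walkGain-go≡ : ∀ u (us l : List (Fin n)) → _ ≡ closedProd u l

      walkGain≡closedProd : ∀ u us → walkGain k Φ (u ∷ us) ≡ closedProd u (u ∷ us)
      walkGain≡closedProd u us with u ∷ us
      ... | l = walkGain-go≡ u us l

      walkGain-go≡ u us []          = ≡.refl
      walkGain-go≡ u us (x ∷ [])    = ≡.refl
      walkGain-go≡ u us (x ∷ y ∷ r) = ≡.cong (φ x y *_) (walkGain-go≡ u us (y ∷ r))

  conj-φ : ∀ {x y} → adj x y ≡ true → conj (φ x y) ≈ φ y x
  conj-φ {x} {y} xy = begin
    conj (φ x y)                      ≈⟨ *-identityˡ _ ⟨
    1# * conj (φ x y)                 ≈⟨ *-congʳ (proj₁ (inv x y xy)) ⟨
    (φ y x * φ x y) * conj (φ x y)    ≈⟨ *-assoc _ _ _ ⟩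
    φ y x * (φ x y * conj (φ x y))    ≈⟨ *-congˡ (unit x y xy) ⟩
    φ y x * 1#                        ≈⟨ *-identityʳ _ ⟩
    φ y x                             ∎

  private
    Adj : Fin n → Fin n → Carrier
    Adj = adjMat k Φ

  Adj-adjacent : ∀ {x y} → adj x y ≡ true → Adj x y ≡ φ x y
  Adj-adjacent {x} {y} eq rewrite eq = ≡.refl

  Adj-nonadjacent : ∀ {x y} → adj x y ≡ false → Adj x y ≡ 0#
  Adj-nonadjacent {x} {y} eq rewrite eq = ≡.refl

  Adj-hermitian : ∀ x y → conj (Adj x y) ≈ Adj y x
  Adj-hermitian x y = by (adj x y) ≡.refl
    where
    by : ∀ b → adj x y ≡ b → conj (Adj x y) ≈ Adj y x
    by true xy = trans (conj-cong (reflexive (Adj-adjacent xy)))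
      (trans (conj-φ xy) (reflexive (≡.sym (Adj-adjacent (≡.trans (adj-sym y x) xy)))))
    by false xy = trans (conj-cong (reflexive (Adj-nonadjacent xy)))
      (trans conj-0 (reflexive (≡.sym (Adj-nonadjacent (≡.trans (adj-sym y x) xy)))))

  conj-sgn : ∀ t x → conj (sgn ring t x) ≈ sgn ring t (conj x)
  conj-sgn zero    x = refl
  conj-sgn (suc t) x = trans (conj-neg _) (-‿cong (conj-sgn t x))

  re-sgn : ∀ t x → re (sgn ring t x) K.≈ sgn K.ring t (re x)
  re-sgn zero    x = K.refl
  re-sgn (suc t) x = K.trans (re-neg _) (K.-‿cong (re-sgn t x))

  emb-sgn : ∀ t x → emb (sgn K.ring t x) ≈ sgn ring t (emb x)
  emb-sgn zero    x = refl
  emb-sgn (suc t) x = trans (emb-neg _) (-‿cong (emb-sgn t x))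

  emb-sumL : (f : A → K.Carrier) (xs : List A) → emb (RR.sumL K.rawRing (map f xs)) ≈ sumL (map (λ x → emb (f x)) xs)
  emb-sumL f []       = emb-0
  emb-sumL f (x ∷ xs) = trans (emb-+ _ _) (+-congˡ (emb-sumL f xs))

  -- (−1)ᵗ A(Φ) with 1 on the diagonal: t = 0 serves A(Φ) itself, t = 1 the leading
  -- coefficients of xI − A(Φ).
  twisted : ℕ → Fin n → Fin n → Carrier
  twisted t x y = if x == y then 1# else sgn ring t (Adj x y)

  module _ (t : ℕ) where
    private
      N : Fin n → Fin n → Carrier
      N = twisted t

    twisted-diag : ∀ x → N x x ≈ 1#
    twisted-diag x rewrite ≡⇒== {i = x} ≡.refl = refl

    twisted-off : ∀ {x y} → x ≢ y → N x y ≡ sgn ring t (Adj x y)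
    twisted-off {x} {y} x≢y rewrite ≢⇒== x≢y = ≡.refl

    twisted-hermitian : ∀ x y → conj (N x y) ≈ N y x
    twisted-hermitian x y with x ≟ y
    ... | yes ≡.refl = trans conj-1 (sym (twisted-diag x))
    ... | no x≢y     = trans (conj-sgn t _) (trans (sgn-cong ring t (Adj-hermitian x y))
                         (reflexive (≡.sym (twisted-off (≢-sym x≢y)))))

    adjacent⇒≢ : ∀ {x y} → adj x y ≡ true → x ≢ y
    adjacent⇒≢ {x} xy ≡.refl with () ← ≡.trans (≡.sym xy) (irrefl x)

    twisted-adjacent : ∀ {x y} → adj x y ≡ true → N x y ≈ sgn ring t (φ x y)
    twisted-adjacent xy = trans (reflexive (twisted-off (adjacent⇒≢ xy)))
      (sgn-cong ring t (reflexive (Adj-adjacent xy)))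

    twisted-unit : ∀ {x y} → Adjacent G (x , y) → N x y * N y x ≈ 1# × N y x * N x y ≈ 1#
    twisted-unit {x} {y} xy = pair xy yx (proj₂ (inv x y xy)) , pair yx xy (proj₁ (inv x y xy))
      where
      yx : adj y x ≡ true
      yx = ≡.trans (adj-sym y x) xy
      pair : ∀ {a b} → adj a b ≡ true → adj b a ≡ true → φ a b * φ b a ≈ 1# → N a b * N b a ≈ 1#
      pair ab ba eq = trans (*-cong (twisted-adjacent ab) (twisted-adjacent ba))
        (trans (sgn-* ring t t _ _) (trans (reflexive (sgn-+ ring t t _)) (trans (sgn-double ring t _) eq)))

    twisted-path : ∀ x l {z} → All (Adjacent G) (pathE x l z) →
      walkProd D N (pathE x l z) ≈ sgn ring (length (x ∷ l) *ℕ t) (closedProd z (x ∷ l))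
    twisted-path x [] (xz ∷ []) = trans (*-identityʳ _) (trans (twisted-adjacent xz)
      (reflexive (≡.cong (λ e → sgn ring e _) (≡.sym (ℕ.+-identityʳ t)))))
    twisted-path x (y ∷ l) (xy ∷ adj) = trans (*-cong (twisted-adjacent xy) (twisted-path y l adj))
      (sgn-* ring t (length (y ∷ l) *ℕ t) _ _)

    w : Elem n → K.Carrier
    w = weight K D conj re emb isStar {M = N} twisted-diag twisted-hermitian

    weight-cycle : ∀ u us → ElemWF G (cyc (u ∷ us)) →
      w (cyc (u ∷ us)) K.≈ sgn K.ring (length (u ∷ us) *ℕ t) (elemR (cyc (u ∷ us)) K.+ elemR (cyc (u ∷ us)))
    weight-cycle u us (_ , _ , adjacent) = K.trans (K.+-cong half half) (sgn-additive (length (u ∷ us) *ℕ t) _)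
      where
      half : re (walkProd D N (edges (u , us))) K.≈ sgn K.ring (length (u ∷ us) *ℕ t) (elemR (cyc (u ∷ us)))
      half = K.trans (re-cong (twisted-path u us (≡.subst (All (Adjacent G)) (cycEdges≡ u us) adjacent)))
        (K.trans (re-sgn (length (u ∷ us) *ℕ t) _)
          (K.reflexive (≡.cong (λ p → sgn K.ring (length (u ∷ us) *ℕ t) (re p)) (≡.sym (walkGain≡closedProd u us)))))
      sgn-additive : ∀ e x → sgn K.ring e x K.+ sgn K.ring e x K.≈ sgn K.ring e (x K.+ x)
      sgn-additive zero    x = K.refl
      sgn-additive (suc e) x = K.trans (RingProperties.-‿+-comm K.ring _ _) (K.-‿cong (sgn-additive e x))

    weights : (B : Basic n) → All (ElemWF G) B →
      RR.prodL K.rawRing (map w B) K.≈ sgn K.ring (nVerts B *ℕ t) (pow2 (cB B) K.* RB B)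
    weights [] [] = K.sym (K.*-identityˡ _)
    weights (k2 u v ∷ B) (_ ∷ wf) = K.trans (K.*-identityˡ _) (K.trans (weights B wf)
      (K.trans (K.sym (sgn-double K.ring t _)) (K.reflexive (≡.sym (≡.trans (sgn-+ K.ring t (t +ℕ nVerts B *ℕ t) _)
        (≡.cong (sgn K.ring t) (sgn-+ K.ring t (nVerts B *ℕ t) _)))))))
    weights (cyc [] ∷ B) ((() , _) ∷ _)
    weights (cyc l@(u ∷ us) ∷ B) (w ∷ wf) = K.trans (K.*-cong (weight-cycle u us w) (weights B wf))
      (K.trans (sgn-* K.ring (length l *ℕ t) (nVerts B *ℕ t) _ _)
      (K.trans (K.reflexive (≡.cong (λ e → sgn K.ring e ((elemR (cyc l) K.+ elemR (cyc l)) K.* (pow2 (cB B) K.* RB B))) (≡.trans (≡.sym (ℕ.*-distribʳ-+ t (length l) (nVerts B)))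
        (≡.cong (_*ℕ t) (≡.sym (List.length-++ l))))))
      (sgn-cong K.ring (nVerts (cyc l ∷ B) *ℕ t) (regroup (elemR (cyc l)) (pow2 (cB B)) (RB B)))))
      where
      regroup : ∀ r p b → (r K.+ r) K.* (p K.* b) K.≈ ((K.1# K.+ K.1#) K.* p) K.* (r K.* b)
      regroup = solve 3 (λ r p b → (r :+ r) :* (p :* b) := ((con 1 :+ con 1) :* p) :* (r :* b)) K.refl
        where open SemiringSolver K.commutativeSemiring using (solve; _:+_; _:*_; _:=_; con)

    basic-sum : (B : Basic n) → BasicWF G B →
      sumL (map (λ ds → signed (lookup (toVec ds)) (mσ N (lookup (toVec ds)))) (orientations B))
        ≈ emb (sgn K.ring (nVerts B +ℕ pB B) (sgn K.ring (nVerts B *ℕ t) (pow2 (cB B) K.* RB B)))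
    basic-sum B wf = begin
      sumL (map (λ ds → signed (lookup (toVec ds)) (mσ N (lookup (toVec ds)))) (orientations B))
        ≈⟨ sumL-cong ring (orientations B) (λ ds∈ → same-sign (∈-orientations⁻ B ds∈)) ⟩
      sumL (map (λ ds → sgn ring e (mσ N (lookup (toVec ds)))) (orientations B))
        ≈⟨ sgn-sumL ring e _ (orientations B) ⟩
      sgn ring e (sumL (map (λ ds → mσ N (lookup (toVec ds))) (orientations B)))
        ≈⟨ sgn-cong ring e (orientation-sum K D conj re emb isStar twisted-diag twisted-hermitian {G} twisted-unit B wf) ⟩
      sgn ring e (emb (RR.prodL K.rawRing (map w B)))
        ≈⟨ sgn-cong ring e (emb-cong (weights B (proj₁ wf))) ⟩
      sgn ring e (emb (sgn K.ring (nVerts B *ℕ t) (pow2 (cB B) K.* RB B)))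
        ≈⟨ emb-sgn e _ ⟨
      emb (sgn K.ring e (sgn K.ring (nVerts B *ℕ t) (pow2 (cB B) K.* RB B))) ∎
      where
      e = nVerts B +ℕ pB B
      same-sign : ∀ {ds x} → Oriented ds B → signed (lookup (toVec ds)) x ≈ sgn ring e x
      same-sign {ds} {x} o = trans (signed≈sgn ring (toVec-decomposes (oriented-wellFormed {G = G} wf o)) x)
        (reflexive (≡.cong₂ (λ a b → sgn ring (a +ℕ b) x) (Perm.↭-length (oriented-verts o)) (Pointwise-length o)))

  term≈ : ∀ e B → term e B K.≈ sgn K.ring e (pow2 (cB B) K.* RB B)
  term≈ e B with isEven e | if-isEven≈sgn K.ring e (pow2 (cB B) K.* RB B)
  ... | true  | p = p
  ... | false | p = p

  signed-zero : {ds : List (Cycle n)} {σ : Fin n → Fin n} → Decomposes ds σ → ∀ {x} → x ≈ 0# → signed σ x ≈ 0#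
  signed-zero {ds} {σ} d p = trans (signed≈sgn ring d _)
    (trans (sgn-cong ring (length (V ds) +ℕ length ds) p) (sgn-0 ring (length (V ds) +ℕ length ds)))

  oriented-length : {B : Basic n} {ds : List (Cycle n)} {i : ℕ} → nVerts B ≡ i → Oriented ds B → length (V ds) ≡ i
  oriented-length eq o = ≡.trans (Perm.↭-length (oriented-verts o)) eq

  Mdet-adjMat : ∀ L → Enumerates𝓑 G n L → Mdet n Adj ≈ emb (basicSum n L)
  Mdet-adjMat L enum = begin
    Mdet n Adj
      ≈⟨ perms-sum ring {G = G} enum (λ σ → signed σ (mσ Adj σ)) vanish ⟩
    sumL (map (λ B → sumL (map (λ ds → signed (lookup (toVec ds)) (mσ Adj (lookup (toVec ds)))) (orientations B))) L)
      ≈⟨ sumL-cong ring L (λ {B} B∈ → per-basic B (proj₁ (All.lookup (proj₁ enum) B∈)) (proj₂ (All.lookup (proj₁ enum) B∈))) ⟩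
    sumL (map (λ B → emb (term (n +ℕ pB B) B)) L)
      ≈⟨ emb-sumL _ L ⟨
    emb (basicSum n L) ∎
    where
    vanish : ∀ {ds σ} → Decomposes ds σ → (All (Adjacent G) (E ds) → length (V ds) ≢ n) → signed σ (mσ Adj σ) ≈ 0#
    vanish {ds} {σ} d bad = signed-zero d (by (All.all? (λ (x , y) → adj x y Bool.≟ true) (E ds)))
      where
      by : Dec (All (Adjacent G) (E ds)) → mσ Adj σ ≈ 0#
      by (yes good) = let x , x∉ = uncovered (Decomposes.wellFormed d) (bad good) in
        mσ-zero ring d x (reflexive (≡.trans (≡.cong (Adj x) (Decomposes.fixes d x∉)) (Adj-nonadjacent (irrefl x))))
      by (no ¬good) = let x , y , e∈ , xy = non-adjacent G (E ds) ¬good in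
        mσ-zero ring d x (reflexive (≡.trans (≡.cong (Adj x) (Decomposes.follows d e∈)) (Adj-nonadjacent xy)))
    per-basic : ∀ B → BasicWF G B → nVerts B ≡ n →
      sumL (map (λ ds → signed (lookup (toVec ds)) (mσ Adj (lookup (toVec ds)))) (orientations B)) ≈ emb (term (n +ℕ pB B) B)
    per-basic B wf len = begin
      sumL (map (λ ds → signed (lookup (toVec ds)) (mσ Adj (lookup (toVec ds)))) (orientations B))
        ≈⟨ sumL-cong ring (orientations B) (λ {ds} ds∈ → signed-cong ring (lookup (toVec ds)) (untwist (∈-orientations⁻ B ds∈))) ⟩
      sumL (map (λ ds → signed (lookup (toVec ds)) (mσ (twisted 0) (lookup (toVec ds)))) (orientations B))
        ≈⟨ basic-sum 0 B wf ⟩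
      emb (sgn K.ring (nVerts B +ℕ pB B) (sgn K.ring (nVerts B *ℕ 0) (pow2 (cB B) K.* RB B)))
        ≡⟨ ≡.cong₂ (λ a b → emb (sgn K.ring (a +ℕ pB B) (sgn K.ring b (pow2 (cB B) K.* RB B)))) len (ℕ.*-zeroʳ (nVerts B)) ⟩
      emb (sgn K.ring (n +ℕ pB B) (pow2 (cB B) K.* RB B))
        ≈⟨ emb-cong (term≈ (n +ℕ pB B) B) ⟨
      emb (term (n +ℕ pB B) B) ∎
      where
      untwist : ∀ {ds} → Oriented ds B → mσ Adj (lookup (toVec ds)) ≈ mσ (twisted 0) (lookup (toVec ds))
      untwist {ds} o = mσ-cong D *-isMonoid (λ x → reflexive (≡.sym (twisted-off 0 (≢-sym (moves d
        (covered (Decomposes.wellFormed d) (oriented-length len o) x))))))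
        where
        d : Decomposes ds (lookup (toVec ds))
        d = toVec-decomposes (oriented-wellFormed {G = G} wf o)

  private
    xI-A : Fin n → Fin n → ℕ → Carrier
    xI-A i j = RawRing._+_ (PolyRing D) (if i == j then PolyOps.X D else RawRing.0# (PolyRing D))
      (RawRing.-_ (PolyRing D) (PolyOps.constP D (Adj i j)))

  xI-A-monomial : ∀ x y → Monomial ring (xI-A x y) (loops x y) (twisted 1 x y)
  xI-A-monomial x y with x ≟ y
  ... | yes ≡.refl = +-neg-0 refl , λ
    { zero _ → +-neg-0 (reflexive (Adj-nonadjacent (irrefl x)))
    ; (suc zero) 1≢1 → ⊥-elim (1≢1 ≡.refl)
    ; (suc (suc j)) _ → +-neg-0 refl }
    where
    +-neg-0 : ∀ {a b} → b ≈ 0# → a + - b ≈ a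
    +-neg-0 b≈0 = trans (+-congˡ (trans (-‿cong b≈0) -0#≈0#)) (+-identityʳ _)
  ... | no _ = +-identityˡ _ , λ
    { zero 0≢0 → ⊥-elim (0≢0 ≡.refl)
    ; (suc j) _ → trans (+-identityˡ _) -0#≈0# }

  charPoly-coefficient : ∀ i → i ≤ n → ∀ L → Enumerates𝓑 G i L → charPoly k Φ (n ∸ i) ≈ emb (basicSum 0 L)
  charPoly-coefficient i i≤n L enum = begin
    charPoly k Φ (n ∸ i)
      ≡⟨ Mdet-coefficient ring xI-A (n ∸ i) ⟩
    sumL (map (λ σ → signed σ (coeff σ)) (perms n))
      ≈⟨ perms-sum ring {G = G} enum (λ σ → signed σ (coeff σ)) vanish ⟩
    sumL (map (λ B → sumL (map (λ ds → signed (lookup (toVec ds)) (coeff (lookup (toVec ds)))) (orientations B))) L)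
      ≈⟨ sumL-cong ring L (λ {B} B∈ → per-basic B (proj₁ (All.lookup (proj₁ enum) B∈)) (proj₂ (All.lookup (proj₁ enum) B∈))) ⟩
    sumL (map (λ B → emb (term (pB B) B)) L)
      ≈⟨ emb-sumL _ L ⟨
    emb (basicSum 0 L) ∎
    where
    coeff : (Fin n → Fin n) → Carrier
    coeff σ = MooreDet.mσ (PolyRing D) xI-A σ (n ∸ i)
    monomial : ∀ σ → Monomial ring (MooreDet.mσ (PolyRing D) xI-A σ) (exponent σ) (mσ (twisted 1) σ)
    monomial σ = mσ-monomial ring (λ x → xI-A-monomial x (σ x))
    vanish : ∀ {ds σ} → Decomposes ds σ → (All (Adjacent G) (E ds) → length (V ds) ≢ i) → signed σ (coeff σ) ≈ 0#
    vanish {ds} {σ} d bad = signed-zero d (by (n ∸ i ℕ.≟ exponent σ) (All.all? (λ (x , y) → adj x y Bool.≟ true) (E ds)))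
      where
      by : Dec (n ∸ i ≡ exponent σ) → Dec (All (Adjacent G) (E ds)) → coeff σ ≈ 0#
      by (no ne) _ = proj₂ (monomial σ) (n ∸ i) ne
      by (yes eq) (yes good) = ⊥-elim (bad good (ℕ.+-cancelˡ-≡ (n ∸ i) _ _ (≡.trans
        (≡.cong (_+ℕ length (V ds)) eq) (≡.trans (exponent-count ds d) (≡.sym (ℕ.m∸n+n≡m i≤n))))))
      by (yes eq) (no ¬good) = let x , y , e∈ , xy = non-adjacent G (E ds) ¬good in begin
        coeff σ                                            ≡⟨ ≡.cong (MooreDet.mσ (PolyRing D) xI-A σ) eq ⟩
        MooreDet.mσ (PolyRing D) xI-A σ (exponent σ)       ≈⟨ proj₁ (monomial σ) ⟩
        mσ (twisted 1) σ                                   ≈⟨ mσ-zero ring d x (begin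
          twisted 1 x (σ x)     ≡⟨ ≡.cong (twisted 1 x) (Decomposes.follows d e∈) ⟩
          twisted 1 x y         ≡⟨ twisted-off 1 (E-irreflexive ds (Decomposes.wellFormed d) e∈) ⟩
          - Adj x y             ≡⟨ ≡.cong -_ (Adj-nonadjacent xy) ⟩
          - 0#                  ≈⟨ -0#≈0# ⟩
          0#                    ∎) ⟩
        0# ∎
    per-basic : ∀ B → BasicWF G B → nVerts B ≡ i →
      sumL (map (λ ds → signed (lookup (toVec ds)) (coeff (lookup (toVec ds)))) (orientations B)) ≈ emb (term (pB B) B)
    per-basic B wf len = begin
      sumL (map (λ ds → signed (lookup (toVec ds)) (coeff (lookup (toVec ds)))) (orientations B))
        ≈⟨ sumL-cong ring (orientations B) (λ {ds} ds∈ → signed-cong ring (lookup (toVec ds)) (leading (∈-orientations⁻ B ds∈))) ⟩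
      sumL (map (λ ds → signed (lookup (toVec ds)) (mσ (twisted 1) (lookup (toVec ds)))) (orientations B))
        ≈⟨ basic-sum 1 B wf ⟩
      emb (sgn K.ring (nVerts B +ℕ pB B) (sgn K.ring (nVerts B *ℕ 1) x))
        ≡⟨ ≡.cong₂ (λ a b → emb (sgn K.ring a (sgn K.ring b x))) (ℕ.+-comm (nVerts B) (pB B)) (ℕ.*-identityʳ (nVerts B)) ⟩
      emb (sgn K.ring (pB B +ℕ nVerts B) (sgn K.ring (nVerts B) x))
        ≡⟨ ≡.cong emb (sgn-+ K.ring (pB B) (nVerts B) _) ⟩
      emb (sgn K.ring (pB B) (sgn K.ring (nVerts B) (sgn K.ring (nVerts B) x)))
        ≈⟨ emb-cong (sgn-cong K.ring (pB B) (sgn-double K.ring (nVerts B) x)) ⟩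
      emb (sgn K.ring (pB B) x)
        ≈⟨ emb-cong (term≈ (pB B) B) ⟨
      emb (term (pB B) B) ∎
      where
      x = pow2 (cB B) K.* RB B
      leading : ∀ {ds} → Oriented ds B → coeff (lookup (toVec ds)) ≈ mσ (twisted 1) (lookup (toVec ds))
      leading {ds} o = trans (reflexive (≡.cong (MooreDet.mσ (PolyRing D) xI-A σ) (≡.sym exponent≡)))
        (proj₁ (monomial σ))
        where
        σ = lookup (toVec ds)
        d : Decomposes ds σ
        d = toVec-decomposes (oriented-wellFormed {G = G} wf o)
        exponent≡ : exponent σ ≡ n ∸ i
        exponent≡ = ≡.trans (≡.sym (ℕ.m+n∸n≡m (exponent σ) i)) (≡.cong (_∸ i)
          (≡.trans (≡.cong (exponent σ +ℕ_) (≡.sym (oriented-length len o))) (exponent-count ds d)))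

theorem5p2 : ∀ {c ℓ : Level} (R : CommutativeRing c ℓ) (k : Algebras.Kind R)
    (n : ℕ) (G : SimpleGraph n) (Φ : GainGraphs.GainGraph R k G) →
    (∀ (L : List (Basic n)) → Enumerates𝓑 G n L →
    RawRing._≈_ (GainGraphs.DG R k)
    (MooreDet.Mdet (GainGraphs.DG R k) n (GainGraphs.adjMat R k Φ))
    (Algebras.dualEmb R (Algebras.𝔾 R k) (Terms.basicSum R Φ n L)))
    × (∀ (i : ℕ) → 1 ≤ i → i ≤ n → ∀ (L : List (Basic n)) → Enumerates𝓑 G i L →
    RawRing._≈_ (GainGraphs.DG R k)
    (GainGraphs.charPoly R k Φ (n ∸ i))
    (Algebras.dualEmb R (Algebras.𝔾 R k) (Terms.basicSum R Φ 0 L)))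
theorem5p2 R k n G Φ = Mdet-adjMat R k Φ , λ i _ → charPoly-coefficient R k Φ i
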